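{- Let $k$ be a positive integer. Let $(G,\sigma)$ be a $(2k+1)$-unbalanced, $(12k-1)$-edge connected signed graph. Then for every mapping $\beta:V(G)\to\mathbb{Z}_{2k+1}$, the signed graph $(G,\sigma)$ has a $\beta$-orientation.
   Context: A signed graph is a pair $(G,\sigma)$ where $G$ is a graph and $\sigma:E(G)\to\{1,-1\}$; edges with $\sigma(e)=1$ are positive, those with $\sigma(e)=-1$ negative. An orientation $\tau$ of $(G,\sigma)$ orients each positive edge $e=xy$ from one end to the other (if from $x$ to $y$, then $e\in E^+_\tau(x)\cap E^-_\tau(y)$), and labels each negative edge $e=xy$ either as a sink edge, with $e\in E^+_\tau(x)\cap E^+_\tau(y)$, or as a source edge, with $e\in E^-_\tau(x)\cap E^-_\tau(y)$. Write $d^+_\tau(x)=|E^+_\tau(x)|$ and $d^-_\tau(x)=|E^-_\tau(x)|$. Given $\beta:V(G)\to\mathbb{Z}_{2k+1}$, a $\beta$-orientation is an orientation $\tau$ with $d^+_\tau(x)-d^-_\tau(x)\equiv\beta(x)\pmod{2k+1}$ for every vertex $x$. Switching at a vertex $v$ negates the sign of every edge incident to $v$. Two signed graphs on the same underlying graph are equivalent if one is obtained from the other by a sequence of switchings. $(G,\sigma)$ is $(2k+1)$-unbalanced if every signed graph equivalent to it has at least $2k+1$ negative edges. Edge connectivity refers to $G$. -}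

module Defs where

open import Data.Bool.Base using (if_then_else_)
open import Data.Fin.Base using (Fin; toℕ)
open import Data.Fin.Properties using (_≟_)
open import Data.Fin.Subset using (Subset; ∣_∣; _∉_)
open import Data.Integer.Base using (+_) renaming (_-_ to _-ℤ_)
open import Data.Integer.Divisibility using () renaming (_∣_ to _∣ℤ_)
open import Data.List.Base using (foldl)
open import Data.Nat.Base using (ℕ; _+_; _<_; _≤_)
open import Data.Product.Base using (_×_; ∃-syntax)
open import Data.Sign.Base using (Sign; _*_)
import Data.Sign.Properties as Sign
open import Data.Sum.Base using (_⊎_)
open import Data.Vec.Base using (allFin; count)
open import Relation.Binary.Construct.Closure.ReflexiveTransitive using (Star)
open import Relation.Binary.PropositionalEquality using (_≡_; _≗_)
open import Relation.Nullary.Decidable using (_×-dec_; ⌊_⌋)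

-- Finite multigraphs; parallel edges and loops are allowed. The order in which
-- the two ends of an edge are listed carries no meaning.
record Graph : Set where
  field
    order : ℕ
    size  : ℕ
  Vertex : Set
  Vertex = Fin order
  Edge : Set
  Edge = Fin size
  field
    end₁ : Edge → Vertex
    end₂ : Edge → Vertex

  Joins : Edge → Vertex → Vertex → Set
  Joins e u v = (end₁ e ≡ u × end₂ e ≡ v) ⊎ (end₁ e ≡ v × end₂ e ≡ u)

  ConnectedWithout : Subset size → Set
  ConnectedWithout F = ∀ u v → Star (λ x y → ∃[ e ] (e ∉ F × Joins e x y)) u v

  -- The one-vertex graph counts as l-edge-connected for every l.
  EdgeConnected : ℕ → Set
  EdgeConnected l = ∀ (F : Subset size) → ∣ F ∣ < l → ConnectedWithout F

  Signature : Set
  Signature = Edge → Sign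

  negativeEdges : Signature → ℕ
  negativeEdges σ = count (λ e → σ e Sign.≟ Sign.-) (allFin size)

  -- The sign of e is negated once for each end of e at v, so that a loop at v
  -- (the only case in which this happens twice) keeps its sign, as is usual for
  -- signed graphs.
  switch : Signature → Vertex → Signature
  switch σ v e = (negateAt (end₁ e) * negateAt (end₂ e)) * σ e
    where
    negateAt : Vertex → Sign
    negateAt u = if ⌊ u ≟ v ⌋ then Sign.- else Sign.+

  Equivalent : Signature → Signature → Set
  Equivalent σ σ′ = ∃[ vs ] (foldl switch σ vs ≗ σ′)

  Unbalanced : ℕ → Signature → Set
  Unbalanced l σ = ∀ σ′ → Equivalent σ σ′ → l ≤ negativeEdges σ′

-- The ways to orient an edge of the given sign.
data EdgeOrientation : Sign → Set where
  1→2 2→1     : EdgeOrientation Sign.+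
  sink source : EdgeOrientation Sign.-

-- mark₁ o is + if the edge belongs to E⁺ of its first end, and - if it belongs
-- to E⁻ of its first end; similarly mark₂ for the second end. A positive edge
-- oriented from x to y is in E⁺(x) and E⁻(y), a sink edge xy in E⁺(x) and E⁺(y).
mark₁ mark₂ : ∀ {s} → EdgeOrientation s → Sign
mark₁ 1→2    = Sign.+
mark₁ 2→1    = Sign.-
mark₁ sink   = Sign.+
mark₁ source = Sign.-
mark₂ 1→2    = Sign.-
mark₂ 2→1    = Sign.+
mark₂ sink   = Sign.+
mark₂ source = Sign.-

record SignedGraph : Set where
  field
    graph : Graph
  open Graph graph public
  field
    σ : Signature

  Orientation : Set
  Orientation = (e : Edge) → EdgeOrientation (σ e)

  -- The number of edges in E⁺(x) (for s = +) or E⁻(x) (for s = -), where a loop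
  -- is counted once for each of its two ends.
  degree : Sign → Orientation → Vertex → ℕ
  degree s τ x =
      count (λ e → (end₁ e ≟ x) ×-dec (mark₁ (τ e) Sign.≟ s)) (allFin size)
    + count (λ e → (end₂ e ≟ x) ×-dec (mark₂ (τ e) Sign.≟ s)) (allFin size)

  d⁺ d⁻ : Orientation → Vertex → ℕ
  d⁺ = degree Sign.+
  d⁻ = degree Sign.-

  -- ℤₙ is represented by its residues Fin n.
  IsβOrientation : ∀ {n} → (Vertex → Fin n) → Orientation → Set
  IsβOrientation {n} β τ =
    ∀ x → (+ n) ∣ℤ ((+ d⁺ τ x -ℤ + d⁻ τ x) -ℤ + toℕ (β x))

{-# OPTIONS --safe #-}

-- Put q = 2k + 1.  Among the signatures equivalent to σ choose one with as few
-- negative edges as possible.  Then at least half of the edges of every cut are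
-- positive, so the positive edges form a 6k-edge-connected graph, and since there
-- are at least q negative edges, these can be oriented in such a way that the
-- demands left for the positive edges sum to 0 modulo q.  Now the theorem of Lovász,
-- Thomassen, Wu and Zhang on orientations modulo q of 6k-edge-connected graphs applies.
--
-- Their theorem is proved by induction on a stronger statement, in which the edges
-- at a vertex z₀ of bounded degree are already oriented.  Relative to some initial
-- orientation, a solution is a flow of reversals, and for every set A of vertices
-- avoiding z₀ it is assumed that the number of reversals required at A lies,
-- modulo q, in the window from (q - 1) - out(A) to in(A) - (q - 1).
-- If a set of several vertices is at an end of its window, contract it, and
-- afterwards solve the problem inside the set with everything outside fixed.
-- If a vertex is in the middle of its window, split off its edges in pairs.
-- If one end of an edge may move down in its window and the other one up, orient
-- and delete this edge.  Otherwise all vertices are stuck at the same end of their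
-- windows.  Then adding q parallel edges from z₀ to a vertex, which do not matter
-- modulo q, or q - 1 such edges instead of one to z₀, brings this vertex to the
-- other end.
--
-- All case distinctions are made under a double negation, which is removed in the
-- end because a finite search decides whether there is a solution.
module Submission where

open import Data.Bool.Base using (Bool; true; false; not; _∧_; _∨_; _xor_; if_then_else_)
open import Data.Bool.Properties using (not-involutive; ∨-comm; ∧-comm) renaming (_≟_ to _≟ᵇ_)
open import Data.Empty using (⊥; ⊥-elim)
open import Data.Fin.Base using (Fin; zero; suc; toℕ; splitAt; _↑ˡ_; _↑ʳ_)
open import Data.Fin.Properties using (_≟_; any?; all?; splitAt-↑ˡ; splitAt-↑ʳ)
open import Data.Fin.Subset using (Subset; _∉_) renaming (∣_∣ to ∣_∣ˢ)
open import Data.Integer.Base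
  using (ℤ; +_; 0ℤ; 1ℤ; -1ℤ; _+_; _*_; -_; _-_; _⊓_; _≤_; _<_; +≤+; +<+; ∣_∣; _%ℕ_; _/ℕ_)
open import Data.Integer.DivMod using (a≡a%ℕn+[a/ℕn]*n; n%ℕd<d)
import Data.Integer.Divisibility.Signed as Signed
import Data.Integer.Properties as ℤ
open import Data.Integer.Tactic.RingSolver using (solve-∀)
open import Data.List.Base as List using (List; []; _∷_; foldl)
open import Data.List.Properties using (foldl-++)
open import Data.Nat.Base as ℕ using (ℕ; zero; suc; NonZero; z≤n; s≤s)
open import Data.Nat.Induction using (<-rec)
import Data.Nat.Properties as ℕ
open import Data.Product.Base using (_×_; _,_; ∃₂; ∃-syntax; proj₁; proj₂)
open import Data.Sign.Base as Sign using (Sign)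
import Data.Sign.Properties as Sign
open import Data.Sum.Base using (_⊎_; inj₁; inj₂)
open import Data.Vec.Base using (allFin; count; tabulate)
open import Data.Vec.Properties using (lookup∘tabulate; lookup⇒[]=)
open import Function.Base using (_∘_; _$_; case_of_; id)
open import Relation.Binary.Construct.Closure.ReflexiveTransitive using (Star; ε; _◅_)
open import Relation.Binary.PropositionalEquality
open import Relation.Nullary using (¬_; Dec; yes; no; contradiction)
open import Relation.Nullary.Decidable using (⌊_⌋; does; map′; decidable-stable; _×-dec_; ¬?)
open import Relation.Unary using (Decidable)
open import Defs
open import Algebra.Properties.Semiring.Sum ℤ.+-*-semiring
  using (sum; sum-cong-≗; ∑-distrib-+; *-distribˡ-sum; sum-replicate-zero; ∑-comm)

-- Integers and sums over darts

-- A set with capacity o leaving and i entering can only meet a demand that has a representative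
-- modulo q between -o and i. The windows keep a margin p = q - 1 at both ends; if o + i is at least
-- 3p = 6k, they still contain q consecutive integers, hence every residue, and 6k is half of 12k -
-- 1, rounded up. The margin pays for the reductions: for a set affected by it, deleting an edge
-- costs a unit at one end, splitting off a pair a unit at both. In a minimal counterexample the
-- sets of several vertices have a unit to spare at both ends, so only single vertices can obstruct.
-- Splitting off pair after pair eventually violates the condition at the vertex itself. Therefore
-- one vertex `v₀` may be exempt from it, provided that it is in the middle of its window, where
-- both ends approach it equally fast. Once all its edges lead to one neighbour, they can meet its
-- demand, and it is contracted. Moving a vertex to the other end of its window adds edges at z₀;
-- this is why the capacity at z₀ comes last in the induction.

infixl 6 _⊕_

_⊕_ : ∀ {a b} → 0ℤ ≤ a → 0ℤ ≤ b → 0ℤ ≤ a + b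
_⊕_ = ℤ.+-mono-≤

gap : ∀ {i j} → i ≤ j → 0ℤ ≤ j - i
gap = ℤ.i≤j⇒0≤j-i

-- Opaque, since evaluating the ring identities passed here would be expensive.
opaque
  by-gap : ∀ {i j s} → 0ℤ ≤ s → s ≡ j - i → i ≤ j
  by-gap 0≤s eq = ℤ.0≤i-j⇒j≤i (subst (0ℤ ≤_) eq 0≤s)

  absurd-gap : ∀ {s} → 0ℤ ≤ s → s ≡ -1ℤ → ⊥
  absurd-gap 0≤s refl = case 0≤s of λ ()

by-cases : ∀ {a} {A : Set a} → (A → ⊥) → (¬ A → ⊥) → ⊥
by-cases f g = g f

≰⇒1+≤ : ∀ {i j} → ¬ i ≤ j → 1ℤ + j ≤ i
≰⇒1+≤ i≰j = ℤ.i<j⇒suc[i]≤j (ℤ.≰⇒> i≰j)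

0≤*0≤ : ∀ {a b} → 0ℤ ≤ a → 0ℤ ≤ b → 0ℤ ≤ a * b
0≤*0≤ {+ a} {+ b} _ _ = subst (0ℤ ≤_) (ℤ.pos-* a b) (+≤+ z≤n)

-- Double negation shift holds over a finite type; it lets `unbalanced` classify all vertices at
-- once.
¬¬-∀ : ∀ {n} {P : Fin n → Set} → (∀ i → ¬ ¬ P i) → ¬ ¬ (∀ i → P i)
¬¬-∀ {zero}  f k = k λ ()
¬¬-∀ {suc n} f k = f zero λ p₀ → ¬¬-∀ (f ∘ suc) λ p → k λ { zero → p₀ ; (suc i) → p i }

𝟙 : Bool → ℤ
𝟙 true  = 1ℤ
𝟙 false = 0ℤ

0≤𝟙 : ∀ b → 0ℤ ≤ 𝟙 b
0≤𝟙 true  = +≤+ z≤n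
0≤𝟙 false = +≤+ z≤n

0≤1-𝟙 : ∀ b → 0ℤ ≤ 1ℤ - 𝟙 b
0≤1-𝟙 true  = +≤+ z≤n
0≤1-𝟙 false = +≤+ z≤n

sum-zero : ∀ {n} {f : Fin n → ℤ} → (∀ i → f i ≡ 0ℤ) → sum f ≡ 0ℤ
sum-zero {n} eq = trans (sum-cong-≗ eq) (sum-replicate-zero n)

0≤sum : ∀ {n} {f : Fin n → ℤ} → (∀ i → 0ℤ ≤ f i) → 0ℤ ≤ sum f
0≤sum {zero}  h = +≤+ z≤n
0≤sum {suc n} h = h zero ⊕ 0≤sum (h ∘ suc)

-- The dart (e , b) is the edge e, traversed from its end b to its end not b.
Darts : Set → ℕ → Set
Darts A m = Fin m → Bool → A

opaque
  S : ∀ {m} → Darts ℤ m → ℤ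
  S f = sum (λ e → f e true + f e false)

  S-suc : ∀ {m} (f : Darts ℤ (suc m)) → S f ≡ f zero true + f zero false + S (f ∘ suc)
  S-suc f = refl

  S-empty : (f : Darts ℤ zero) → S f ≡ 0ℤ
  S-empty f = refl

  S-++ : ∀ a {b} (f : Darts ℤ (a ℕ.+ b)) → S f ≡ S (f ∘ (_↑ˡ b)) + S (f ∘ (a ↑ʳ_))
  S-++ zero    f = sym (ℤ.+-identityˡ (S f))
  S-++ (suc a) f = trans
    (cong (λ r → f zero true + f zero false + r) (S-++ a (f ∘ suc)))
    (sym (ℤ.+-assoc (f zero true + f zero false) _ _))

  -- The two darts of an edge are compared jointly, because the cancellation in an antisymmetric
  -- function is visible only in the pair.
  S-pairwise : ∀ {m} {f g : Darts ℤ m} →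
    (∀ e → f e true + f e false ≡ g e true + g e false) → S f ≡ S g
  S-pairwise {_} {f} {g} = sum-cong-≗ {x = λ e → f e true + f e false} {y = λ e → g e true + g e false}

  S-antisym : ∀ {m} {f : Darts ℤ m} → (∀ e → f e true + f e false ≡ 0ℤ) → S f ≡ 0ℤ
  S-antisym {f = f} = sum-zero {f = λ e → f e true + f e false}

  S-reverse : ∀ {m} (f : Darts ℤ m) → S (λ e b → f e (not b)) ≡ S f
  S-reverse f = sum-cong-≗ λ e → ℤ.+-comm (f e false) (f e true)

  S-distrib-+ : ∀ {m} (f g : Darts ℤ m) → S (λ e b → f e b + g e b) ≡ S f + S g
  S-distrib-+ f g = trans
    (sum-cong-≗ λ e → interchange (f e true) (g e true) (f e false) (g e false))
    (∑-distrib-+ (λ e → f e true + f e false) (λ e → g e true + g e false))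
    where
    interchange : ∀ a b c d → (a + b) + (c + d) ≡ (a + c) + (b + d)
    interchange = solve-∀

  S-distribˡ-* : ∀ {m} k (f : Darts ℤ m) → S (λ e b → k * f e b) ≡ k * S f
  S-distribˡ-* k f = sym $ trans
    (*-distribˡ-sum k (λ e → f e true + f e false))
    (sum-cong-≗ λ e → ℤ.*-distribˡ-+ k (f e true) (f e false))

  0≤S : ∀ {m} {f : Darts ℤ m} → (∀ e b → 0ℤ ≤ f e b) → 0ℤ ≤ S f
  0≤S h = 0≤sum λ e → h e true ⊕ h e false

module _ {m : ℕ} where

  S-cong : {f g : Darts ℤ m} → (∀ e b → f e b ≡ g e b) → S f ≡ S g
  S-cong eq = S-pairwise λ e → cong₂ _+_ (eq e true) (eq e false)

  S-zero : {f : Darts ℤ m} → (∀ e b → f e b ≡ 0ℤ) → S f ≡ 0ℤ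
  S-zero eq = S-antisym λ e → cong₂ _+_ (eq e true) (eq e false)

  S-split : {f : Darts ℤ m} (g h : Darts ℤ m) → (∀ e b → f e b ≡ g e b + h e b) → S f ≡ S g + S h
  S-split g h eq = trans (S-cong eq) (S-distrib-+ g h)

  S-minus : {f : Darts ℤ m} (g h : Darts ℤ m) → (∀ e b → f e b ≡ g e b - h e b) → S f ≡ S g - S h
  S-minus g h eq = trans
    (S-split g (λ e b → - 1ℤ * h e b) (λ e b → trans (eq e b) (cong (λ r → g e b + r) (neg (h e b)))))
    (cong (λ r → S g + r) (trans (S-distribˡ-* (- 1ℤ) h) (sym (neg (S h)))))
    where
    neg : ∀ a → - a ≡ - 1ℤ * a
    neg = solve-∀

δ : ∀ {m} → Fin m → Bool → Darts ℤ m
δ i β e b = 𝟙 (⌊ i ≟ e ⌋ ∧ ⌊ β ≟ᵇ b ⌋)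

0≤δ : ∀ {m} (i : Fin m) β e b → 0ℤ ≤ δ i β e b
0≤δ i β e b = 0≤𝟙 (⌊ i ≟ e ⌋ ∧ ⌊ β ≟ᵇ b ⌋)

δ-cases : ∀ {m} (i : Fin m) β e b → δ i β e b ≡ 0ℤ ⊎ (i ≡ e × β ≡ b × δ i β e b ≡ 1ℤ)
δ-cases i β e b with i ≟ e | β ≟ᵇ b
... | yes p | yes p′ = inj₂ (p , p′ , refl)
... | yes p | no  _  = inj₁ refl
... | no  _ | yes _  = inj₁ refl
... | no  _ | no  _  = inj₁ refl

δ-refl : ∀ {m} (i : Fin m) β → δ i β i β ≡ 1ℤ
δ-refl i β with i ≟ i | β ≟ᵇ β
... | yes _ | yes _ = refl
... | yes _ | no ¬p = contradiction refl ¬p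
... | no ¬p | _     = contradiction refl ¬p

δ-≢ : ∀ {m} (i : Fin m) β e b → (i ≡ e → β ≡ b → ⊥) → δ i β e b ≡ 0ℤ
δ-≢ i β e b ne with δ-cases i β e b
... | inj₁ eq = eq
... | inj₂ (p , p′ , _) = ⊥-elim (ne p p′)

δ-suc : ∀ {m} (i : Fin m) β e b → δ (suc i) β (suc e) b ≡ δ i β e b
δ-suc i β e b with i ≟ e
... | yes _ = refl
... | no  _ = refl

δ≤ : ∀ {m} {c : Darts ℤ m} → (∀ e b → 0ℤ ≤ c e b) → ∀ i β → 1ℤ ≤ c i β →
     ∀ e b → δ i β e b ≤ c e b
δ≤ 0≤c i β 1≤c e b with δ-cases i β e b
... | inj₁ eq = subst (_≤ _) (sym eq) (0≤c e b)
... | inj₂ (refl , refl , eq) = subst (_≤ _) (sym eq) 1≤c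

S-δ : ∀ {m} (f : Darts ℤ m) i β → S (λ e b → f e b * δ i β e b) ≡ f i β
S-δ {suc m} f zero β = trans (S-suc (λ e b → f e b * δ zero β e b)) $ trans
  (cong₂ _+_ (at β) (S-zero λ e b → ℤ.*-zeroʳ (f (suc e) b)))
  (ℤ.+-identityʳ (f zero β))
  where
  at : ∀ β → f zero true * δ {suc m} zero β zero true + f zero false * δ {suc m} zero β zero false ≡ f zero β
  at true  = lem (f zero true) (f zero false)
    where
    lem : ∀ x y → x * 1ℤ + y * 0ℤ ≡ x
    lem = solve-∀
  at false = lem (f zero true) (f zero false)
    where
    lem : ∀ x y → x * 0ℤ + y * 1ℤ ≡ y
    lem = solve-∀
S-δ {suc m} f (suc i) β = trans (S-suc (λ e b → f e b * δ (suc i) β e b)) $ trans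
  (cong₂ _+_
    (lem (f zero true) (f zero false))
    (S-cong λ e b → cong (f (suc e) b *_) (δ-suc i β e b)))
  (trans (ℤ.+-identityˡ _) (S-δ (f ∘ suc) i β))
  where
  lem : ∀ x y → x * 0ℤ + y * 0ℤ ≡ 0ℤ
  lem = solve-∀

term≤S : ∀ {m} {f : Darts ℤ m} → (∀ e b → 0ℤ ≤ f e b) → ∀ i β → f i β ≤ S f
term≤S {f = f} 0≤f i β = by-gap
  (0≤S {f = λ e b → f e b * (1ℤ - δ i β e b)} (λ e b → 0≤*0≤ (0≤f e b) (0≤1-𝟙 (⌊ i ≟ e ⌋ ∧ ⌊ β ≟ᵇ b ⌋))))
  (trans (S-minus f (λ e b → f e b * δ i β e b) (λ e b → lem (f e b) (δ i β e b)))
         (cong (λ r → S f - r) (S-δ f i β)))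
  where
  lem : ∀ x y → x * (1ℤ - y) ≡ x - x * y
  lem = solve-∀

-- Greedy: each dart in turn takes the minimum of its bound and of what is still to be placed.
distribute : ∀ {m} (f : Darts ℤ m) → (∀ e b → 0ℤ ≤ f e b) → ∀ s → 0ℤ ≤ s → s ≤ S f →
  ∃[ h ] (∀ e b → 0ℤ ≤ h e b × h e b ≤ f e b) × S h ≡ s
distribute {zero} f 0≤f s 0≤s s≤S =
  (λ ()) , (λ ()) , trans (S-empty (λ ())) (ℤ.≤-antisym 0≤s (subst (s ≤_) (S-empty f) s≤S))
distribute {suc m} f 0≤f s 0≤s s≤S =
  h , bounds , trans (S-suc h) (trans (cong (λ r → x + y + r) Srest) (total s x y))
  where
  x y : ℤ
  x = s ⊓ f zero true
  y = (s - x) ⊓ f zero false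
  total : ∀ s x y → x + y + (s - x - y) ≡ s
  total = solve-∀
  0≤x : 0ℤ ≤ x
  0≤x = ℤ.⊓-glb 0≤s (0≤f zero true)
  0≤s-x : 0ℤ ≤ s - x
  0≤s-x = gap (ℤ.i⊓j≤i s _)
  0≤y : 0ℤ ≤ y
  0≤y = ℤ.⊓-glb 0≤s-x (0≤f zero false)
  rest≤ : s - x - y ≤ S (f ∘ suc)
  rest≤ with ℤ.≤-total s (f zero true)
  ... | inj₁ p rewrite ℤ.i≤j⇒i⊓j≡i p =
    by-gap (0≤S (λ e → 0≤f (suc e)) ⊕ ℤ.⊓-glb (subst (0ℤ ≤_) (sym (ℤ.+-inverseʳ s)) (+≤+ z≤n)) (0≤f zero false))
           (lem (S (f ∘ suc)) s _)
    where
    lem : ∀ r s y → r + y ≡ r - (s - s - y)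
    lem = solve-∀
  ... | inj₂ p rewrite ℤ.i≥j⇒i⊓j≡j p with ℤ.≤-total (s - f zero true) (f zero false)
  ... | inj₁ p′ rewrite ℤ.i≤j⇒i⊓j≡i p′ =
    by-gap (0≤S (λ e → 0≤f (suc e))) (lem (S (f ∘ suc)) (s - f zero true))
    where
    lem : ∀ r z → r ≡ r - (z - z)
    lem = solve-∀
  ... | inj₂ p′ rewrite ℤ.i≥j⇒i⊓j≡j p′ =
    by-gap (gap (subst (s ≤_) (S-suc f) s≤S)) (lem (S (f ∘ suc)) s (f zero true) (f zero false))
    where
    lem : ∀ r s a b → (a + b + r) - s ≡ r - (s - a - b)
    lem = solve-∀
  IH : ∃[ h ] (∀ e b → 0ℤ ≤ h e b × h e b ≤ f (suc e) b) × S h ≡ s - x - y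
  IH = distribute (f ∘ suc) (λ e → 0≤f (suc e)) (s - x - y) (gap (ℤ.i⊓j≤i (s - x) _)) rest≤
  h : Darts ℤ (suc m)
  h zero    true  = x
  h zero    false = y
  h (suc e) b     = proj₁ IH e b
  Srest : S (proj₁ IH) ≡ s - x - y
  Srest = proj₂ (proj₂ IH)
  bounds : ∀ e b → 0ℤ ≤ h e b × h e b ≤ f e b
  bounds zero    true  = 0≤x , ℤ.i⊓j≤j s _
  bounds zero    false = 0≤y , ℤ.i⊓j≤j (s - x) _
  bounds (suc e) b     = proj₁ (proj₂ IH) e b

-- Capacities of cuts

Antisymmetric : ∀ {m} → Darts ℤ m → Set
Antisymmetric g = ∀ e → g e false ≡ - g e true

antisym : ∀ {m} {g : Darts ℤ m} → Antisymmetric g → ∀ e b → g e (not b) ≡ - g e b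
antisym anti e true  = anti e
antisym {g = g} anti e false = trans (sym (ℤ.neg-involutive (g e true))) (cong -_ (sym (anti e)))

infixl 6 _+ᵈ_ _-ᵈ_

_+ᵈ_ _-ᵈ_ : ∀ {m} → Darts ℤ m → Darts ℤ m → Darts ℤ m
(f +ᵈ g) e b = f e b + g e b
(f -ᵈ g) e b = f e b - g e b

_+ˣ_ : ∀ {A : Set} → (A → ℤ) → (A → ℤ) → (A → ℤ)
(X +ˣ Y) l = X l + Y l

cons : ∀ {A : Set} {m} → A → A → Darts A m → Darts A (suc m)
cons x y f zero    true  = x
cons x y f zero    false = y
cons x y f (suc e) b     = f e b

-- A weight is evaluated at the source and the target of a dart. Leaving, entering and inner
-- capacity and net flow become instances of one sum, and identities between them reduce to ring
-- identities between weights.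
Weight : Set
Weight = ℤ → ℤ → ℤ

module _ {V : Set} where

  opaque
    cut : Weight → ∀ {m} → Darts V m → Darts ℤ m → (V → ℤ) → ℤ
    cut w end c X = S λ e b → w (X (end e b)) (X (end e (not b))) * c e b

    between : ∀ {m} → Darts V m → Darts ℤ m → (V → ℤ) → (V → ℤ) → ℤ
    between end c X Y = S λ e b → (X (end e b) * Y (end e (not b)) + Y (end e b) * X (end e (not b))) * c e b

    cut-relabel : ∀ {w m} (end : Darts V m) c (φ : V → V) X → cut w (λ e b → φ (end e b)) c X ≡ cut w end c (X ∘ φ)
    cut-relabel end c φ X = refl

  out inn inside net : ∀ {m} → Darts V m → Darts ℤ m → (V → ℤ) → ℤ
  out    = cut (λ x y → x * (1ℤ - y))
  inn    = cut (λ x y → (1ℤ - x) * y)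
  inside = cut (λ x y → x * y)
  net    = cut (λ x y → x)

  module _ {m : ℕ} (end : Darts V m) where
    opaque
      unfolding cut

      cut-cong : ∀ {w} c {X Y} → (∀ l → X l ≡ Y l) → cut w end c X ≡ cut w end c Y
      cut-cong {w} c eq = S-cong λ e b → cong₂ (λ x y → w x y * c e b) (eq (end e b)) (eq (end e (not b)))

      cut-≗ : ∀ {w c d} X → (∀ e b → c e b ≡ d e b) → cut w end c X ≡ cut w end d X
      cut-≗ {w} X eq = S-cong λ e b → cong (w (X (end e b)) (X (end e (not b))) *_) (eq e b)

      cut-+ : ∀ {w} c g X → cut w end (c +ᵈ g) X ≡ cut w end c X + cut w end g X
      cut-+ {w} c g X = S-split (λ e b → w (X (end e b)) (X (end e (not b))) * c e b) _
        λ e b → ℤ.*-distribˡ-+ (w (X (end e b)) (X (end e (not b)))) (c e b) (g e b)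

      cut-- : ∀ {w} c g X → cut w end (c -ᵈ g) X ≡ cut w end c X - cut w end g X
      cut-- {w} c g X = S-minus (λ e b → w (X (end e b)) (X (end e (not b))) * c e b) _
        λ e b → lem (w (X (end e b)) (X (end e (not b)))) (c e b) (g e b)
        where
        lem : ∀ w c g → w * (c - g) ≡ w * c - w * g
        lem = solve-∀

      cut-scale : ∀ {w} k c X → cut w end (λ e b → k * c e b) X ≡ k * cut w end c X
      cut-scale {w} k c X = trans (S-cong λ e b → lem k (w (X (end e b)) (X (end e (not b)))) (c e b))
        (S-distribˡ-* k (λ e b → w (X (end e b)) (X (end e (not b))) * c e b))
        where
        lem : ∀ k w c → w * (k * c) ≡ k * (w * c)
        lem = solve-∀

      cut-δ : ∀ {w} i β X → cut w end (δ i β) X ≡ w (X (end i β)) (X (end i (not β)))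
      cut-δ {w} i β X = S-δ (λ e b → w (X (end e b)) (X (end e (not b)))) i β

      cut-zero : ∀ {w c} X → (∀ e b → w (X (end e b)) (X (end e (not b))) ≡ 0ℤ ⊎ c e b ≡ 0ℤ) → cut w end c X ≡ 0ℤ
      cut-zero {w} {c} X h = S-zero λ e b → case h e b of λ
        { (inj₁ eq) → trans (cong (_* c e b) eq) (ℤ.*-zeroˡ (c e b))
        ; (inj₂ eq) → trans (cong (w (X (end e b)) (X (end e (not b))) *_) eq) (ℤ.*-zeroʳ (w (X (end e b)) (X (end e (not b))))) }

      0≤cut : ∀ {w c} → (∀ e b → 0ℤ ≤ c e b) → ∀ X → (∀ u v → 0ℤ ≤ w (X u) (X v)) → 0ℤ ≤ cut w end c X
      0≤cut 0≤c X 0≤w = 0≤S λ e b → 0≤*0≤ (0≤w (end e b) (end e (not b))) (0≤c e b)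

      term≤cut : ∀ {w c} → (∀ e b → 0ℤ ≤ c e b) → ∀ X → (∀ u v → 0ℤ ≤ w (X u) (X v)) →
        ∀ e b → w (X (end e b)) (X (end e (not b))) * c e b ≤ cut w end c X
      term≤cut 0≤c X 0≤w = term≤S λ e b → 0≤*0≤ (0≤w (end e b) (end e (not b))) (0≤c e b)

      cut-reverse : ∀ {w w′} → (∀ x y c d → w x y * d + w y x * c ≡ w′ x y * c + w′ y x * d) →
        ∀ c X → cut w end (λ e b → c e (not b)) X ≡ cut w′ end c X
      cut-reverse eq c X = S-pairwise λ e → eq (X (end e true)) (X (end e false)) (c e true) (c e false)

      cut-antisym : ∀ {w w′ g} → (∀ x y c → w x y * c + w y x * - c ≡ w′ x y * c + w′ y x * - c) →
        Antisymmetric g → ∀ X → cut w end g X ≡ cut w′ end g X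
      cut-antisym {w} {w′} {g} eq anti X = S-pairwise λ e → subst
        (λ c → w (X (end e true)) (X (end e false)) * g e true + w (X (end e false)) (X (end e true)) * c
             ≡ w′ (X (end e true)) (X (end e false)) * g e true + w′ (X (end e false)) (X (end e true)) * c)
        (sym (anti e)) (eq (X (end e true)) (X (end e false)) (g e true))

      cut-negated : ∀ {w} c X → cut (λ x y → - w x y) end c X ≡ - cut w end c X
      cut-negated {w} c X = trans (S-cong λ e b → lem (w (X (end e b)) (X (end e (not b)))) (c e b))
        (trans (S-distribˡ-* -1ℤ (λ e b → w (X (end e b)) (X (end e (not b))) * c e b)) (ℤ.-1*i≡-i (cut w end c X)))
        where
        lem : ∀ w c → - w * c ≡ -1ℤ * (w * c)
        lem = solve-∀

      net-+ˣ : ∀ d X Y → net end d (X +ˣ Y) ≡ net end d X + net end d Y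
      net-+ˣ d X Y = S-split (λ e b → X (end e b) * d e b) _
        λ e b → ℤ.*-distribʳ-+ (d e b) (X (end e b)) (Y (end e b))

      net-supported : ∀ {d} X v → (∀ e b → end e b ≡ v ⊎ d e b ≡ 0ℤ) → net end d X ≡ X v * S d
      net-supported {d} X v h = trans (S-cong term) (S-distribˡ-* (X v) d)
        where
        term : ∀ e b → X (end e b) * d e b ≡ X v * d e b
        term e b with h e b
        ... | inj₁ refl = refl
        ... | inj₂ eq rewrite eq = trans (ℤ.*-zeroʳ (X (end e b))) (sym (ℤ.*-zeroʳ (X v)))

      cut-+ˣ : ∀ {w} → (∀ x x′ y y′ c → w x x′ * c + w y y′ * c ≡ w (x + y) (x′ + y′) * c + (x * y′ + y * x′) * c) →
        ∀ c X Y → cut w end c X + cut w end c Y ≡ cut w end c (X +ˣ Y) + between end c X Y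
      cut-+ˣ eq c X Y = trans (sym (S-distrib-+ _ _)) (trans
        (S-cong λ e b → eq (X (end e b)) (X (end e (not b))) (Y (end e b)) (Y (end e (not b))) (c e b))
        (S-distrib-+ _ _))

      between-zero : ∀ {c} (A B : V → Bool) →
        (∀ e b → A (end e b) ≡ true → B (end e (not b)) ≡ true → c e b ≡ 0ℤ × c e (not b) ≡ 0ℤ) →
        between end c (𝟙 ∘ A) (𝟙 ∘ B) ≡ 0ℤ
      between-zero {c} A B h = S-zero term
        where
        product : ∀ a b → (a ≡ true → b ≡ true → ⊥) → 𝟙 a * 𝟙 b ≡ 0ℤ
        product true  true  ¬both = ⊥-elim (¬both refl refl)
        product true  false _  = refl
        product false _     _  = refl
        term : ∀ e b → (𝟙 (A (end e b)) * 𝟙 (B (end e (not b))) + 𝟙 (B (end e b)) * 𝟙 (A (end e (not b)))) * c e b ≡ 0ℤ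
        term e b with c e b ℤ.≟ 0ℤ
        ... | yes eq = trans (cong (λ r → (𝟙 (A (end e b)) * 𝟙 (B (end e (not b))) + 𝟙 (B (end e b)) * 𝟙 (A (end e (not b)))) * r) eq)
          (ℤ.*-zeroʳ (𝟙 (A (end e b)) * 𝟙 (B (end e (not b))) + 𝟙 (B (end e b)) * 𝟙 (A (end e (not b)))))
        ... | no ne  = trans (cong (_* c e b) (cong₂ _+_
          (product (A (end e b)) (B (end e (not b))) λ s t → ne (proj₁ (h e b s t)))
          (product (B (end e b)) (A (end e (not b))) λ s t → ne (subst (λ b → c e b ≡ 0ℤ) (not-involutive b)
            (proj₂ (h e (not b) t (subst (λ b → B (end e b) ≡ true) (sym (not-involutive b)) s)))))))
          (ℤ.*-zeroˡ (c e b))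

    -- For disjoint sets: a dart between them leaves one of the two, but not their union.
    out-+ˣ : ∀ c X Y → out end c X + out end c Y ≡ out end c (X +ˣ Y) + between end c X Y
    out-+ˣ = cut-+ˣ {λ x y → x * (1ℤ - y)} lem
      where
      lem : ∀ x x′ y y′ c → x * (1ℤ - x′) * c + y * (1ℤ - y′) * c ≡ (x + y) * (1ℤ - (x′ + y′)) * c + (x * y′ + y * x′) * c
      lem = solve-∀

    inn-+ˣ : ∀ c X Y → inn end c X + inn end c Y ≡ inn end c (X +ˣ Y) + between end c X Y
    inn-+ˣ = cut-+ˣ {λ x y → (1ℤ - x) * y} lem
      where
      lem : ∀ x x′ y y′ c → (1ℤ - x) * x′ * c + (1ℤ - y) * y′ * c ≡ (1ℤ - (x + y)) * (x′ + y′) * c + (x * y′ + y * x′) * c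
      lem = solve-∀

    inn-antisym : ∀ {g} → Antisymmetric g → ∀ X → inn end g X ≡ - out end g X
    inn-antisym {g} anti X = trans (cut-antisym {λ x y → (1ℤ - x) * y} {λ x y → - (x * (1ℤ - y))} lem anti X) (cut-negated {λ x y → x * (1ℤ - y)} g X)
      where
      lem : ∀ x y g → (1ℤ - x) * y * g + (1ℤ - y) * x * - g ≡ - (x * (1ℤ - y)) * g + - (y * (1ℤ - x)) * - g
      lem = solve-∀

    -- The two weights differ by x y, which is symmetric, so an antisymmetric function sums to zero
    -- against the difference.
    net-antisym : ∀ {g} → Antisymmetric g → ∀ X → net end g X ≡ out end g X
    net-antisym = cut-antisym {λ x y → x} {λ x y → x * (1ℤ - y)} lem
      where
      lem : ∀ x y g → x * g + y * (- g) ≡ x * (1ℤ - y) * g + y * (1ℤ - x) * (- g)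
      lem = solve-∀

    inside-antisym : ∀ {g} → Antisymmetric g → ∀ X → inside end g X ≡ 0ℤ
    inside-antisym anti X = trans (cut-antisym {λ x y → x * y} {λ _ _ → 0ℤ} lem anti X) (cut-zero X λ _ _ → inj₁ refl)
      where
      lem : ∀ x y g → x * y * g + y * x * - g ≡ 0ℤ * g + 0ℤ * - g
      lem = solve-∀

    out-reverse : ∀ c X → out end (λ e b → c e (not b)) X ≡ inn end c X
    out-reverse = cut-reverse {λ x y → x * (1ℤ - y)} {λ x y → (1ℤ - x) * y} lem
      where
      lem : ∀ x y c d → x * (1ℤ - y) * d + y * (1ℤ - x) * c ≡ (1ℤ - x) * y * c + (1ℤ - y) * x * d
      lem = solve-∀

    inn-reverse : ∀ c X → inn end (λ e b → c e (not b)) X ≡ out end c X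
    inn-reverse = cut-reverse {λ x y → (1ℤ - x) * y} {λ x y → x * (1ℤ - y)} lem
      where
      lem : ∀ x y c d → (1ℤ - x) * y * d + (1ℤ - y) * x * c ≡ x * (1ℤ - y) * c + y * (1ℤ - x) * d
      lem = solve-∀

    inside-reverse : ∀ c X → inside end (λ e b → c e (not b)) X ≡ inside end c X
    inside-reverse = cut-reverse {λ x y → x * y} {λ x y → x * y} lem
      where
      lem : ∀ x y c d → x * y * d + y * x * c ≡ x * y * c + y * x * d
      lem = solve-∀

    module _ (A : V → Bool) where

      out-zero : ∀ {c} → (∀ e b → A (end e b) ≡ true → A (end e (not b)) ≡ false → c e b ≡ 0ℤ) → out end c (𝟙 ∘ A) ≡ 0ℤ
      out-zero {c} h = cut-zero (𝟙 ∘ A) term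
        where
        term : ∀ e b → 𝟙 (A (end e b)) * (1ℤ - 𝟙 (A (end e (not b)))) ≡ 0ℤ ⊎ c e b ≡ 0ℤ
        term e b with A (end e b) in eq | A (end e (not b)) in eq′
        ... | false | _     = inj₁ refl
        ... | true  | true  = inj₁ refl
        ... | true  | false = inj₂ (h e b eq eq′)

      inn-zero : ∀ {c} → (∀ e b → A (end e b) ≡ false → A (end e (not b)) ≡ true → c e b ≡ 0ℤ) → inn end c (𝟙 ∘ A) ≡ 0ℤ
      inn-zero {c} h = cut-zero (𝟙 ∘ A) term
        where
        term : ∀ e b → (1ℤ - 𝟙 (A (end e b))) * 𝟙 (A (end e (not b))) ≡ 0ℤ ⊎ c e b ≡ 0ℤ
        term e b with A (end e b) in eq | A (end e (not b)) in eq′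
        ... | true  | true  = inj₁ refl
        ... | true  | false = inj₁ refl
        ... | false | false = inj₁ refl
        ... | false | true  = inj₂ (h e b eq eq′)

    module _ {c : Darts ℤ m} (0≤c : ∀ e b → 0ℤ ≤ c e b) (A : V → Bool) where

      private
        0≤out-weight : ∀ u v → 0ℤ ≤ 𝟙 (A u) * (1ℤ - 𝟙 (A v))
        0≤out-weight u v = 0≤*0≤ (0≤𝟙 (A u)) (0≤1-𝟙 (A v))
        0≤inn-weight : ∀ u v → 0ℤ ≤ (1ℤ - 𝟙 (A u)) * 𝟙 (A v)
        0≤inn-weight u v = 0≤*0≤ (0≤1-𝟙 (A u)) (0≤𝟙 (A v))

      0≤out : 0ℤ ≤ out end c (𝟙 ∘ A)
      0≤out = 0≤cut 0≤c (𝟙 ∘ A) 0≤out-weight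

      0≤inn : 0ℤ ≤ inn end c (𝟙 ∘ A)
      0≤inn = 0≤cut 0≤c (𝟙 ∘ A) 0≤inn-weight

      0≤inside : 0ℤ ≤ inside end c (𝟙 ∘ A)
      0≤inside = 0≤cut 0≤c (𝟙 ∘ A) λ u v → 0≤*0≤ (0≤𝟙 (A u)) (0≤𝟙 (A v))

      cap≤out : ∀ e b → A (end e b) ≡ true → A (end e (not b)) ≡ false → c e b ≤ out end c (𝟙 ∘ A)
      cap≤out e b p p′ = subst (_≤ out end c (𝟙 ∘ A))
        (trans (cong₂ (λ x y → 𝟙 x * (1ℤ - 𝟙 y) * c e b) p p′) (ℤ.*-identityˡ (c e b)))
        (term≤cut {λ x y → x * (1ℤ - y)} 0≤c (𝟙 ∘ A) 0≤out-weight e b)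

      cap≤inn : ∀ e b → A (end e b) ≡ false → A (end e (not b)) ≡ true → c e b ≤ inn end c (𝟙 ∘ A)
      cap≤inn e b p p′ = subst (_≤ inn end c (𝟙 ∘ A))
        (trans (cong₂ (λ x y → (1ℤ - 𝟙 x) * 𝟙 y * c e b) p p′) (ℤ.*-identityˡ (c e b)))
        (term≤cut {λ x y → (1ℤ - x) * y} 0≤c (𝟙 ∘ A) 0≤inn-weight e b)

    opaque
      unfolding cut

      cut-cons : ∀ {w} v v′ c₁ c₂ c X → cut w (cons v v′ end) (cons c₁ c₂ c) X
        ≡ w (X v) (X v′) * c₁ + w (X v′) (X v) * c₂ + cut w end c X
      cut-cons v v′ c₁ c₂ c X = S-suc _

-- Windows modulo q

module Windows (p q : ℤ) (1≤p : 1ℤ ≤ p) (q≡1+p : q ≡ 1ℤ + p) where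

  q≤ : 0ℤ ≤ 1ℤ + p - q
  q≤ = gap (ℤ.≤-reflexive q≡1+p)

  q≥ : 0ℤ ≤ q - (1ℤ + p)
  q≥ = gap (ℤ.≤-reflexive (sym q≡1+p))

  0≤q : 0ℤ ≤ q
  0≤q = by-gap (gap 1≤p ⊕ q≥ ⊕ +≤+ {n = 2} z≤n) (lem p q)
    where
    lem : ∀ p q → (p - 1ℤ) + (q - (1ℤ + p)) + + 2 ≡ q - 0ℤ
    lem = solve-∀

  q*-mono : ∀ {i j} → i ≤ j → q * i ≤ q * j
  q*-mono {i} {j} i≤j = by-gap (0≤*0≤ 0≤q (gap i≤j)) (trans (ℤ.*-distribˡ-+ q j (- i)) (lem q i j))
    where
    lem : ∀ q i j → q * j + q * - i ≡ q * j - q * i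
    lem = solve-∀

  sign-cases : ∀ t → q * t ≤ - q ⊎ 0ℤ ≤ q * t
  sign-cases t with t ℤ.≤? -1ℤ
  ... | yes t≤-1 = inj₁ (subst (q * t ≤_) (lem q) (q*-mono t≤-1))
    where
    lem : ∀ q → q * -1ℤ ≡ - q
    lem = solve-∀
  ... | no  t≰-1 = inj₂ (subst (_≤ q * t) (ℤ.*-zeroʳ q) (q*-mono (≰⇒1+≤ t≰-1)))

  opaque
    -- For L and U as in Network below: demand - q j is at least a - leaving and at
    -- most entering - b.
    Within : (a b l u : ℤ) → Set
    Within a b l u = ∃[ j ] (a + q * j ≤ l × b ≤ u + q * j)

    -- For L and U as in `Network`, this says that the demand is, modulo q, the midpoint between -
    -- leaving and entering.
    Balanced : (l u : ℤ) → Set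
    Balanced l u = ∃[ j ] l - q * j ≡ u + q * j

  -- P, N ≤ 2q - 1 and min(P , N) ≤ q - 1, for the numbers P of edges leaving and N of
  -- edges entering z₀: the bound d(z₀) ≤ 2q - 2 + |τ(z₀)| of Lovász et al.
  Root : (P N : ℤ) → Set
  Root P N = (P ≤ p × N ≤ p + q) ⊎ (P ≤ p + q × N ≤ p)

  opaque
    unfolding Within Balanced

    within : ∀ {a b l u} j → a + q * j ≤ l → b ≤ u + q * j → Within a b l u
    within j h k = j , h , k

    balanced-at : ∀ {l u} → Balanced l u → ∃[ j ] l - q * j ≡ u + q * j
    balanced-at bal = bal

    at-balanced : ∀ {l u} j → l - q * j ≡ u + q * j → Balanced l u
    at-balanced j eq = j , eq

    within-mono : ∀ {a b l u a′ b′ l′ u′} → a′ - a ≤ l′ - l → b′ - b ≤ u′ - u →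
      Within a b l u → Within a′ b′ l′ u′
    within-mono {a} {b} {l} {u} {a′} {b′} {l′} {u′} al bu (j , h , k) =
      j , by-gap (gap al ⊕ gap h) (lem a l a′ l′ (q * j)) , by-gap (gap bu ⊕ gap k) (lem′ b u b′ u′ (q * j))
      where
      lem : ∀ a l a′ l′ x → (l′ - l) - (a′ - a) + (l - (a + x)) ≡ l′ - (a′ + x)
      lem = solve-∀
      lem′ : ∀ b u b′ u′ x → (u′ - u) - (b′ - b) + (u + x - b) ≡ u′ + x - b′
      lem′ = solve-∀

    within-sym : ∀ {a b l u} → Within a b l u → Within b a u l
    within-sym {a} {b} {l} {u} (j , h , k) =
      - j , by-gap (gap k) (lem b u q j) , by-gap (gap h) (lem′ a l q j)
      where
      lem : ∀ b u q j → u + q * j - b ≡ u - (b + q * - j)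
      lem = solve-∀
      lem′ : ∀ a l q j → l - (a + q * j) ≡ l + q * - j - a
      lem′ = solve-∀

    balanced-sym : ∀ {l u} → Balanced l u → Balanced u l
    balanced-sym {l} {u} (j , eq) = - j , trans (lem u q j) (trans (sym eq) (lem′ l q j))
      where
      lem : ∀ u q j → u - q * - j ≡ u + q * j
      lem = solve-∀
      lem′ : ∀ l q j → l - q * j ≡ l + q * - j
      lem′ = solve-∀

    root-sym : ∀ {P N} → Root P N → Root N P
    root-sym (inj₁ (a , b)) = inj₂ (b , a)
    root-sym (inj₂ (a , b)) = inj₁ (b , a)

    root-mono : ∀ {P N P′ N′} → P′ ≤ P → N′ ≤ N → Root P N → Root P′ N′
    root-mono a b (inj₁ (c , d)) = inj₁ (ℤ.≤-trans a c , ℤ.≤-trans b d)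
    root-mono a b (inj₂ (c , d)) = inj₂ (ℤ.≤-trans a c , ℤ.≤-trans b d)

    -- Here `l` equals p + q j, and u + q j is at most p + q, since otherwise the multiple j - 1
    -- would put the set into the interior. As both capacities are nonnegative, j - i is 0 or 1, and
    -- these values give the two alternatives of `Root`.
    root-at-left-end : ∀ {l u} j i → p + q * j ≤ l → ¬ q + q * j ≤ l → ¬ Within q q l u →
      0ℤ ≤ u + q * i → 0ℤ ≤ l - q * i → Root (u + q * i) (l - q * i)
    root-at-left-end {l} {u} j i lo hi ¬strict 0≤P 0≤N = case sign-cases (j - i) of λ
      { (inj₁ h) → ⊥-elim (absurd-gap (0≤N ⊕ gap l≤ ⊕ gap h ⊕ q≥) (eq₀ p q l i j))
      ; (inj₂ h) → case sign-cases (j - i - 1ℤ) of λ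
        { (inj₁ h′) → inj₂
           ( by-gap (gap u≤ ⊕ h) (eq₁ q p u i j)
           , by-gap (gap l≤ ⊕ gap h′) (eq₂ q p l i j) )
        ; (inj₂ h′) → inj₁
           ( by-gap (gap u≤ ⊕ h′) (eq₃ q p u i j)
           , by-gap (gap l≤ ⊕ gap (t≤1 h′)) (eq₄ q p l i j) ) } }
      where
      l≤ : l ≤ p + q * j
      l≤ = by-gap (gap (≰⇒1+≤ hi) ⊕ q≤) (eq p q l (q * j))
        where
        eq : ∀ p q l x → q + x - (1ℤ + l) + (1ℤ + p - q) ≡ p + x - l
        eq = solve-∀
      u≤ : u + q * j ≤ p + q
      u≤ = case q ℤ.≤? u + q * (j - 1ℤ) of λ
        { (yes h) → ⊥-elim (¬strict (j - 1ℤ , by-gap (gap lo ⊕ 0≤p) (eq p q l j) , h))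
        ; (no ¬h) → by-gap (gap (≰⇒1+≤ ¬h) ⊕ q≤) (eq′ p q u j) }
        where
        0≤p : 0ℤ ≤ p
        0≤p = ℤ.≤-trans (+≤+ z≤n) 1≤p
        eq : ∀ p q l j → l - (p + q * j) + p ≡ l - (q + q * (j - 1ℤ))
        eq = solve-∀
        eq′ : ∀ p q u j → q - (1ℤ + (u + q * (j - 1ℤ))) + (1ℤ + p - q) ≡ p + q - (u + q * j)
        eq′ = solve-∀
      t≤1 : 0ℤ ≤ q * (j - i - 1ℤ) → q * (j - i - 1ℤ) ≤ 0ℤ
      t≤1 _ = case sign-cases (1ℤ - (j - i)) of λ
        { (inj₁ k) → ⊥-elim (absurd-gap (0≤P ⊕ gap u≤ ⊕ gap k ⊕ q≥) (eq p q u i j))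
        ; (inj₂ k) → by-gap k (eq′ q i j) }
        where
        eq : ∀ p q u i j → u + q * i + (p + q - (u + q * j)) + (- q - q * (1ℤ - (j - i))) + (q - (1ℤ + p))
           ≡ -1ℤ
        eq = solve-∀
        eq′ : ∀ q i j → q * (1ℤ - (j - i)) ≡ 0ℤ - q * (j - i - 1ℤ)
        eq′ = solve-∀
      eq₀ : ∀ p q l i j → l - q * i + (p + q * j - l) + (- q - q * (j - i)) + (q - (1ℤ + p)) ≡ -1ℤ
      eq₀ = solve-∀
      eq₁ : ∀ q p u i j → p + q - (u + q * j) + q * (j - i) ≡ p + q - (u + q * i)
      eq₁ = solve-∀
      eq₂ : ∀ q p l i j → p + q * j - l + (- q - q * (j - i - 1ℤ)) ≡ p - (l - q * i)
      eq₂ = solve-∀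
      eq₃ : ∀ q p u i j → p + q - (u + q * j) + q * (j - i - 1ℤ) ≡ p - (u + q * i)
      eq₃ = solve-∀
      eq₄ : ∀ q p l i j → p + q * j - l + (0ℤ - q * (j - i - 1ℤ)) ≡ p + q - (l - q * i)
      eq₄ = solve-∀

    -- A set which is not in the interior of its window may play the role of the
    -- active vertices, once its demand is met by reversals on its boundary.
    root-of-tight : ∀ {l u} i → Within p p l u → ¬ Within q q l u →
      0ℤ ≤ u + q * i → 0ℤ ≤ l - q * i → Root (u + q * i) (l - q * i)
    root-of-tight {l} {u} i (j , lo , hi) ¬strict 0≤P 0≤N with q + q * j ℤ.≤? l | q ℤ.≤? u + q * j
    ... | yes h | yes k = ⊥-elim (¬strict (j , h , k))
    ... | no ¬h | _     = root-at-left-end {l} {u} j i lo ¬h ¬strict 0≤P 0≤N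
    -- The right end becomes the left one when the two sides are exchanged and `i`, `j` are negated.
    ... | yes _ | no ¬k = root-sym $ subst₂ Root (eq₁ l q i) (eq₂ u q i) $
      root-at-left-end {u} {l} (- j) (- i)
        (by-gap (gap hi) (eq₃ u q p j))
        (λ k → ¬k (by-gap (gap k) (eq₄ u q j)))
        (¬strict ∘ within-sym)
        (subst (0ℤ ≤_) (sym (eq₁ l q i)) 0≤N) (subst (0ℤ ≤_) (sym (eq₂ u q i)) 0≤P)
      where
      eq₁ : ∀ l q i → l + q * - i ≡ l - q * i
      eq₁ = solve-∀
      eq₂ : ∀ u q i → u - q * - i ≡ u + q * i
      eq₂ = solve-∀
      eq₃ : ∀ u q p j → u + q * j - p ≡ u - (p + q * - j)
      eq₃ = solve-∀
      eq₄ : ∀ u q j → u - (q + q * - j) ≡ u + q * j - q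
      eq₄ = solve-∀

    -- Applied to a partition into two sets without edges between them.
    uncut : ∀ {l u l′ u′ P N} j₀ h j → h + q * j ≤ l → h ≤ u + q * j → Within p p l′ u′ → Root P N →
      l + l′ ≡ q * j₀ + N → u + u′ ≡ P - q * j₀ → h ≤ 0ℤ
    uncut {l} {u} {l′} {u′} {P} {N} j₀ h j lo hi (j′ , lo′ , hi′) root eqₗ eqᵤ =
      go root (sign-cases t) (sign-cases (- t))
      where
      -- Adding the two windows gives N ≥ h + p - q t and P ≥ h + p + q t. For either sign of t, one
      -- of these and the bounds in `Root` force h ≤ 0.
      t : ℤ
      t = j₀ - j - j′
      N≥ : h + p - q * t ≤ N
      N≥ = by-gap (gap lo ⊕ gap lo′ ⊕ gap (ℤ.≤-reflexive eqₗ)) (eq q p h l l′ N j₀ j j′)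
        where
        eq : ∀ q p h l l′ N j₀ j j′ → l - (h + q * j) + (l′ - (p + q * j′)) + (q * j₀ + N - (l + l′))
          ≡ N - (h + p - q * (j₀ - j - j′))
        eq = solve-∀
      P≥ : h + p + q * t ≤ P
      P≥ = by-gap (gap hi ⊕ gap hi′ ⊕ gap (ℤ.≤-reflexive eqᵤ)) (eq q p h u u′ P j₀ j j′)
        where
        eq : ∀ q p h u u′ P j₀ j j′ → u + q * j - h + (u′ + q * j′ - p) + (P - q * j₀ - (u + u′))
          ≡ P - (h + p + q * (j₀ - j - j′))
        eq = solve-∀
      eq₁ : ∀ q p X h t → p + q - X + (X - (h + p - q * t)) + (- q - q * t) ≡ 0ℤ - h
      eq₁ = solve-∀
      eq₂ : ∀ q p X h t → p - X + (X - (h + p + q * t)) + q * t ≡ 0ℤ - h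
      eq₂ = solve-∀
      eq₃ : ∀ q p X h t → p + q - X + (X - (h + p + q * t)) + (- q - q * - t) ≡ 0ℤ - h
      eq₃ = solve-∀
      eq₄ : ∀ q p X h t → p - X + (X - (h + p - q * t)) + q * - t ≡ 0ℤ - h
      eq₄ = solve-∀
      go : Root P N → q * t ≤ - q ⊎ 0ℤ ≤ q * t → q * - t ≤ - q ⊎ 0ℤ ≤ q * - t → h ≤ 0ℤ
      go (inj₁ (P≤ , N≤)) (inj₁ s) _ = by-gap (gap N≤ ⊕ gap N≥ ⊕ gap s) (eq₁ q p N h t)
      go (inj₁ (P≤ , N≤)) (inj₂ s) _ = by-gap (gap P≤ ⊕ gap P≥ ⊕ s) (eq₂ q p P h t)
      go (inj₂ (P≤ , N≤)) _ (inj₁ s) = by-gap (gap P≤ ⊕ gap P≥ ⊕ gap s) (eq₃ q p P h t)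
      go (inj₂ (P≤ , N≤)) _ (inj₂ s) = by-gap (gap N≤ ⊕ gap N≥ ⊕ s) (eq₄ q p N h t)

    uncut⇒⊥ : ∀ {l u l′ u′ P N} j₀ → Within p p l u → Within p p l′ u′ → Root P N →
      l + l′ ≡ q * j₀ + N → u + u′ ≡ P - q * j₀ → ⊥
    uncut⇒⊥ {l} {u} {l′} {u′} {P} {N} j₀ (j , lo , hi) w root eqₗ eqᵤ =
      absurd-gap (gap 1≤p ⊕ gap (uncut {l} {u} {l′} {u′} {P} {N} j₀ p j lo hi w root eqₗ eqᵤ)) (eq p)
      where
      eq : ∀ p → p - 1ℤ + (0ℤ - p) ≡ -1ℤ
      eq = solve-∀

    -- In the middle of the window, `uncut` can be applied with h equal to half of l + u.
    balanced-uncut⇒≤0 : ∀ {l u l′ u′ P N} j₀ → Balanced l u → Within p p l′ u′ → Root P N →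
      l + l′ ≡ q * j₀ + N → u + u′ ≡ P - q * j₀ → l + u ≤ 0ℤ
    balanced-uncut⇒≤0 {l} {u} {l′} {u′} {P} {N} j₀ (j , bal) w root eqₗ eqᵤ =
      by-gap (gap h≤0 ⊕ gap h≤0 ⊕ gap (ℤ.≤-reflexive (sym bal))) (eq l u (q * j))
      where
      h≤0 : l - q * j ≤ 0ℤ
      h≤0 = uncut {l} {u} {l′} {u′} {P} {N} j₀ (l - q * j) j (ℤ.≤-reflexive (eq′ l (q * j))) (ℤ.≤-reflexive bal) w root eqₗ eqᵤ
        where
        eq′ : ∀ l x → l - x + x ≡ l
        eq′ = solve-∀
      eq : ∀ l u x → 0ℤ - (l - x) + (0ℤ - (l - x)) + (l - x - (u + x)) ≡ 0ℤ - (l + u)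
      eq = solve-∀

    -- Without room at either end, l - q j and u + q j are both equal to p, which puts the demand in
    -- the middle.
    left-or-right : ∀ {l u} → Within p p l u → ¬ Balanced l u → Within q p l u ⊎ Within p q l u
    left-or-right {l} {u} (j , h , k) ¬bal with q + q * j ℤ.≤? l | q ℤ.≤? u + q * j
    ... | yes h′ | _      = inj₁ (j , h′ , k)
    ... | no  _  | yes k′ = inj₂ (j , h , k′)
    ... | no ¬h  | no ¬k  = ⊥-elim $ ¬bal (j , trans l≡p (sym u≡p))
      where
      eq : ∀ p q l x → q + x - (1ℤ + l) + (1ℤ + p - q) ≡ p - (l - x)
      eq = solve-∀
      eq′ : ∀ p l x → l - (p + x) ≡ l - x - p
      eq′ = solve-∀
      eq″ : ∀ p q u → q - (1ℤ + u) + (1ℤ + p - q) ≡ p - u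
      eq″ = solve-∀
      l≡p : l - q * j ≡ p
      l≡p = ℤ.≤-antisym (by-gap (gap (≰⇒1+≤ ¬h) ⊕ q≤) (eq p q l (q * j))) (by-gap (gap h) (eq′ p l (q * j)))
      u≡p : u + q * j ≡ p
      u≡p = ℤ.≤-antisym (by-gap (gap (≰⇒1+≤ ¬k) ⊕ q≤) (eq″ p q (u + q * j))) k

    -- q units more on the other side turn a vertex at the left end of its window
    -- into one at the right end, because demands only matter modulo q.
    flip-window : ∀ {l u} d → d ≤ 1ℤ → Within p q l u → Within q p (l - d) (u + (q - d))
    flip-window {l} {u} d d≤1 (j , h , k) =
      j - 1ℤ ,
      by-gap (gap h ⊕ gap d≤1 ⊕ gap 1≤p) (eq p q l d j) ,
      by-gap (gap k ⊕ gap d≤1 ⊕ q≥) (eq′ p q u d j)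
      where
      eq : ∀ p q l d j → l - (p + q * j) + (1ℤ - d) + (p - 1ℤ) ≡ l - d - (q + q * (j - 1ℤ))
      eq = solve-∀
      eq′ : ∀ p q u d j → u + q * j - q + (1ℤ - d) + (q - (1ℤ + p)) ≡ u + (q - d) + q * (j - 1ℤ) - p
      eq′ = solve-∀

-- Sets of labels

infix 4 _⊆_

_⊆_ : {A : Set} → (A → Bool) → (A → Bool) → Set
X ⊆ Y = ∀ l → X l ≡ true → Y l ≡ true

card : ∀ {m} → (Fin m → Bool) → ℕ
card {zero}  A = 0
card {suc m} A = (if A zero then 1 else 0) ℕ.+ card (A ∘ suc)

card-mono : ∀ {m} {A B : Fin m → Bool} → A ⊆ B → card A ℕ.≤ card B
card-mono {zero} h = z≤n
card-mono {suc m} {A} {B} h with A zero in eq | B zero in eq′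
... | false | _     = ℕ.≤-trans (card-mono (h ∘ suc)) (ℕ.m≤n+m _ _)
... | true  | true  = s≤s (card-mono (h ∘ suc))
... | true  | false = contradiction (trans (sym (h zero eq)) eq′) λ ()

card-strict : ∀ {m} {A B : Fin m → Bool} → A ⊆ B → ∀ z → B z ≡ true → A z ≡ false → card A ℕ.< card B
card-strict {suc m} {A} {B} h zero z∈ z∉ rewrite z∈ | z∉ = s≤s (card-mono (h ∘ suc))
card-strict {suc m} {A} {B} h (suc z) z∈ z∉ with A zero in eq | B zero in eq′
... | false | _     = ℕ.≤-trans (card-strict (h ∘ suc) z z∈ z∉) (ℕ.m≤n+m _ _)
... | true  | true  = s≤s (card-strict (h ∘ suc) z z∈ z∉)
... | true  | false = contradiction (trans (sym (h zero eq)) eq′) λ ()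

true≢false : ∀ {b} → b ≡ true → b ≡ false → ⊥
true≢false refl ()

⟦_⟧ : ∀ {m} → Fin m → Fin m → Bool
⟦ v ⟧ l = ⌊ v ≟ l ⌋

∈⟦⟧ : ∀ {m} (v : Fin m) → ⟦ v ⟧ v ≡ true
∈⟦⟧ v with v ≟ v
... | yes _ = refl
... | no ¬p = contradiction refl ¬p

∈⟦⟧⇒≡ : ∀ {m} {v l : Fin m} → ⟦ v ⟧ l ≡ true → v ≡ l
∈⟦⟧⇒≡ {v = v} {l} eq with v ≟ l
... | yes p = p
∈⟦⟧⇒≡ () | no _

∉⟦⟧ : ∀ {m} {v l : Fin m} → v ≢ l → ⟦ v ⟧ l ≡ false
∉⟦⟧ {v = v} {l} ne with v ≟ l
... | yes p = contradiction p ne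
... | no _  = refl

⟦⟧⊆ : ∀ {m} {v : Fin m} {A : Fin m → Bool} → A v ≡ true → ⟦ v ⟧ ⊆ A
⟦⟧⊆ {A = A} v∈ l l∈ = subst (λ l → A l ≡ true) (∈⟦⟧⇒≡ l∈) v∈

≡-from-⊆ : ∀ {b c : Bool} → (b ≡ true → c ≡ true) → (c ≡ true → b ≡ true) → b ≡ c
≡-from-⊆ {true}  {true}  f g = refl
≡-from-⊆ {true}  {false} f g = sym (f refl)
≡-from-⊆ {false} {true}  f g = g refl
≡-from-⊆ {false} {false} f g = refl

_∖_ : {A : Set} → (A → Bool) → (A → Bool) → A → Bool
(X ∖ Y) l = X l ∧ not (Y l)

∖⊆ : {A : Set} (X Y : A → Bool) → X ∖ Y ⊆ X
∖⊆ X Y l h with X l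
... | true = refl

∉∖ : {A : Set} (X Y : A → Bool) → ∀ l → (X ∖ Y) l ≡ true → Y l ≡ false
∉∖ X Y l h with X l | Y l
... | true | false = refl

∈∖ : {A : Set} {X Y : A → Bool} → ∀ l → X l ≡ true → Y l ≡ false → (X ∖ Y) l ≡ true
∈∖ l p p′ rewrite p | p′ = refl

merge : ∀ {m} → (x y : Fin m) → Fin m → Fin m
merge x y l = if ⟦ y ⟧ l then x else l

merge-≢ : ∀ {m} (x : Fin m) {y l} → y ≢ l → merge x y l ≡ l
merge-≢ x ne rewrite ∉⟦⟧ ne = refl

merge-saturated : ∀ {m} {A : Set} (B : Fin m → A) {x y} → B x ≡ B y → ∀ l → B (merge x y l) ≡ B l
merge-saturated B {x} {y} eq l with y ≟ l
... | yes refl = eq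
... | no  _    = refl

-- The reversal of one unit on the dart (i , β), as an antisymmetric flow.
unit : ∀ {m} → Fin m → Bool → Darts ℤ m
unit i β e b = δ i β e b - δ i (not β) e b

unit-anti : ∀ {m} (i : Fin m) β → Antisymmetric (unit i β)
unit-anti i true  e = lem (δ i true e false) (δ i false e false) (δ i true e true) (δ i false e true) off₁ off₂
  where
  off₁ : δ i true e false ≡ δ i false e true
  off₁ = trans (δ-≢ i true e false λ _ ()) (sym (δ-≢ i false e true λ _ ()))
  off₂ : δ i false e false ≡ δ i true e true
  off₂ with i ≟ e
  ... | yes _ = refl
  ... | no  _ = refl
  lem : ∀ a b c d → a ≡ d → b ≡ c → a - b ≡ - (c - d)
  lem a b _ _ refl refl = solve₂ a b
    where
    solve₂ : ∀ a b → a - b ≡ - (b - a)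
    solve₂ = solve-∀
unit-anti i false e = lem (δ i false e false) (δ i true e false) (δ i false e true) (δ i true e true) off₂ off₁
  where
  off₁ : δ i true e false ≡ δ i false e true
  off₁ = trans (δ-≢ i true e false λ _ ()) (sym (δ-≢ i false e true λ _ ()))
  off₂ : δ i false e false ≡ δ i true e true
  off₂ with i ≟ e
  ... | yes _ = refl
  ... | no  _ = refl
  lem : ∀ a b c d → a ≡ d → b ≡ c → a - b ≡ - (c - d)
  lem a b _ _ refl refl = solve₂ a b
    where
    solve₂ : ∀ a b → a - b ≡ - (b - a)
    solve₂ = solve-∀

another : ∀ {m} (A : Fin m → Bool) x → A x ≡ true →
  (∀ l → ⟦ x ⟧ l ≡ A l) ⊎ ∃[ y ] (A y ≡ true × y ≢ x)
another A x x∈ with any? (λ y → (A y ≟ᵇ true) ×-dec ¬? (y ≟ x))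
... | yes p = inj₂ p
... | no ¬p = inj₁ λ l → ≡-from-⊆ (⟦⟧⊆ {A = A} x∈ l) (only l)
  where
  only : ∀ l → A l ≡ true → ⟦ x ⟧ l ≡ true
  only l l∈ with l ≟ x
  ... | yes refl = ∈⟦⟧ l
  ... | no  ne   = ⊥-elim (¬p (l , l∈ , ne))

module _ {V : Set} {m : ℕ} (end : Darts V m) where

  net-unit : ∀ i β X → net end (unit i β) X ≡ X (end i β) - X (end i (not β))
  net-unit i β X = trans (cut-- end (δ i β) (δ i (not β)) X) (cong₂ _-_ (cut-δ end i β X) (cut-δ end i (not β) X))

-- Sending flow along parallel edges

module Route {n m : ℕ} (end : Darts (Fin n) m) (c : Darts ℤ m) (0≤c : ∀ e b → 0ℤ ≤ c e b) (x y : Fin n) where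

  toll : Darts ℤ m
  toll e b = 𝟙 (⟦ x ⟧ (end e b)) * 𝟙 (⟦ y ⟧ (end e (not b))) * c e b

  record Routing (t : ℤ) : Set where
    field
      flow    : Darts ℤ m
      anti    : Antisymmetric flow
      ≤cap    : ∀ e b → flow e b ≤ c e b
      support : ∀ e b → flow e b ≡ 0ℤ ⊎ (end e b ≡ x × end e (not b) ≡ y ⊎ end e b ≡ y × end e (not b) ≡ x)
      amount  : ∀ X → net end flow X ≡ t * (X x - X y)

  -- The amount is spread over the darts from `x` to `y`; subtracting it on the opposite darts makes
  -- it antisymmetric and only decreases values, so the capacities are still respected.
  route : ∀ t → 0ℤ ≤ t → t ≤ S toll → Routing t
  route t 0≤t t≤ = record
    { flow = λ e b → h e b - h e (not b) ; anti = λ e → lem (h e true) (h e false)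
    ; ≤cap = λ e b → by-gap (gap (proj₂ (bounds e b)) ⊕ gap (toll≤ e b) ⊕ proj₁ (bounds e (not b)))
        (lem₂ (h e b) (toll e b) (c e b) (h e (not b)))
    ; support = support ; amount = amount }
    where
    0≤toll : ∀ e b → 0ℤ ≤ toll e b
    0≤toll e b = 0≤*0≤ (0≤*0≤ (0≤𝟙 (⟦ x ⟧ (end e b))) (0≤𝟙 (⟦ y ⟧ (end e (not b))))) (0≤c e b)
    distribution = distribute toll 0≤toll t 0≤t t≤
    h : Darts ℤ m
    h = proj₁ distribution
    bounds : ∀ e b → 0ℤ ≤ h e b × h e b ≤ toll e b
    bounds = proj₁ (proj₂ distribution)
    Sh : S h ≡ t
    Sh = proj₂ (proj₂ distribution)
    toll≤ : ∀ e b → toll e b ≤ c e b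
    toll≤ e b with ⟦ x ⟧ (end e b) | ⟦ y ⟧ (end e (not b))
    ... | true  | true  = ℤ.≤-reflexive (ℤ.*-identityˡ (c e b))
    ... | true  | false = subst (_≤ c e b) (sym (ℤ.*-zeroˡ (c e b))) (0≤c e b)
    ... | false | true  = subst (_≤ c e b) (sym (ℤ.*-zeroˡ (c e b))) (0≤c e b)
    ... | false | false = subst (_≤ c e b) (sym (ℤ.*-zeroˡ (c e b))) (0≤c e b)
    lem : ∀ a b → b - a ≡ - (a - b)
    lem = solve-∀
    lem₂ : ∀ a f c b → f - a + (c - f) + b ≡ c - (a - b)
    lem₂ = solve-∀
    h-support : ∀ e b → h e b ≡ 0ℤ ⊎ (end e b ≡ x × end e (not b) ≡ y)
    h-support e b with x ≟ end e b | y ≟ end e (not b) | bounds e b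
    ... | yes p | yes p′ | _       = inj₂ (sym p , sym p′)
    ... | yes _ | no  _  | lo , hi = inj₁ (ℤ.≤-antisym (subst (h e b ≤_) (ℤ.*-zeroˡ (c e b)) hi) lo)
    ... | no  _ | yes _  | lo , hi = inj₁ (ℤ.≤-antisym (subst (h e b ≤_) (ℤ.*-zeroˡ (c e b)) hi) lo)
    ... | no  _ | no  _  | lo , hi = inj₁ (ℤ.≤-antisym (subst (h e b ≤_) (ℤ.*-zeroˡ (c e b)) hi) lo)
    support : ∀ e b → h e b - h e (not b) ≡ 0ℤ ⊎ (end e b ≡ x × end e (not b) ≡ y ⊎ end e b ≡ y × end e (not b) ≡ x)
    support e b with h-support e b | h-support e (not b)
    ... | inj₂ p | _ = inj₂ (inj₁ p)
    ... | inj₁ _ | inj₂ (p , p′) = inj₂ (inj₂ (trans (cong (end e) (sym (not-involutive b))) p′ , p))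
    ... | inj₁ p | inj₁ p′ = inj₁ (cong₂ _-_ p p′)
    from : ∀ e b → end e b ≡ x ⊎ h e b ≡ 0ℤ
    from e b with h-support e b
    ... | inj₁ p = inj₂ p
    ... | inj₂ (p , _) = inj₁ p
    to : ∀ e b → end e b ≡ y ⊎ h e (not b) ≡ 0ℤ
    to e b with h-support e (not b)
    ... | inj₁ p = inj₂ p
    ... | inj₂ (_ , p) = inj₁ (trans (cong (end e) (sym (not-involutive b))) p)
    amount : ∀ X → net end (λ e b → h e b - h e (not b)) X ≡ t * (X x - X y)
    amount X = begin
      net end (h -ᵈ (λ e b → h e (not b))) X       ≡⟨ cut-- end h (λ e b → h e (not b)) X ⟩
      net end h X - net end (λ e b → h e (not b)) X
        ≡⟨ cong₂ _-_ (net-supported end X x from) (net-supported end X y to) ⟩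
      X x * S h - X y * S (λ e b → h e (not b))
        ≡⟨ cong₂ (λ a b → X x * a - X y * b) Sh (trans (S-reverse h) Sh) ⟩
      X x * t - X y * t                            ≡⟨ lem₃ (X x) (X y) t ⟩
      t * (X x - X y)                              ∎
      where
      open ≡-Reasoning
      lem₃ : ∀ a b t → a * t - b * t ≡ t * (a - b)
      lem₃ = solve-∀

-- The theorem of Lovász, Thomassen, Wu and Zhang

module Networks (n : ℕ) (p q : ℤ) (1≤p : 1ℤ ≤ p) (q≡1+p : q ≡ 1ℤ + p) where
  open Windows p q 1≤p q≡1+p public

  -- The inactive labels, among them zero, together form the vertex z₀ of the
  -- induction, whose edges already have their final orientation.  A dart of
  -- capacity c can be reversed up to c times.  The sum of dem over the darts with
  -- source v is the number of reversals of entering minus leaving darts that is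
  -- required at v modulo q.
  record Network : Set where
    field
      {size} : ℕ
      end : Darts (Fin (suc n)) size
      cap dem : Darts ℤ size
      active : Fin (suc n) → Bool

    leaving entering demand L U : (Fin (suc n) → Bool) → ℤ
    leaving  A = out end cap (𝟙 ∘ A)
    entering A = inn end cap (𝟙 ∘ A)
    demand   A = net end dem (𝟙 ∘ A)
    L A = demand A + leaving A
    U A = entering A - demand A

    LU-cong : ∀ {a b A B} → (∀ l → A l ≡ B l) → Within a b (L A) (U A) → Within a b (L B) (U B)
    LU-cong {a} {b} eq = subst₂ (Within a b)
      (cong₂ _+_ (cut-cong end dem (cong 𝟙 ∘ eq)) (cut-cong end cap (cong 𝟙 ∘ eq)))
      (cong₂ _-_ (cut-cong end cap (cong 𝟙 ∘ eq)) (cut-cong end dem (cong 𝟙 ∘ eq)))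

    LU-balanced : ∀ {A B} → (∀ l → A l ≡ B l) → Balanced (L A) (U A) → Balanced (L B) (U B)
    LU-balanced eq = subst₂ Balanced
      (cong₂ _+_ (cut-cong end dem (cong 𝟙 ∘ eq)) (cut-cong end cap (cong 𝟙 ∘ eq)))
      (cong₂ _-_ (cut-cong end cap (cong 𝟙 ∘ eq)) (cut-cong end dem (cong 𝟙 ∘ eq)))

    -- The sets subject to `good`: `x` rules out the empty set and `v₀` alone, and `z` rules out all
    -- of `active`, which is governed by `total` and `root`.
    record Proper (v₀ : Fin (suc n)) (A : Fin (suc n) → Bool) : Set where
      constructor proper
      field
        sub : A ⊆ active
        {x} : Fin (suc n)
        x∈  : A x ≡ true
        x≢  : x ≢ v₀
        {z} : Fin (suc n)
        z∈  : active z ≡ true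
        z∉  : A z ≡ false

    -- If v₀ is active, the cut around v₀ alone is exempt from the condition good.
    record Valid (v₀ : Fin (suc n)) : Set where
      field
        0≤cap    : ∀ e b → 0ℤ ≤ cap e b
        inactive : active zero ≡ false
        total    : ∃[ j ] demand active ≡ q * j
        root     : Root (entering active) (leaving active)
        good     : ∀ {A} → Proper v₀ A → ¬ ¬ Within p p (L A) (U A)
        balanced : active v₀ ≡ true → Balanced (L ⟦ v₀ ⟧) (U ⟦ v₀ ⟧)

    -- By additivity `meets` could be restricted to single vertices; it is stated for sets because
    -- these pull back along a contraction.
    record Solution : Set where
      field
        flow  : Darts ℤ size
        anti  : Antisymmetric flow
        ≤cap  : ∀ e b → flow e b ≤ cap e b
        fixed : ∀ e b → active (end e b) ≡ false → flow e b ≡ 0ℤ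
        meets : ∀ {B} → B ⊆ active → ∃[ j ] net end (dem +ᵈ flow) (𝟙 ∘ B) ≡ q * j

    energy fringe : ℤ
    energy = inside end cap (𝟙 ∘ active)
    fringe = entering active + leaving active

  open Network public

  -- Reversing darts, restricting and contracting

  restrict : Network → (Fin (suc n) → Bool) → Network
  restrict N A = record { end = end N ; cap = cap N ; dem = dem N ; active = A }

  shift : (N : Network) → Darts ℤ (size N) → Network
  shift N g = record { end = end N ; cap = cap N -ᵈ g ; dem = dem N +ᵈ g ; active = active N }

  -- The type of labels stays the same: no dart ends at `y` any more, and `y` becomes inactive.
  -- Demands sit on darts, so those at `y` pass to `x` by themselves.
  contract : Network → (x y : Fin (suc n)) → Network
  contract N x y = record
    { end = λ e b → merge x y (end N e b) ; cap = cap N ; dem = dem N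
    ; active = active N ∖ ⟦ y ⟧ }

  module _ (N : Network) {v₀ : Fin (suc n)} (valid : Valid N v₀) where
    open Valid valid

    proper-weaken : ∀ {A B} → Proper N v₀ A → B ⊆ A → ∀ {x z} → B x ≡ true → x ≢ v₀ → A z ≡ true → B z ≡ false →
      Proper N v₀ B
    proper-weaken A-proper B⊆A x∈ x≢ z∈ z∉ =
      proper (λ l → sub l ∘ B⊆A l) x∈ x≢ (sub _ z∈) z∉
      where open Proper A-proper using (sub)

    module _ {g} (anti : Antisymmetric g) (≤cap : ∀ e b → g e b ≤ cap N e b) where

      -- Reversals out of `A` add to its demand what they take from its leaving capacity. Thus `L`
      -- and `U`, and with them all windows, are invariant under reversals.
      L-shift : ∀ A → L (shift N g) A ≡ L N A
      L-shift A = trans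
        (cong₂ _+_ (cut-+ (end N) (dem N) g (𝟙 ∘ A)) (cut-- (end N) (cap N) g (𝟙 ∘ A)))
        (trans (cong (λ r → demand N A + r + (leaving N A - out (end N) g (𝟙 ∘ A))) (net-antisym (end N) anti (𝟙 ∘ A)))
               (lem (demand N A) (leaving N A) _))
        where
        lem : ∀ d o g → d + g + (o - g) ≡ d + o
        lem = solve-∀

      U-shift : ∀ A → U (shift N g) A ≡ U N A
      U-shift A = trans
        (cong₂ _-_ (trans (cut-- (end N) (cap N) g (𝟙 ∘ A)) (cong (λ r → entering N A - r) (inn-antisym (end N) anti (𝟙 ∘ A))))
                   (trans (cut-+ (end N) (dem N) g (𝟙 ∘ A)) (cong (λ r → demand N A + r) (net-antisym (end N) anti (𝟙 ∘ A)))))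
        (lem (entering N A) (demand N A) _)
        where
        lem : ∀ i d g → i - (- g) - (d + g) ≡ i - d
        lem = solve-∀

      within-shift : ∀ {a b A} → Within a b (L N A) (U N A) → Within a b (L (shift N g) A) (U (shift N g) A)
      within-shift {a} {b} {A} = subst₂ (Within a b) (sym (L-shift A)) (sym (U-shift A))

      balanced-shift : ∀ {A} → Balanced (L N A) (U N A) → Balanced (L (shift N g) A) (U (shift N g) A)
      balanced-shift {A} = subst₂ Balanced (sym (L-shift A)) (sym (U-shift A))

      0≤cap-shift : ∀ e b → 0ℤ ≤ (cap N -ᵈ g) e b
      0≤cap-shift e b = gap (≤cap e b)

      -- After the reversals the demand of `A` is q j itself, so its remaining capacities are U + q
      -- j and L - q j, the form required by `root-of-tight`. Subsets of `A` keep the windows that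
      -- they have in `N`.
      restrict-shift-valid : ∀ {A} → Proper N v₀ A →
        ∃[ j ] demand (shift N g) A ≡ q * j →
        Within p p (L N A) (U N A) → ¬ Within q q (L N A) (U N A) →
        Valid (restrict (shift N g) A) v₀
      restrict-shift-valid {A} A-proper (j , met) w ¬strict = record
        { 0≤cap    = 0≤cap-shift
        ; inactive = zero∉
        ; total    = j , met
        ; root     = subst₂ Root (sym entering≡) (sym leaving≡) $ root-of-tight {L N A} {U N A} j w ¬strict
            (subst (0ℤ ≤_) entering≡ (0≤inn (end N) 0≤cap-shift A))
            (subst (0ℤ ≤_) leaving≡ (0≤out (end N) 0≤cap-shift A))
        ; good     = λ { {B} (proper B⊆A x∈ x≢ z∈ z∉) ¬w →
            good (proper-weaken A-proper B⊆A x∈ x≢ z∈ z∉) (¬w ∘ within-shift {p} {p} {B}) }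
        ; balanced = λ v₀∈A → balanced-shift (balanced (sub v₀ v₀∈A))
        }
        where
        open Proper A-proper using (sub)
        N′ = shift N g
        zero∉ : A zero ≡ false
        zero∉ with A zero in eq
        ... | false = refl
        ... | true  = ⊥-elim (true≢false (sub zero eq) inactive)
        entering≡ : entering N′ A ≡ U N A + q * j
        entering≡ = trans (lem (entering N′ A) (demand N′ A)) (cong₂ _+_ (U-shift A) met)
          where
          lem : ∀ i d → i ≡ i - d + d
          lem = solve-∀
        leaving≡ : leaving N′ A ≡ L N A - q * j
        leaving≡ = trans (lem (leaving N′ A) (demand N′ A)) (cong₂ _-_ (L-shift A) met)
          where
          lem : ∀ o d → o ≡ d + o - d
          lem = solve-∀

      module _ (fixed : ∀ e b → active N (end N e b) ≡ false → g e b ≡ 0ℤ) where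

        out-active≡0 : out (end N) g (𝟙 ∘ active N) ≡ 0ℤ
        out-active≡0 = out-zero (end N) (active N) λ e b _ ∉ → begin
          g e b           ≡⟨ cong (g e) (sym (not-involutive b)) ⟩
          g e (not (not b)) ≡⟨ antisym {g = g} anti e (not b) ⟩
          - g e (not b)   ≡⟨ cong -_ (fixed e (not b) ∉) ⟩
          0ℤ              ∎
          where open ≡-Reasoning

        leaving-active-shift : leaving (shift N g) (active N) ≡ leaving N (active N)
        leaving-active-shift = trans (cut-- (end N) (cap N) g (𝟙 ∘ active N))
          (trans (cong (λ r → leaving N (active N) - r) out-active≡0) (ℤ.+-identityʳ _))

        entering-active-shift : entering (shift N g) (active N) ≡ entering N (active N)
        entering-active-shift = trans (cut-- (end N) (cap N) g (𝟙 ∘ active N))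
          (trans (cong (λ r → entering N (active N) - r) (trans (inn-antisym (end N) anti (𝟙 ∘ active N)) (cong -_ out-active≡0)))
                 (ℤ.+-identityʳ _))

        demand-active-shift : demand (shift N g) (active N) ≡ demand N (active N)
        demand-active-shift = trans (cut-+ (end N) (dem N) g (𝟙 ∘ active N))
          (trans (cong (λ r → demand N (active N) + r) (trans (net-antisym (end N) anti (𝟙 ∘ active N)) out-active≡0))
                 (ℤ.+-identityʳ _))

        shift-valid : Valid (shift N g) v₀
        shift-valid = record
          { 0≤cap    = 0≤cap-shift
          ; inactive = inactive
          ; total    = proj₁ total , trans demand-active-shift (proj₂ total)
          ; root     = subst₂ Root (sym entering-active-shift) (sym leaving-active-shift) root
          ; good     = λ { {B} (proper B⊆ x∈ x≢ z∈ z∉) ¬w →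
              good (proper B⊆ x∈ x≢ z∈ z∉) (¬w ∘ within-shift {p} {p} {B}) }
          ; balanced = λ v₀∈ → balanced-shift (balanced v₀∈)
          }

        energy-shift : energy (shift N g) ≡ energy N
        energy-shift = trans (cut-- (end N) (cap N) g (𝟙 ∘ active N))
          (trans (cong (λ r → energy N - r) (inside-antisym (end N) anti (𝟙 ∘ active N))) (ℤ.+-identityʳ _))

        shift-solution : Solution (shift N g) → Solution N
        shift-solution s = record
          { flow  = g +ᵈ flow
          ; anti  = λ e → trans (cong₂ _+_ (anti e) (anti′ e)) (sym (ℤ.neg-distrib-+ (g e true) (flow e true)))
          ; ≤cap  = λ e b → by-gap (gap (≤cap′ e b)) (lem (cap N e b) (g e b) (flow e b))
          ; fixed = λ e b ∉ → cong₂ _+_ (fixed e b ∉) (fixed′ e b ∉)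
          ; meets = λ {B} B⊆ → case meets B⊆ of λ (j , eq) →
              j , trans (cut-≗ (end N) (𝟙 ∘ B) λ e b → sym (ℤ.+-assoc (dem N e b) (g e b) (flow e b))) eq
          }
          where
          open Solution s renaming (anti to anti′; ≤cap to ≤cap′; fixed to fixed′)
          lem : ∀ c g f → c - g - f ≡ c - (g + f)
          lem = solve-∀

    L-contract : ∀ x y B → L (contract N x y) B ≡ L N (B ∘ merge x y)
    L-contract x y B = cong₂ _+_
      (cut-relabel (end N) (dem N) (merge x y) (𝟙 ∘ B))
      (cut-relabel (end N) (cap N) (merge x y) (𝟙 ∘ B))

    U-contract : ∀ x y B → U (contract N x y) B ≡ U N (B ∘ merge x y)
    U-contract x y B = cong₂ _-_
      (cut-relabel (end N) (cap N) (merge x y) (𝟙 ∘ B))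
      (cut-relabel (end N) (dem N) (merge x y) (𝟙 ∘ B))

    module _ {x y} (x∈ : active N x ≡ true) (y∈ : active N y ≡ true) (x≢y : x ≢ y) (x≢v₀ : x ≢ v₀) where

      private
        N₁ = contract N x y

      active-contract : ∀ l → active N₁ (merge x y l) ≡ active N l
      active-contract l with y ≟ l
      ... | yes refl rewrite x∈ | y∈ | ∉⟦⟧ (≢-sym x≢y) = refl
      ... | no  ne rewrite ∉⟦⟧ ne with active N l
      ... | true  = refl
      ... | false = refl

      contract-⊆ : ∀ {B} → B ⊆ active N₁ → B ∘ merge x y ⊆ active N
      contract-⊆ {B} B⊆ l l∈ = trans (sym (active-contract l)) (B⊆ (merge x y l) l∈)

      contract-merge : ∀ {l} → active N₁ l ≡ true → merge x y l ≡ l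
      contract-merge {l} l∈ = merge-≢ x λ { refl → true≢false (∈⟦⟧ y) (∉∖ (active N) ⟦ y ⟧ l l∈) }

      contract-proper : ∀ {B} → Proper N₁ v₀ B → Proper N v₀ (B ∘ merge x y)
      contract-proper {B} (proper B⊆ {z} z∈ z≢ {w} w∈ w∉) = proper (contract-⊆ B⊆)
        (trans (cong B (contract-merge (B⊆ z z∈))) z∈) z≢
        (∖⊆ (active N) ⟦ y ⟧ w w∈) (trans (cong B (contract-merge w∈)) w∉)

      contract-valid : Valid N₁ v₀
      contract-valid = record
        { 0≤cap    = 0≤cap
        ; inactive = inactive′
        ; total    = proj₁ total , trans (cut-relabel (end N) (dem N) (merge x y) (𝟙 ∘ active N₁))
                       (trans (cut-cong (end N) (dem N) (cong 𝟙 ∘ active-contract)) (proj₂ total))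
        ; root     = subst₂ Root
            (sym (trans (cut-relabel (end N) (cap N) (merge x y) (𝟙 ∘ active N₁)) (cut-cong (end N) (cap N) (cong 𝟙 ∘ active-contract))))
            (sym (trans (cut-relabel (end N) (cap N) (merge x y) (𝟙 ∘ active N₁)) (cut-cong (end N) (cap N) (cong 𝟙 ∘ active-contract))))
            root
        ; good     = λ {B} B-proper ¬w → good (contract-proper B-proper)
            (¬w ∘ subst₂ (Within p p) (sym (L-contract x y B)) (sym (U-contract x y B)))
        ; balanced = λ v₀∈ → subst₂ Balanced (sym (L-contract x y ⟦ v₀ ⟧)) (sym (U-contract x y ⟦ v₀ ⟧)) $
            LU-balanced N (λ l → sym (merge-saturated ⟦ v₀ ⟧ (same v₀∈) l)) (balanced (∖⊆ (active N) ⟦ y ⟧ v₀ v₀∈))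
        }
        where
        inactive′ : active N₁ zero ≡ false
        inactive′ rewrite inactive = refl
        same : active N₁ v₀ ≡ true → ⟦ v₀ ⟧ x ≡ ⟦ v₀ ⟧ y
        same v₀∈ = trans (∉⟦⟧ (≢-sym x≢v₀)) (sym (∉⟦⟧ λ { refl → true≢false (∈⟦⟧ y) (∉∖ (active N) ⟦ y ⟧ y v₀∈) }))

      -- A set that does not separate `x` from `y` is the preimage under `merge x y` of the same set
      -- without `y`.
      contract-meets : ∀ {d} → (∀ {B} → B ⊆ active N₁ → ∃[ j ] net (end N₁) d (𝟙 ∘ B) ≡ q * j) →
        ∀ {B} → B ⊆ active N → B x ≡ B y → ∃[ j ] net (end N) d (𝟙 ∘ B) ≡ q * j
      contract-meets {d} meets {B} B⊆ Bx≡By = case meets {B ∖ ⟦ y ⟧} B′⊆ of λ (j , eq) →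
        j , trans (cut-cong (end N) d (λ l → cong 𝟙 (same l)))
              (trans (sym (cut-relabel (end N) d (merge x y) (𝟙 ∘ (B ∖ ⟦ y ⟧)))) eq)
        where
        B′⊆ : B ∖ ⟦ y ⟧ ⊆ active N₁
        B′⊆ l l∈ = ∈∖ {X = active N} {Y = ⟦ y ⟧} l (B⊆ l (∖⊆ B ⟦ y ⟧ l l∈)) (∉∖ B ⟦ y ⟧ l l∈)
        same : ∀ l → B l ≡ (B ∖ ⟦ y ⟧) (merge x y l)
        same l with y ≟ l
        ... | yes refl rewrite ∉⟦⟧ (≢-sym x≢y) with B x
        ...   | true  = sym Bx≡By
        ...   | false = sym Bx≡By
        same l | no ne rewrite ∉⟦⟧ ne with B l
        ... | true  = refl
        ... | false = refl

      contract-fixed : ∀ {g : Darts ℤ (size N)} → (∀ e b → active N₁ (end N₁ e b) ≡ false → g e b ≡ 0ℤ) →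
        ∀ e b → active N (end N e b) ≡ false → g e b ≡ 0ℤ
      contract-fixed fixed e b ∉ = fixed e b (trans (active-contract (end N e b)) ∉)

      card-contract : card (active N₁) ℕ.< card (active N)
      card-contract = card-strict (∖⊆ (active N) ⟦ y ⟧) y y∈ y∉
        where
        y∉ : active N₁ y ≡ false
        y∉ rewrite y∈ | ∈⟦⟧ y = refl

  p≤q : p ≤ q
  p≤q = by-gap (q≥ ⊕ +≤+ {n = 1} z≤n) (lem p q)
    where
    lem : ∀ p q → q - (1ℤ + p) + 1ℤ ≡ q - p
    lem = solve-∀

  within-weaken : ∀ {a b a′ b′ l u} → a′ ≤ a → b′ ≤ b → Within a b l u → Within a′ b′ l u
  within-weaken {a} {b} {a′} {b′} {l} {u} a′≤a b′≤b =
    within-mono {a} {b} {l} {u} {a′} {b′}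
      (by-gap (gap a′≤a) (lem a a′ l)) (by-gap (gap b′≤b) (lem b b′ u))
    where
    lem : ∀ a a′ l → a - a′ ≡ l - l - (a′ - a)
    lem = solve-∀

  within-dropₗ : ∀ {b l u} → Within q b l u → Within p b (l - 1ℤ) u
  within-dropₗ {b} {l} {u} = within-mono {q} {b} {l} {u} {p} {b}
    (by-gap q≥ (lem p q l)) (ℤ.≤-reflexive (lem′ b u))
    where
    lem : ∀ p q l → q - (1ℤ + p) ≡ l - 1ℤ - l - (p - q)
    lem = solve-∀
    lem′ : ∀ b u → b - b ≡ u - u
    lem′ = solve-∀

  within-dropᵤ : ∀ {a l u} → Within a q l u → Within a p l (u - 1ℤ)
  within-dropᵤ = within-sym ∘ within-dropₗ ∘ within-sym

  -- Deleting a dart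

  module _ (N : Network) (i : Fin (size N)) (β : Bool) where

    -- One unit of the dart keeps its present direction for good, so the demands do not change.
    delete : Network
    delete = record { end = end N ; cap = cap N -ᵈ δ i β ; dem = dem N ; active = active N }

    private
      s t : Fin (suc n)
      s = end N i β
      t = end N i (not β)

    leaving-delete : ∀ A → leaving delete A ≡ leaving N A - 𝟙 (A s) * (1ℤ - 𝟙 (A t))
    leaving-delete A = trans (cut-- (end N) (cap N) (δ i β) (𝟙 ∘ A)) (cong (λ r → leaving N A - r) (cut-δ (end N) i β (𝟙 ∘ A)))

    entering-delete : ∀ A → entering delete A ≡ entering N A - (1ℤ - 𝟙 (A s)) * 𝟙 (A t)
    entering-delete A = trans (cut-- (end N) (cap N) (δ i β) (𝟙 ∘ A)) (cong (λ r → entering N A - r) (cut-δ (end N) i β (𝟙 ∘ A)))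

    energy-delete : energy delete ≡ energy N - 𝟙 (active N s) * 𝟙 (active N t)
    energy-delete = trans (cut-- (end N) (cap N) (δ i β) (𝟙 ∘ active N)) (cong (λ r → energy N - r) (cut-δ (end N) i β (𝟙 ∘ active N)))

    L-delete : ∀ A → L delete A ≡ L N A - 𝟙 (A s) * (1ℤ - 𝟙 (A t))
    L-delete A = trans (cong (λ r → demand N A + r) (leaving-delete A)) (sym (ℤ.+-assoc (demand N A) (leaving N A) _))

    U-delete : ∀ A → U delete A ≡ U N A - (1ℤ - 𝟙 (A s)) * 𝟙 (A t)
    U-delete A = trans (cong (_- demand N A) (entering-delete A)) (lem (entering N A) (demand N A) ((1ℤ - 𝟙 (A s)) * 𝟙 (A t)))
      where
      lem : ∀ i d x → i - x - d ≡ i - d - x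
      lem = solve-∀

    delete-solution : Solution delete → Solution N
    delete-solution sol = record
      { flow  = flow ; anti = anti
      ; ≤cap  = λ e b → ℤ.≤-trans (≤cap e b) (by-gap (0≤δ i β e b) (lem (cap N e b) (δ i β e b)))
      ; fixed = fixed ; meets = meets }
      where
      open Solution sol
      lem : ∀ c d → d ≡ c - (c - d)
      lem = solve-∀

    module _ {v₀} (valid : Valid N v₀) (1≤cap : 1ℤ ≤ cap N i β) where
      open Valid valid

      0≤cap-delete : ∀ e b → 0ℤ ≤ cap N e b - δ i β e b
      0≤cap-delete e b = gap (δ≤ 0≤cap i β 1≤cap e b)

      -- Only sets separating the ends of the dart lose a unit, of `L` if it leaves them and of `U`
      -- if it enters them. The two hypotheses grant them this unit.
      delete-valid : active N v₀ ≡ false →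
        (∀ {A} → Proper N v₀ A → A s ≡ true → A t ≡ false → ¬ ¬ Within q p (L N A) (U N A)) →
        (∀ {A} → Proper N v₀ A → A s ≡ false → A t ≡ true → ¬ ¬ Within p q (L N A) (U N A)) →
        Valid delete v₀
      delete-valid v₀∉ left right = record
        { 0≤cap    = 0≤cap-delete
        ; inactive = inactive
        ; total    = total
        ; root     = root-mono
            (subst (_≤ entering N (active N)) (sym (entering-delete (active N)))
              (minus-≤ (0≤*0≤ (0≤1-𝟙 (active N s)) (0≤𝟙 (active N t)))))
            (subst (_≤ leaving N (active N)) (sym (leaving-delete (active N)))
              (minus-≤ (0≤*0≤ (0≤𝟙 (active N s)) (0≤1-𝟙 (active N t)))))
            root
        ; good     = λ { {A} (proper A⊆ x∈ x≢ z∈ z∉) ¬w → window (proper A⊆ x∈ x≢ z∈ z∉) (A s) (A t) refl refl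
            (¬w ∘ subst₂ (Within p p) (sym (L-delete A)) (sym (U-delete A))) }
        ; balanced = λ v₀∈ → ⊥-elim (true≢false v₀∈ v₀∉)
        }
        where
        minus-≤ : ∀ {a x} → 0ℤ ≤ x → a - x ≤ a
        minus-≤ {a} {x} 0≤x = by-gap 0≤x (lem a x)
          where
          lem : ∀ a x → x ≡ a - (a - x)
          lem = solve-∀
        window : ∀ {A} → Proper N v₀ A → ∀ b c → A s ≡ b → A t ≡ c →
          ¬ ¬ Within p p (L N A - 𝟙 b * (1ℤ - 𝟙 c)) (U N A - (1ℤ - 𝟙 b) * 𝟙 c)
        window {A} A-proper true  true  _ _ ¬w = good A-proper λ w →
          ¬w (subst₂ (Within p p) (sym (ℤ.+-identityʳ (L N A))) (sym (ℤ.+-identityʳ (U N A))) w)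
        window {A} A-proper false false _ _ ¬w = good A-proper λ w →
          ¬w (subst₂ (Within p p) (sym (ℤ.+-identityʳ (L N A))) (sym (ℤ.+-identityʳ (U N A))) w)
        window {A} A-proper true false eq eq′ ¬w = left A-proper eq eq′ λ w →
          ¬w (subst (Within p p (L N A - 1ℤ)) (sym (ℤ.+-identityʳ (U N A))) (within-dropₗ w))
        window {A} A-proper false true eq eq′ ¬w = right A-proper eq eq′ λ w →
          ¬w (subst (λ l → Within p p l (U N A - 1ℤ)) (sym (ℤ.+-identityʳ (L N A))) (within-dropᵤ w))

  -- Vertex sets without edges between them

  Separated : Network → (A B : Fin (suc n) → Bool) → Set
  Separated N A B = ∀ e b → A (end N e b) ≡ true → B (end N e (not b)) ≡ true →
    cap N e b ≡ 0ℤ × cap N e (not b) ≡ 0ℤ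

  module _ (N : Network) {A : Fin (suc n) → Bool} (A⊆ : A ⊆ active N) where

    private
      B = active N ∖ A

    union : ∀ l → ((𝟙 ∘ A) +ˣ (𝟙 ∘ B)) l ≡ 𝟙 (active N l)
    union l with A l in eq | active N l in eq′
    ... | true  | true  = refl
    ... | true  | false = ⊥-elim (true≢false (A⊆ l eq) eq′)
    ... | false | true  = refl
    ... | false | false = refl

    module _ (separated : Separated N A B) where

      leaving-separated : leaving N A + leaving N B ≡ leaving N (active N)
      leaving-separated = trans (out-+ˣ (end N) (cap N) (𝟙 ∘ A) (𝟙 ∘ B)) (trans
        (cong₂ _+_ (cut-cong (end N) (cap N) union) (between-zero (end N) A B separated))
        (ℤ.+-identityʳ _))

      entering-separated : entering N A + entering N B ≡ entering N (active N)
      entering-separated = trans (inn-+ˣ (end N) (cap N) (𝟙 ∘ A) (𝟙 ∘ B)) (trans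
        (cong₂ _+_ (cut-cong (end N) (cap N) union) (between-zero (end N) A B separated))
        (ℤ.+-identityʳ _))

      demand-separated : demand N A + demand N B ≡ demand N (active N)
      demand-separated = trans (sym (net-+ˣ (end N) (dem N) (𝟙 ∘ A) (𝟙 ∘ B))) (cut-cong (end N) (dem N) union)

      L-separated : ∀ {k} → demand N (active N) ≡ k → L N A + L N B ≡ k + leaving N (active N)
      L-separated eq = trans (lem (demand N A) (leaving N A) (demand N B) (leaving N B))
        (cong₂ _+_ (trans demand-separated eq) leaving-separated)
        where
        lem : ∀ a b c d → a + b + (c + d) ≡ a + c + (b + d)
        lem = solve-∀

      U-separated : ∀ {k} → demand N (active N) ≡ k → U N A + U N B ≡ entering N (active N) - k
      U-separated eq = trans (lem (demand N A) (entering N A) (demand N B) (entering N B))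
        (cong₂ _-_ entering-separated (trans demand-separated eq))
        where
        lem : ∀ a b c d → b - a + (d - c) ≡ b + d - (a + c)
        lem = solve-∀

  positive : ∀ {x} → 0ℤ ≤ x → x ≢ 0ℤ → 1ℤ ≤ x
  positive {+ zero}  _ ne = ⊥-elim (ne refl)
  positive {+ suc _} _ _  = +≤+ (s≤s z≤n)

  Adjacent : Network → (x y : Fin (suc n)) → Set
  Adjacent N x y = ∃₂ λ e b → end N e b ≡ x × end N e (not b) ≡ y × (1ℤ ≤ cap N e b ⊎ 1ℤ ≤ cap N e (not b))

  nonadjacent : ∀ {N v₀} → Valid N v₀ → ∀ e b → ¬ Adjacent N (end N e b) (end N e (not b)) →
    cap N e b ≡ 0ℤ × cap N e (not b) ≡ 0ℤ
  nonadjacent {N} valid e b ¬adj = zeros (cap N e b ℤ.≟ 0ℤ) (cap N e (not b) ℤ.≟ 0ℤ)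
    where
    open Valid valid
    zeros : Dec (cap N e b ≡ 0ℤ) → Dec (cap N e (not b) ≡ 0ℤ) → cap N e b ≡ 0ℤ × cap N e (not b) ≡ 0ℤ
    zeros (yes p) (yes p′) = p , p′
    zeros (no ¬p) _        = ⊥-elim (¬adj (e , b , refl , refl , inj₁ (positive (0≤cap e b) ¬p)))
    zeros (yes _) (no ¬p)  = ⊥-elim (¬adj (e , b , refl , refl , inj₂ (positive (0≤cap e (not b)) ¬p)))

  separated-if : ∀ {N v₀} → Valid N v₀ → ∀ {A B} →
    (∀ x y → A x ≡ true → B y ≡ true → ¬ Adjacent N x y) → Separated N A B
  separated-if valid ¬adj e b s t = nonadjacent valid e b (¬adj _ _ s t)

  -- Adding an edge

  module _ (N : Network) (u w : Fin (suc n)) (κ : ℤ) (c : Darts ℤ (size N)) where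

    add-edge : Network
    add-edge = record { end = cons u w (end N) ; cap = cons κ 0ℤ c ; dem = cons 0ℤ 0ℤ (dem N) ; active = active N }

    demand-add : ∀ A → demand add-edge A ≡ demand N A
    demand-add A = trans (cut-cons (end N) u w 0ℤ 0ℤ (dem N) (𝟙 ∘ A)) (lem (𝟙 (A u)) (𝟙 (A w)) (demand N A))
      where
      lem : ∀ a b d → a * 0ℤ + b * 0ℤ + d ≡ d
      lem = solve-∀

    leaving-add : ∀ A → leaving add-edge A ≡ 𝟙 (A u) * (1ℤ - 𝟙 (A w)) * κ + out (end N) c (𝟙 ∘ A)
    leaving-add A = trans (cut-cons (end N) u w κ 0ℤ c (𝟙 ∘ A)) (lem (𝟙 (A u)) (𝟙 (A w)) κ _)
      where
      lem : ∀ a b k d → a * (1ℤ - b) * k + b * (1ℤ - a) * 0ℤ + d ≡ a * (1ℤ - b) * k + d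
      lem = solve-∀

    entering-add : ∀ A → entering add-edge A ≡ (1ℤ - 𝟙 (A u)) * 𝟙 (A w) * κ + inn (end N) c (𝟙 ∘ A)
    entering-add A = trans (cut-cons (end N) u w κ 0ℤ c (𝟙 ∘ A)) (lem (𝟙 (A u)) (𝟙 (A w)) κ _)
      where
      lem : ∀ a b k d → (1ℤ - a) * b * k + (1ℤ - b) * a * 0ℤ + d ≡ (1ℤ - a) * b * k + d
      lem = solve-∀

    energy-add : energy add-edge ≡ 𝟙 (active N u) * 𝟙 (active N w) * κ + inside (end N) c (𝟙 ∘ active N)
    energy-add = trans (cut-cons (end N) u w κ 0ℤ c (𝟙 ∘ active N)) (lem (𝟙 (active N u)) (𝟙 (active N w)) κ _)
      where
      lem : ∀ a b k d → a * b * k + b * a * 0ℤ + d ≡ a * b * k + d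
      lem = solve-∀

    meets-add : ∀ g X → net (end add-edge) (dem add-edge +ᵈ g) X
      ≡ X u * g zero true + X w * g zero false + net (end N) (dem N +ᵈ (λ e → g (suc e))) X
    meets-add g X = trans
      (cut-≗ (end add-edge) X λ { zero true → ℤ.+-identityˡ (g zero true) ; zero false → ℤ.+-identityˡ (g zero false) ; (suc e) b → refl })
      (cut-cons (end N) u w (g zero true) (g zero false) (dem N +ᵈ (λ e → g (suc e))) X)

  -- Exchanges `L` with `U`, and thus the two ends of every window, so that only one end has to be
  -- treated.
  transpose : Network → Network
  transpose N = record
    { end = end N ; cap = λ e b → cap N e (not b) ; dem = λ e b → - 1ℤ * dem N e b ; active = active N }

  module _ (N : Network) where

    demand-transpose : ∀ A → demand (transpose N) A ≡ - demand N A
    demand-transpose A = trans (cut-scale (end N) (- 1ℤ) (dem N) (𝟙 ∘ A)) (lem (demand N A))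
      where
      lem : ∀ d → - 1ℤ * d ≡ - d
      lem = solve-∀

    L-transpose : ∀ A → L (transpose N) A ≡ U N A
    L-transpose A = trans (cong₂ _+_ (demand-transpose A) (out-reverse (end N) (cap N) (𝟙 ∘ A)))
      (ℤ.+-comm (- demand N A) (entering N A))

    U-transpose : ∀ A → U (transpose N) A ≡ L N A
    U-transpose A = trans (cong₂ _-_ (inn-reverse (end N) (cap N) (𝟙 ∘ A)) (demand-transpose A))
      (lem (leaving N A) (demand N A))
      where
      lem : ∀ o d → o - - d ≡ d + o
      lem = solve-∀

    within-transpose : ∀ {a b A} → Within a b (L N A) (U N A) → Within b a (L (transpose N) A) (U (transpose N) A)
    within-transpose {a} {b} {A} w = subst₂ (Within b a) (sym (L-transpose A)) (sym (U-transpose A)) (within-sym w)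

    transpose-valid : ∀ {v₀} → Valid N v₀ → Valid (transpose N) v₀
    transpose-valid {v₀} valid = record
      { 0≤cap    = λ e b → 0≤cap e (not b)
      ; inactive = inactive
      ; total    = - proj₁ total , trans (demand-transpose (active N)) (trans (cong -_ (proj₂ total)) (ℤ.neg-distribʳ-* q (proj₁ total)))
      ; root     = subst₂ Root
          (sym (inn-reverse (end N) (cap N) (𝟙 ∘ active N))) (sym (out-reverse (end N) (cap N) (𝟙 ∘ active N))) (root-sym root)
      ; good     = λ { {A} (proper A⊆ x∈ x≢ z∈ z∉) ¬w → good (proper A⊆ x∈ x≢ z∈ z∉) (¬w ∘ within-transpose) }
      ; balanced = λ v₀∈ → subst₂ Balanced (sym (L-transpose ⟦ v₀ ⟧)) (sym (U-transpose ⟦ v₀ ⟧)) (balanced-sym (balanced v₀∈))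
      }
      where open Valid valid

    energy-transpose : energy (transpose N) ≡ energy N
    energy-transpose = inside-reverse (end N) (cap N) (𝟙 ∘ active N)

    fringe-transpose : fringe (transpose N) ≡ fringe N
    fringe-transpose = trans
      (cong₂ _+_ (inn-reverse (end N) (cap N) (𝟙 ∘ active N)) (out-reverse (end N) (cap N) (𝟙 ∘ active N)))
      (ℤ.+-comm (leaving N (active N)) (entering N (active N)))

    transpose-solution : Solution (transpose N) → Solution N
    transpose-solution sol = record
      { flow  = λ e b → flow e (not b)
      ; anti  = λ e → trans (sym (ℤ.neg-involutive (flow e true))) (cong -_ (sym (anti e)))
      ; ≤cap  = λ e b → subst (λ b′ → flow e (not b) ≤ cap N e b′) (not-involutive b) (≤cap e (not b))
      ; fixed = λ e b ∉ → trans (antisym {g = flow} anti e b) (cong -_ (fixed e b ∉))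
      ; meets = λ {B} B⊆ → case meets {B} B⊆ of λ (j , eq) →
          - j , trans (cut-≗ (end N) (𝟙 ∘ B) (λ e b → trans (cong (λ r → dem N e b + r) (antisym {g = flow} anti e b)) (lem (dem N e b) (flow e b))))
            (trans (cut-scale (end N) (- 1ℤ) (dem (transpose N) +ᵈ flow) (𝟙 ∘ B)) (trans (cong (- 1ℤ *_) eq) (lem′ q j)))
      }
      where
      open Solution sol
      lem : ∀ d f → d + - f ≡ - 1ℤ * (- 1ℤ * d + f)
      lem = solve-∀
      lem′ : ∀ q j → - 1ℤ * (q * j) ≡ q * - j
      lem′ = solve-∀

  -- Minimal counterexamples

  module Minimal (c : ℕ) (ε : ℤ)
    (IH₁ : ∀ N v₀ → Valid N v₀ → card (active N) ℕ.< c → ¬ ¬ Solution N)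
    (IH₂ : ∀ N v₀ → Valid N v₀ → card (active N) ≡ c → energy N < ε → ¬ ¬ Solution N)
    where

    -- The fringe is left free, because `Flip` has to yield a counterexample again although it may
    -- enlarge the fringe.
    record Counterexample (N : Network) (v₀ : Fin (suc n)) : Set where
      field
        valid      : Valid N v₀
        card≡      : card (active N) ≡ c
        energy≡    : energy N ≡ ε
        unsolvable : ¬ Solution N
      open Valid valid public

    module _ {N : Network} {v₀} (ce : Counterexample N v₀) where
      open Counterexample ce

      -- Identifying two vertices of `A` is enough to apply the first induction hypothesis, and the
      -- resulting flow meets the demand of `A`, which contains both. If `A` were not in the
      -- interior of its window, the capacities left at its boundary would satisfy `Root`, so the
      -- problem inside `A` would be solvable as well.
      strict : ∀ {A} (A-proper : Proper N v₀ A) {y} → A y ≡ true → y ≢ Proper.x A-proper →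
        ¬ ¬ Within q q (L N A) (U N A)
      strict {A} A-proper@(proper sub {x} x∈ x≢v₀ {z} z∈ z∉) {y} y∈ y≢x ¬strict =
        good A-proper λ w →
        IH₁ N₁ v₀ N₁-valid (subst (card (active N₁) ℕ.<_) card≡ card₁) λ s₁ →
        IH₁ (N₂ s₁) v₀ (N₂-valid w s₁) (subst (card A ℕ.<_) card≡ (card-strict sub z z∈ z∉)) λ s₂ →
        unsolvable (combine s₁ s₂)
        where
        open Solution
        N₁ = contract N x y
        N₁-valid = contract-valid N valid (sub x x∈) (sub y y∈) (≢-sym y≢x) x≢v₀
        card₁ = card-contract N valid (sub x x∈) (sub y y∈) (≢-sym y≢x) x≢v₀
        meets₁ : (s₁ : Solution N₁) → ∀ {B} → B ⊆ active N → B x ≡ B y →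
          ∃[ j ] net (end N) (dem N +ᵈ flow s₁) (𝟙 ∘ B) ≡ q * j
        meets₁ s₁ = contract-meets N valid (sub x x∈) (sub y y∈) (≢-sym y≢x) x≢v₀ (meets s₁)
        N₂ : Solution N₁ → Network
        N₂ s₁ = restrict (shift N (flow s₁)) A
        N₂-valid : Within p p (L N A) (U N A) → (s₁ : Solution N₁) → Valid (N₂ s₁) v₀
        N₂-valid w s₁ = restrict-shift-valid N valid (anti s₁) (≤cap s₁) A-proper
          (meets₁ s₁ sub (trans x∈ (sym y∈))) w ¬strict
        combine : (s₁ : Solution N₁) → Solution (N₂ s₁) → Solution N
        combine s₁ s₂ = record
          { flow  = g₁ +ᵈ g₂
          ; anti  = λ e → trans (cong₂ _+_ (anti s₁ e) (anti s₂ e)) (sym (ℤ.neg-distrib-+ (g₁ e true) (g₂ e true)))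
          ; ≤cap  = λ e b → by-gap (gap (≤cap s₂ e b)) (lem (cap N e b) (g₁ e b) (g₂ e b))
          ; fixed = λ e b ∉ → cong₂ _+_
              (contract-fixed N valid (sub x x∈) (sub y y∈) (≢-sym y≢x) x≢v₀ (fixed s₁) e b ∉)
              (fixed s₂ e b (outside (end N e b) ∉))
          ; meets = both
          }
          where
          g₁ = flow s₁
          g₂ = flow s₂
          lem : ∀ c g f → c - g - f ≡ c - (g + f)
          lem = solve-∀
          outside : ∀ l → active N l ≡ false → A l ≡ false
          outside l ∉ with A l in eq
          ... | false = refl
          ... | true  = ⊥-elim (true≢false (sub l eq) ∉)
          both : ∀ {B} → B ⊆ active N → ∃[ j ] net (end N) (dem N +ᵈ (g₁ +ᵈ g₂)) (𝟙 ∘ B) ≡ q * j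
          -- The part of `B` inside `A` is settled by `s₂`. The part outside contains neither `x`
          -- nor `y`, so `s₁` settles it, and `s₂` vanishes on all darts starting there.
          both {B} B⊆ = case₂ (meets s₂ {B₁} B₁⊆A) (meets₁ s₁ {B₂} (λ l → B⊆ l ∘ ∖⊆ B A l) (trans (drop x x∈) (sym (drop y y∈))))
            where
            B₁ B₂ : Fin (suc n) → Bool
            B₁ l = B l ∧ A l
            B₂ = B ∖ A
            B₁⊆A : B₁ ⊆ A
            B₁⊆A l h with B l | A l
            ... | true | true = refl
            drop : ∀ l → A l ≡ true → B₂ l ≡ false
            drop l l∈ rewrite l∈ with B l
            ... | true  = refl
            ... | false = refl
            split : ∀ l → 𝟙 (B l) ≡ 𝟙 (B₁ l) + 𝟙 (B₂ l)
            split l with B l | A l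
            ... | true  | true  = refl
            ... | true  | false = refl
            ... | false | _     = refl
            g₂≡0 : ∀ e b → 𝟙 (B₂ (end N e b)) ≡ 0ℤ ⊎ g₂ e b ≡ 0ℤ
            g₂≡0 e b with B₂ (end N e b) in eq
            ... | false = inj₁ refl
            ... | true  = inj₂ (fixed s₂ e b (∉∖ B A (end N e b) eq))
            d₁ d₂ : Darts ℤ (size N)
            d₁ = dem N +ᵈ g₁
            d₂ = d₁ +ᵈ g₂
            case₂ : ∃[ j ] net (end N) d₂ (𝟙 ∘ B₁) ≡ q * j → ∃[ j ] net (end N) d₁ (𝟙 ∘ B₂) ≡ q * j →
              ∃[ j ] net (end N) (dem N +ᵈ (g₁ +ᵈ g₂)) (𝟙 ∘ B) ≡ q * j
            case₂ (j , eq) (j′ , eq′) = j + j′ , (begin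
              net (end N) (dem N +ᵈ (g₁ +ᵈ g₂)) (𝟙 ∘ B)
                ≡⟨ cut-≗ (end N) (𝟙 ∘ B) (λ e b → sym (ℤ.+-assoc (dem N e b) (g₁ e b) (g₂ e b))) ⟩
              net (end N) d₂ (𝟙 ∘ B)
                ≡⟨ cut-cong (end N) d₂ split ⟩
              net (end N) d₂ ((𝟙 ∘ B₁) +ˣ (𝟙 ∘ B₂))
                ≡⟨ net-+ˣ (end N) d₂ (𝟙 ∘ B₁) (𝟙 ∘ B₂) ⟩
              net (end N) d₂ (𝟙 ∘ B₁) + net (end N) d₂ (𝟙 ∘ B₂)
                ≡⟨ cong₂ _+_ eq (trans (cut-+ (end N) d₁ g₂ (𝟙 ∘ B₂)) (cong₂ _+_ eq′ (cut-zero (end N) (𝟙 ∘ B₂) g₂≡0))) ⟩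
              q * j + (q * j′ + 0ℤ)
                ≡⟨ lem′ q j j′ ⟩
              q * (j + j′) ∎)
              where
              open ≡-Reasoning
              lem′ : ∀ q j j′ → q * j + (q * j′ + 0ℤ) ≡ q * (j + j′)
              lem′ = solve-∀

      -- All other sets containing x are in the interior of their windows.
      around : ∀ {a b A} → a ≤ q → b ≤ q → Proper N v₀ A → ∀ x → A x ≡ true → x ≢ v₀ →
        Within a b (L N ⟦ x ⟧) (U N ⟦ x ⟧) → ¬ ¬ Within a b (L N A) (U N A)
      around {A = A} a≤q b≤q (proper sub _ _ z∈ z∉) x x∈ x≢v₀ w ¬w with another A x x∈
      ... | inj₁ same = ¬w (LU-cong N same w)
      ... | inj₂ (y , y∈ , y≢x) =
        strict (proper sub x∈ x≢v₀ z∈ z∉) y∈ y≢x (¬w ∘ within-weaken a≤q b≤q)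

      unit-≤cap : ∀ i β → 1ℤ ≤ cap N i β → ∀ e b → unit i β e b ≤ cap N e b
      unit-≤cap i β 1≤cap e b =
        by-gap (gap (δ≤ 0≤cap i β 1≤cap e b) ⊕ 0≤δ i (not β) e b) (lem (cap N e b) (δ i β e b) (δ i (not β) e b))
        where
        lem : ∀ c d d′ → c - d + d′ ≡ c - (d - d′)
        lem = solve-∀

      unit-fixed : ∀ i β → active N (end N i β) ≡ true → active N (end N i (not β)) ≡ true →
        ∀ e b → active N (end N e b) ≡ false → unit i β e b ≡ 0ℤ
      unit-fixed i β s∈ t∈ e b ∉ = cong₂ _-_
        (δ-≢ i β e b λ { refl refl → true≢false s∈ ∉ })
        (δ-≢ i (not β) e b λ { refl refl → true≢false t∈ ∉ })

      shift-counterexample : ∀ {g} → Antisymmetric g → (∀ e b → g e b ≤ cap N e b) →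
        (∀ e b → active N (end N e b) ≡ false → g e b ≡ 0ℤ) → Counterexample (shift N g) v₀
      shift-counterexample anti ≤cap fixed = record
        { valid      = shift-valid N valid anti ≤cap fixed
        ; card≡      = card≡
        ; energy≡    = trans (energy-shift N valid anti ≤cap fixed) energy≡
        ; unsolvable = unsolvable ∘ shift-solution N valid anti ≤cap fixed
        }

    active-≢zero : ∀ {N v₀} → Valid N v₀ → ∀ {x} → active N x ≡ true → x ≢ zero
    active-≢zero valid x∈ refl = true≢false x∈ (Valid.inactive valid)

    -- Every set that the dart leaves contains `x`, and every set that it enters contains `y`;
    -- `around` turns the spare units of these two vertices into spare units of all such sets.
    no-dart : ∀ {N} → Counterexample N zero → ∀ i β {x y} → end N i β ≡ x → end N i (not β) ≡ y →
      1ℤ ≤ cap N i β → active N x ≡ true → active N y ≡ true →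
      Within q p (L N ⟦ x ⟧) (U N ⟦ x ⟧) → Within p q (L N ⟦ y ⟧) (U N ⟦ y ⟧) → ⊥
    no-dart {N} ce i β refl refl 1≤cap x∈ y∈ wx wy =
      IH₂ (delete N i β) zero
        (delete-valid N i β valid 1≤cap inactive
          (λ P x∈A _ → around ce ℤ.≤-refl p≤q P _ x∈A (active-≢zero valid x∈) wx)
          (λ P _ y∈A → around ce p≤q ℤ.≤-refl P _ y∈A (active-≢zero valid y∈) wy))
        card≡ less (unsolvable ∘ delete-solution N i β)
      where
      open Counterexample ce
      less : energy (delete N i β) < ε
      less = ℤ.suc[i]≤j⇒i<j (by-gap (+≤+ {n = 0} z≤n) (trans (lem (energy N) ε energy≡) (cong (λ r → ε - (1ℤ + r)) (sym eq))))
        where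
        eq : energy (delete N i β) ≡ energy N - 1ℤ
        eq = trans (energy-delete N i β) (cong₂ (λ a b → energy N - 𝟙 a * 𝟙 b) x∈ y∈)
        lem : ∀ a b → a ≡ b → 0ℤ ≡ b - (1ℤ + (a - 1ℤ))
        lem a _ refl = lem′ a
          where
          lem′ : ∀ a → 0ℤ ≡ a - (1ℤ + (a - 1ℤ))
          lem′ = solve-∀

    reversed : ∀ {N v₀} → Counterexample N v₀ → ∀ i β → 1ℤ ≤ cap N i (not β) - unit i β i (not β)
    reversed {N} ce i β = by-gap (0≤cap i (not β)) (trans (lem (cap N i (not β)))
      (cong (λ r → cap N i (not β) - r - 1ℤ) (sym (cong₂ _-_ (δ-≢ i β i (not β) (λ _ → b≢not-b β)) (δ-refl i (not β))))))
      where
      open Counterexample ce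
      lem : ∀ c → c ≡ c - (0ℤ - 1ℤ) - 1ℤ
      lem = solve-∀
      b≢not-b : ∀ b → b ≡ not b → ⊥
      b≢not-b true ()
      b≢not-b false ()

    kept : ∀ {N v₀} → Counterexample N v₀ → ∀ i β k γ → (k ≡ i → γ ≡ β → ⊥) → 1ℤ ≤ cap N i β → 1ℤ ≤ cap N i β - unit k γ i β
    kept {N} ce i β k γ ne 1≤cap = by-gap (gap 1≤cap ⊕ 0≤δ k (not γ) i β)
      (trans (lem (cap N i β) (δ k (not γ) i β)) (cong (λ r → cap N i β - (r - δ k (not γ) i β) - 1ℤ) (sym (δ-≢ k γ i β ne))))
      where
      lem : ∀ c d → c - 1ℤ + d ≡ c - (0ℤ - d) - 1ℤ
      lem = solve-∀

    -- The dart points the wrong way for a deletion; reversing it first does not affect any window.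
    no-dart′ : ∀ {N} → Counterexample N zero → ∀ i β {x y} → end N i β ≡ x → end N i (not β) ≡ y →
      1ℤ ≤ cap N i β → active N x ≡ true → active N y ≡ true →
      Within p q (L N ⟦ x ⟧) (U N ⟦ x ⟧) → Within q p (L N ⟦ y ⟧) (U N ⟦ y ⟧) → ⊥
    no-dart′ {N} ce i β refl refl 1≤cap x∈ y∈ wx wy =
      no-dart (shift-counterexample ce anti ≤cap (unit-fixed ce i β x∈ y∈)) i (not β)
        refl (cong (end N i) (not-involutive β)) (reversed ce i β) y∈ x∈
        (within-shift N valid anti ≤cap wy) (within-shift N valid anti ≤cap wx)
      where
      open Counterexample ce
      anti = unit-anti i β
      ≤cap = unit-≤cap ce i β 1≤cap

    -- Splitting off a pair of edges at the exempt vertex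

    module Lift {N : Network} {v₀ : Fin (suc n)} (ce : Counterexample N v₀) (v₀∈ : active N v₀ ≡ true)
      {u w : Fin (suc n)} (u≢w : u ≢ w) (u≢v₀ : u ≢ v₀) (w≢v₀ : w ≢ v₀)
      (u∈⊎w∈ : active N u ≡ true ⊎ active N w ≡ true)
      (i : Fin (size N)) (β : Bool) (eᵢ : end N i β ≡ u) (eᵢ′ : end N i (not β) ≡ v₀) (1≤capᵢ : 1ℤ ≤ cap N i β)
      (k : Fin (size N)) (γ : Bool) (eₖ : end N k γ ≡ v₀) (eₖ′ : end N k (not γ) ≡ w) (1≤capₖ : 1ℤ ≤ cap N k γ)
      where
      open Counterexample ce

      c′ : Darts ℤ (size N)
      c′ = (cap N -ᵈ δ i β) -ᵈ δ k γ

      N′ : Network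
      N′ = add-edge N u w 1ℤ c′

      0≤c′ : ∀ e b → 0ℤ ≤ c′ e b
      0≤c′ e b with δ-cases i β e b
      ... | inj₁ eq = subst (λ r → 0ℤ ≤ cap N e b - r - δ k γ e b) (sym eq)
        (subst (λ r → 0ℤ ≤ r - δ k γ e b) (sym (ℤ.+-identityʳ (cap N e b))) (gap (δ≤ 0≤cap k γ 1≤capₖ e b)))
      ... | inj₂ (refl , refl , _) = subst (λ r → 0ℤ ≤ cap N e b - δ i β e b - r) (sym (δ-≢ k γ i β λ { refl refl → u≢v₀ (trans (sym eᵢ) eₖ) }))
        (subst (0ℤ ≤_) (sym (ℤ.+-identityʳ _)) (gap (δ≤ 0≤cap i β 1≤capᵢ e b)))

      -- Replacing the path from `u` through `v₀` to `w` by an edge costs a unit of both `L` and `U`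
      -- if the set separates `v₀` from both neighbours, and nothing otherwise.
      loss : (A : Fin (suc n) → Bool) → ℤ
      loss A = 𝟙 (A v₀) * (1ℤ - 𝟙 (A u)) * (1ℤ - 𝟙 (A w)) + (1ℤ - 𝟙 (A v₀)) * 𝟙 (A u) * 𝟙 (A w)

      cut-lift : ∀ {ϖ} X → cut ϖ (end N′) (cap N′) X
        ≡ cut ϖ (end N) (cap N) X - (ϖ (X u) (X v₀) + ϖ (X v₀) (X w) - ϖ (X u) (X w))
      cut-lift {ϖ} X = trans (cut-cons (end N) u w 1ℤ 0ℤ c′ X) (trans
        (cong (λ r → ϖ (X u) (X w) * 1ℤ + ϖ (X w) (X u) * 0ℤ + r) (trans (cut-- (end N) (cap N -ᵈ δ i β) (δ k γ) X) (cong₂ _-_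
          (trans (cut-- (end N) (cap N) (δ i β) X) (cong (λ r → cut ϖ (end N) (cap N) X - r) (trans (cut-δ (end N) i β X) (cong₂ (λ s t → ϖ (X s) (X t)) eᵢ eᵢ′))))
          (trans (cut-δ (end N) k γ X) (cong₂ (λ s t → ϖ (X s) (X t)) eₖ eₖ′)))))
        (lem (ϖ (X u) (X w)) (ϖ (X w) (X u)) (cut ϖ (end N) (cap N) X) (ϖ (X u) (X v₀)) (ϖ (X v₀) (X w))))
        where
        lem : ∀ a b o c d → a * 1ℤ + b * 0ℤ + (o - c - d) ≡ o - (c + d - a)
        lem = solve-∀

      leaving-lift : ∀ A → leaving N′ A ≡ leaving N A - loss A
      leaving-lift A = trans (cut-lift (𝟙 ∘ A)) (cong (λ r → leaving N A - r) (bits (A u) (A v₀) (A w)))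
        where
        bits : ∀ u v w → 𝟙 u * (1ℤ - 𝟙 v) + 𝟙 v * (1ℤ - 𝟙 w) - 𝟙 u * (1ℤ - 𝟙 w)
          ≡ 𝟙 v * (1ℤ - 𝟙 u) * (1ℤ - 𝟙 w) + (1ℤ - 𝟙 v) * 𝟙 u * 𝟙 w
        bits true  true  true  = refl
        bits true  true  false = refl
        bits true  false true  = refl
        bits true  false false = refl
        bits false true  true  = refl
        bits false true  false = refl
        bits false false true  = refl
        bits false false false = refl

      entering-lift : ∀ A → entering N′ A ≡ entering N A - loss A
      entering-lift A = trans (cut-lift (𝟙 ∘ A)) (cong (λ r → entering N A - r) (bits (A u) (A v₀) (A w)))
        where
        bits : ∀ u v w → (1ℤ - 𝟙 u) * 𝟙 v + (1ℤ - 𝟙 v) * 𝟙 w - (1ℤ - 𝟙 u) * 𝟙 w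
          ≡ 𝟙 v * (1ℤ - 𝟙 u) * (1ℤ - 𝟙 w) + (1ℤ - 𝟙 v) * 𝟙 u * 𝟙 w
        bits true  true  true  = refl
        bits true  true  false = refl
        bits true  false true  = refl
        bits true  false false = refl
        bits false true  true  = refl
        bits false true  false = refl
        bits false false true  = refl
        bits false false false = refl

      L-lift : ∀ A → L N′ A ≡ L N A - loss A
      L-lift A = trans (cong₂ _+_ (demand-add N u w 1ℤ c′ A) (leaving-lift A)) (sym (ℤ.+-assoc (demand N A) (leaving N A) _))

      U-lift : ∀ A → U N′ A ≡ U N A - loss A
      U-lift A = trans (cong₂ _-_ (entering-lift A) (demand-add N u w 1ℤ c′ A)) (lem (entering N A) (demand N A) (loss A))
        where
        lem : ∀ i d x → i - x - d ≡ i - d - x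
        lem = solve-∀

      loss-active : loss (active N) ≡ 0ℤ
      loss-active rewrite v₀∈ = lem u∈⊎w∈
        where
        lem : active N u ≡ true ⊎ active N w ≡ true →
          1ℤ * (1ℤ - 𝟙 (active N u)) * (1ℤ - 𝟙 (active N w)) + (1ℤ - 1ℤ) * 𝟙 (active N u) * 𝟙 (active N w) ≡ 0ℤ
        lem (inj₁ eq) rewrite eq = refl
        lem (inj₂ eq) rewrite eq with active N u
        ... | true  = refl
        ... | false = refl

      -- One active neighbour suffices: if the other one is inactive, the new edge belongs to the
      -- fringe, and the edge to the active neighbour is lost from the inside.
      energy-lift : energy N′ ≡ energy N - 1ℤ
      energy-lift = trans (cut-lift (𝟙 ∘ active N)) (cong (λ r → energy N - r) (trans
        (cong (λ v → 𝟙 (active N u) * 𝟙 v + 𝟙 v * 𝟙 (active N w) - 𝟙 (active N u) * 𝟙 (active N w)) v₀∈)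
        (bits (active N u) (active N w) u∈⊎w∈)))
        where
        bits : ∀ a b → a ≡ true ⊎ b ≡ true → 𝟙 a * 1ℤ + 1ℤ * 𝟙 b - 𝟙 a * 𝟙 b ≡ 1ℤ
        bits true  true  _ = refl
        bits true  false _ = refl
        bits false true  _ = refl
        bits false false (inj₁ ())
        bits false false (inj₂ ())

      minus-0 : ∀ {a x} → x ≡ 0ℤ → a ≡ a - x
      minus-0 {a} refl = sym (ℤ.+-identityʳ a)

      -- Except for `v₀` alone, the sets with a loss contain `v₀` and another vertex, or both `u`
      -- and `w`, so `strict` supplies the unit at both ends. The vertex `v₀` stays balanced, since
      -- its `L` and `U` drop equally.
      lift-valid : Valid N′ v₀
      lift-valid = record
        { 0≤cap    = λ { zero true → +≤+ z≤n ; zero false → +≤+ z≤n ; (suc e) b → 0≤c′ e b }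
        ; inactive = inactive
        ; total    = proj₁ total , trans (demand-add N u w 1ℤ c′ (active N)) (proj₂ total)
        ; root     = subst₂ Root
            (trans (minus-0 loss-active) (sym (entering-lift (active N))))
            (trans (minus-0 loss-active) (sym (leaving-lift (active N)))) root
        ; good     = λ { {A} (proper A⊆ x∈ x≢ z∈ z∉) ¬w →
            window (proper A⊆ x∈ x≢ z∈ z∉) (A v₀) (A u) (A w) refl refl refl
              (¬w ∘ subst₂ (Within p p) (sym (L-lift A)) (sym (U-lift A))) }
        ; balanced = λ _ → subst₂ Balanced (sym (L-lift ⟦ v₀ ⟧)) (sym (U-lift ⟦ v₀ ⟧)) (balanced-minus (balanced v₀∈))
        }
        where
        balanced-minus : ∀ {l u x} → Balanced l u → Balanced (l - x) (u - x)
        balanced-minus {l} {u} {x} bal = case balanced-at bal of λ (j , eq) → at-balanced j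
          (trans (lem l x (q * j)) (trans (cong (_- x) eq) (lem′ u x (q * j))))
          where
          lem : ∀ l x y → l - x - y ≡ l - y - x
          lem = solve-∀
          lem′ : ∀ u x y → u + y - x ≡ u - x + y
          lem′ = solve-∀
        unchanged : ∀ {A} → Proper N v₀ A → ¬ ¬ Within p p (L N A - 0ℤ) (U N A - 0ℤ)
        unchanged {A} A-proper ¬w = good A-proper
          (¬w ∘ subst₂ (Within p p) (sym (ℤ.+-identityʳ (L N A))) (sym (ℤ.+-identityʳ (U N A))))
        window : ∀ {A} → Proper N v₀ A → ∀ b₀ b₁ b₂ → A v₀ ≡ b₀ → A u ≡ b₁ → A w ≡ b₂ →
          let x = 𝟙 b₀ * (1ℤ - 𝟙 b₁) * (1ℤ - 𝟙 b₂) + (1ℤ - 𝟙 b₀) * 𝟙 b₁ * 𝟙 b₂ in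
          ¬ ¬ Within p p (L N A - x) (U N A - x)
        window P true  true  true  _ _ _ = unchanged P
        window P true  true  false _ _ _ = unchanged P
        window P true  false true  _ _ _ = unchanged P
        window P true  false false eq _ _ ¬w = strict ce P eq (≢-sym (Proper.x≢ P)) λ w →
          ¬w (within-dropᵤ (within-dropₗ w))
        window (proper sub _ _ z∈ z∉) false true true eq eq′ eq″ ¬w =
          strict ce (proper sub eq′ u≢v₀ z∈ z∉) eq″ (≢-sym u≢w) λ w →
          ¬w (within-dropᵤ (within-dropₗ w))
        window P false true  false _ _ _ = unchanged P
        window P false false true  _ _ _ = unchanged P
        window P false false false _ _ _ = unchanged P

      -- A reversal of the new edge is carried out on the path through `v₀`. If `u` or `w` is
      -- inactive, the new edge is not reversed at all, so the darts at inactive vertices remain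
      -- fixed.
      lift-solution : Solution N′ → Solution N
      lift-solution sol = record
        { flow = f ; anti = f-anti ; ≤cap = f-≤ ; fixed = f-fixed ; meets = f-meets }
        where
        open Solution sol
        t : ℤ
        t = flow zero true
        g path f : Darts ℤ (size N)
        g e b = flow (suc e) b
        path = unit i β +ᵈ unit k γ
        f e b = g e b + t * path e b
        t≤1 : t ≤ 1ℤ
        t≤1 = ≤cap zero true
        0≤t : 0ℤ ≤ t
        0≤t = by-gap (gap (subst (_≤ 0ℤ) (anti zero) (≤cap zero false))) (lem t)
          where
          lem : ∀ t → 0ℤ - (- t) ≡ t - 0ℤ
          lem = solve-∀
        path-anti : Antisymmetric path
        path-anti e = trans (cong₂ _+_ (unit-anti i β e) (unit-anti k γ e)) (sym (ℤ.neg-distrib-+ (unit i β e true) _))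
        f-anti : Antisymmetric f
        f-anti e = trans (cong₂ (λ a b → a + t * b) (anti (suc e)) (path-anti e)) (lem (g e true) t (path e true))
          where
          lem : ∀ a t b → - a + t * - b ≡ - (a + t * b)
          lem = solve-∀
        f-≤ : ∀ e b → f e b ≤ cap N e b
        f-≤ e b = by-gap
          (gap (≤cap (suc e) b)
            ⊕ 0≤*0≤ (gap t≤1) (0≤δ i β e b ⊕ 0≤δ k γ e b)
            ⊕ 0≤*0≤ 0≤t (0≤δ i (not β) e b ⊕ 0≤δ k (not γ) e b))
          (lem (cap N e b) (g e b) t (δ i β e b) (δ k γ e b) (δ i (not β) e b) (δ k (not γ) e b))
          where
          lem : ∀ c g t a b a′ b′ → (c - a - b - g) + (1ℤ - t) * (a + b) + t * (a′ + b′) ≡ c - (g + t * (a - a′ + (b - b′)))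
          lem = solve-∀
        t≡0 : active N u ≡ false ⊎ active N w ≡ false → t ≡ 0ℤ
        t≡0 (inj₁ ∉) = fixed zero true ∉
        t≡0 (inj₂ ∉) = trans (sym (ℤ.neg-involutive t)) (cong -_ (trans (sym (anti zero)) (fixed zero false ∉)))
        f-fixed : ∀ e b → active N (end N e b) ≡ false → f e b ≡ 0ℤ
        f-fixed e b ∉ = trans (cong₂ _+_ (fixed (suc e) b ∉) (cases (active N u) (active N w) refl refl)) refl
          where
          cases : ∀ a a′ → active N u ≡ a → active N w ≡ a′ → t * path e b ≡ 0ℤ
          cases false _ eq _ = trans (cong (_* path e b) (t≡0 (inj₁ eq))) (ℤ.*-zeroˡ (path e b))
          cases true false _ eq = trans (cong (_* path e b) (t≡0 (inj₂ eq))) (ℤ.*-zeroˡ (path e b))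
          cases true true eq eq′ = trans (cong (t *_) (cong₂ _+_
            (unit-fixed ce i β (trans (cong (active N) eᵢ) eq) (trans (cong (active N) eᵢ′) v₀∈) e b ∉)
            (unit-fixed ce k γ (trans (cong (active N) eₖ) v₀∈) (trans (cong (active N) eₖ′) eq′) e b ∉)))
            (ℤ.*-zeroʳ t)
        f-meets : ∀ {B} → B ⊆ active N → ∃[ j ] net (end N) (dem N +ᵈ f) (𝟙 ∘ B) ≡ q * j
        f-meets {B} B⊆ = case meets {B} B⊆ of λ (j , eq) → j , trans same eq
          where
          X = 𝟙 ∘ B
          open ≡-Reasoning
          path-net : net (end N) path X ≡ X u - X w
          path-net = trans (cut-+ (end N) (unit i β) (unit k γ) X) (trans
            (cong₂ _+_ (trans (net-unit (end N) i β X) (cong₂ (λ s t → X s - X t) eᵢ eᵢ′))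
                       (trans (net-unit (end N) k γ X) (cong₂ (λ s t → X s - X t) eₖ eₖ′)))
            (lem (X u) (X v₀) (X w)))
            where
            lem : ∀ a b c → a - b + (b - c) ≡ a - c
            lem = solve-∀
          same : net (end N) (dem N +ᵈ f) X ≡ net (end N′) (dem N′ +ᵈ flow) X
          same = begin
            net (end N) (dem N +ᵈ f) X
              ≡⟨ cut-≗ (end N) X (λ e b → sym (ℤ.+-assoc (dem N e b) (g e b) _)) ⟩
            net (end N) ((dem N +ᵈ g) +ᵈ (λ e b → t * path e b)) X
              ≡⟨ cut-+ (end N) (dem N +ᵈ g) (λ e b → t * path e b) X ⟩
            net (end N) (dem N +ᵈ g) X + net (end N) (λ e b → t * path e b) X
              ≡⟨ cong (λ r → net (end N) (dem N +ᵈ g) X + r) (trans (cut-scale (end N) t path X) (cong (t *_) path-net)) ⟩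
            net (end N) (dem N +ᵈ g) X + t * (X u - X w)
              ≡⟨ lem (net (end N) (dem N +ᵈ g) X) t (X u) (X w) ⟩
            X u * t + X w * - t + net (end N) (dem N +ᵈ g) X
              ≡⟨ cong (λ r → X u * t + X w * r + net (end N) (dem N +ᵈ g) X) (sym (anti zero)) ⟩
            X u * t + X w * flow zero false + net (end N) (dem N +ᵈ g) X
              ≡⟨ sym (meets-add N u w 1ℤ c′ flow X) ⟩
            net (end N′) (dem N′ +ᵈ flow) X ∎
            where
            lem : ∀ d t a b → d + t * (a - b) ≡ a * t + b * - t + d
            lem = solve-∀

      lift : ⊥
      lift = IH₂ N′ v₀ lift-valid card≡
        (ℤ.suc[i]≤j⇒i<j (ℤ.≤-reflexive (trans (cong (λ r → 1ℤ + r) energy-lift) (trans (lem (energy N)) energy≡))))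
        (unsolvable ∘ lift-solution)
        where
        lem : ∀ x → 1ℤ + (x - 1ℤ) ≡ x
        lem = solve-∀

    -- Contracting an exempt vertex with at most one neighbour

    module DeadEnd {N : Network} {v₀ : Fin (suc n)} (ce : Counterexample N v₀) (v₀∈ : active N v₀ ≡ true)
      {w : Fin (suc n)} (w≢v₀ : w ≢ v₀) (w∈ : active N w ≡ true)
      (only : ∀ e b → end N e b ≡ v₀ → end N e (not b) ≢ v₀ → end N e (not b) ≢ w → cap N e b ≡ 0ℤ × cap N e (not b) ≡ 0ℤ)
      where
      open Counterexample ce

      private
        ends : Darts (Fin (suc n)) (size N)
        ends = end N

      -- These darts become loops when `v₀` is contracted into `w`; the flow that a solution of the
      -- contraction has on them is meaningless and gets replaced.
      along : Fin (size N) → Bool → Bool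
      along e b = (⟦ v₀ ⟧ (ends e b) ∧ ⟦ w ⟧ (ends e (not b))) ∨ (⟦ w ⟧ (ends e b) ∧ ⟦ v₀ ⟧ (ends e (not b)))

      only′ : ∀ e b → ends e b ≡ v₀ → ends e (not b) ≢ v₀ → ends e (not b) ≢ w → cap N e (not b) ≡ 0ℤ
      only′ e b h h′ h″ = proj₂ (only e b h h′ h″)

      entering-toll : entering N ⟦ v₀ ⟧ ≡ S (Route.toll ends (cap N) 0≤cap w v₀)
      entering-toll = trans inn-S (S-cong term)
        where
        opaque
          unfolding cut
          inn-S : entering N ⟦ v₀ ⟧ ≡ S (λ e b → (1ℤ - 𝟙 (⟦ v₀ ⟧ (ends e b))) * 𝟙 (⟦ v₀ ⟧ (ends e (not b))) * cap N e b)
          inn-S = refl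
        term : ∀ e b → (1ℤ - 𝟙 (⟦ v₀ ⟧ (ends e b))) * 𝟙 (⟦ v₀ ⟧ (ends e (not b))) * cap N e b
          ≡ 𝟙 (⟦ w ⟧ (ends e b)) * 𝟙 (⟦ v₀ ⟧ (ends e (not b))) * cap N e b
        term e b with v₀ ≟ ends e b | w ≟ ends e b | v₀ ≟ ends e (not b)
        ... | yes p | yes p′ | _ = ⊥-elim (w≢v₀ (trans p′ (sym p)))
        ... | yes _ | no  _  | yes _ = refl
        ... | yes _ | no  _  | no  _ = refl
        ... | no  _ | yes _  | yes _ = refl
        ... | no  _ | yes _  | no  _ = refl
        ... | no  _ | no  _  | no  _ = refl
        ... | no ne | no ne′ | yes p = trans (cong (1ℤ *_) zero-cap) (sym (ℤ.*-zeroˡ (cap N e b)))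
          where
          back : ends e (not (not b)) ≡ ends e b
          back = cong (ends e) (not-involutive b)
          zero-cap : cap N e b ≡ 0ℤ
          zero-cap = subst (λ b → cap N e b ≡ 0ℤ) (not-involutive b)
            (only′ e (not b) (sym p) (λ h → ne (sym (trans (sym back) h))) (λ h → ne′ (sym (trans (sym back) h))))

      leaving-toll : leaving N ⟦ v₀ ⟧ ≡ S (Route.toll ends (cap N) 0≤cap v₀ w)
      leaving-toll = trans out-S (S-cong term)
        where
        opaque
          unfolding cut
          out-S : leaving N ⟦ v₀ ⟧ ≡ S (λ e b → 𝟙 (⟦ v₀ ⟧ (ends e b)) * (1ℤ - 𝟙 (⟦ v₀ ⟧ (ends e (not b)))) * cap N e b)
          out-S = refl
        term : ∀ e b → 𝟙 (⟦ v₀ ⟧ (ends e b)) * (1ℤ - 𝟙 (⟦ v₀ ⟧ (ends e (not b)))) * cap N e b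
          ≡ 𝟙 (⟦ v₀ ⟧ (ends e b)) * 𝟙 (⟦ w ⟧ (ends e (not b))) * cap N e b
        term e b with v₀ ≟ ends e b | v₀ ≟ ends e (not b) | w ≟ ends e (not b)
        ... | no  _ | yes _ | yes _ = refl
        ... | no  _ | yes _ | no  _ = refl
        ... | no  _ | no  _ | yes _ = refl
        ... | no  _ | no  _ | no  _ = refl
        ... | yes _ | yes p | yes p′ = ⊥-elim (w≢v₀ (trans p′ (sym p)))
        ... | yes _ | yes _ | no  _ = refl
        ... | yes _ | no  _ | yes _ = refl
        ... | yes p | no ne | no ne′ = trans (cong (1ℤ *_) (proj₁ (only e b (sym p) (ne ∘ sym) (ne′ ∘ sym)))) (sym (ℤ.*-zeroˡ (cap N e b)))

      record Routed : Set where
        field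
          flow    : Darts ℤ (size N)
          anti    : Antisymmetric flow
          ≤cap    : ∀ e b → flow e b ≤ cap N e b
          support : ∀ e b → flow e b ≡ 0ℤ ⊎ along e b ≡ true
          t j     : ℤ
          amount  : ∀ X → net ends flow X ≡ t * (X w - X v₀)
          met     : demand N ⟦ v₀ ⟧ - t ≡ q * j

      -- Being balanced gives h = L - q j = U + q j, and 2h is the total capacity at `v₀`, hence
      -- nonnegative. Therefore t = demand - q j lies between - leaving and entering, and all this
      -- capacity belongs to edges between `v₀` and `w`.
      routed : Routed
      routed = case balanced-at (balanced v₀∈) of λ (j , eq) → from j eq
        where
        along₁ : ∀ {e b} → ends e b ≡ v₀ → ends e (not b) ≡ w → along e b ≡ true
        along₁ {e} {b} p p′ rewrite p | p′ | ∈⟦⟧ v₀ | ∈⟦⟧ w = refl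
        along₂ : ∀ {e b} → ends e b ≡ w → ends e (not b) ≡ v₀ → along e b ≡ true
        along₂ {e} {b} p p′ rewrite p | p′ | ∈⟦⟧ v₀ | ∈⟦⟧ w | ∉⟦⟧ w≢v₀ | ∉⟦⟧ (≢-sym w≢v₀) = refl
        from : ∀ j → L N ⟦ v₀ ⟧ - q * j ≡ U N ⟦ v₀ ⟧ + q * j → Routed
        from j eq = split (0ℤ ℤ.≤? t)
          where
          t h d : ℤ
          d = demand N ⟦ v₀ ⟧
          t = d - q * j
          h = L N ⟦ v₀ ⟧ - q * j
          met : d - t ≡ q * j
          met = lem d (q * j)
            where
            lem : ∀ d x → d - (d - x) ≡ x
            lem = solve-∀
          0≤h : 0ℤ ≤ h
          0≤h = case 0ℤ ℤ.≤? h of λ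
            { (yes 0≤h) → 0≤h
            ; (no ¬0≤h) → ⊥-elim (twice (≰⇒1+≤ ¬0≤h)) }
            where
            twice : 1ℤ + h ≤ 0ℤ → ⊥
            twice h≤ = absurd-gap
              (gap h≤ ⊕ gap h≤ ⊕ 0≤out ends 0≤cap ⟦ v₀ ⟧ ⊕ 0≤inn ends 0≤cap ⟦ v₀ ⟧ ⊕ gap (ℤ.≤-reflexive (sym eq)) ⊕ +≤+ {n = 1} z≤n)
              (lem d (leaving N ⟦ v₀ ⟧) (entering N ⟦ v₀ ⟧) (q * j))
              where
              lem : ∀ d o i x → 0ℤ - (1ℤ + (d + o - x)) + (0ℤ - (1ℤ + (d + o - x))) + o + i + (d + o - x - (i - d + x)) + 1ℤ ≡ -1ℤ
              lem = solve-∀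
          split : Dec (0ℤ ≤ t) → Routed
          split (yes 0≤t) = record
            { flow = flow ; anti = anti ; ≤cap = ≤cap
            ; support = λ e b → case support e b of λ
                { (inj₁ z) → inj₁ z ; (inj₂ (inj₁ (p , p′))) → inj₂ (along₂ p p′) ; (inj₂ (inj₂ (p , p′))) → inj₂ (along₁ p p′) }
            ; t = t ; j = j ; amount = amount ; met = met }
            where
            t≤ : t ≤ entering N ⟦ v₀ ⟧
            t≤ = by-gap (0≤h ⊕ gap (ℤ.≤-reflexive eq)) (lem d (leaving N ⟦ v₀ ⟧) (entering N ⟦ v₀ ⟧) (q * j))
              where
              lem : ∀ d o i x → d + o - x + (i - d + x - (d + o - x)) ≡ i - (d - x)
              lem = solve-∀
            open Route.Routing (Route.route ends (cap N) 0≤cap w v₀ t 0≤t (subst (t ≤_) entering-toll t≤))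
          split (no 0≰t) = record
            { flow = flow ; anti = anti ; ≤cap = ≤cap
            ; support = λ e b → case support e b of λ
                { (inj₁ z) → inj₁ z ; (inj₂ (inj₁ (p , p′))) → inj₂ (along₁ p p′) ; (inj₂ (inj₂ (p , p′))) → inj₂ (along₂ p p′) }
            ; t = t ; j = j
            ; amount = λ X → trans (amount X) (lem′ t (X v₀) (X w)) ; met = met }
            where
            0≤-t : 0ℤ ≤ - t
            0≤-t = by-gap (gap (≰⇒1+≤ 0≰t) ⊕ +≤+ {n = 1} z≤n) (lem t)
              where
              lem : ∀ t → 0ℤ - (1ℤ + t) + 1ℤ ≡ - t - 0ℤ
              lem = solve-∀
            -t≤ : - t ≤ leaving N ⟦ v₀ ⟧
            -t≤ = by-gap 0≤h (lem d (leaving N ⟦ v₀ ⟧) (q * j))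
              where
              lem : ∀ d o x → d + o - x ≡ o - (- (d - x))
              lem = solve-∀
            open Route.Routing (Route.route ends (cap N) 0≤cap v₀ w (- t) 0≤-t (subst (- t ≤_) leaving-toll -t≤))
            lem′ : ∀ t a b → - t * (a - b) ≡ t * (b - a)
            lem′ = solve-∀

      -- Off the edges between `v₀` and `w` the flow of the contraction is kept; on them the routed
      -- flow settles `v₀`. A set that separates `v₀` from `w` differs by `v₀` alone from one that
      -- does not.
      dead-end : ⊥
      dead-end = IH₁ N₁ v₀ (contract-valid N valid w∈ v₀∈ w≢v₀ w≢v₀)
        (subst (card (active N₁) ℕ.<_) card≡ (card-contract N valid w∈ v₀∈ w≢v₀ w≢v₀)) (unsolvable ∘ solution)
        where
        N₁ = contract N w v₀
        solution : Solution N₁ → Solution N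
        solution s₁ = record
          { flow = f ; anti = f-anti ; ≤cap = f-≤ ; fixed = f-fixed ; meets = f-meets }
          where
          open Solution s₁ renaming (flow to g; anti to g-anti; ≤cap to g-≤; fixed to g-fixed; meets to g-meets)
          open Routed routed renaming (flow to r; anti to r-anti; ≤cap to r-≤; support to r-support)
          fixed₁ : ∀ e b → active N (ends e b) ≡ false → g e b ≡ 0ℤ
          fixed₁ = contract-fixed N valid w∈ v₀∈ w≢v₀ w≢v₀ g-fixed
          κ g° f : Darts ℤ (size N)
          κ e b = if along e b then g e b else 0ℤ
          g° = g -ᵈ κ
          f = g° +ᵈ r
          along-sym : ∀ e → along e false ≡ along e true
          along-sym e = trans (∨-comm (⟦ v₀ ⟧ (ends e false) ∧ ⟦ w ⟧ (ends e true)) _)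
            (cong₂ _∨_ (∧-comm (⟦ w ⟧ (ends e false)) _) (∧-comm (⟦ v₀ ⟧ (ends e false)) _))
          κ-anti : Antisymmetric κ
          κ-anti e rewrite along-sym e with along e true
          ... | true  = g-anti e
          ... | false = refl
          g°-anti : Antisymmetric g°
          g°-anti e = trans (cong₂ _-_ (g-anti e) (κ-anti e)) (lem (g e true) (κ e true))
            where
            lem : ∀ a b → - a - - b ≡ - (a - b)
            lem = solve-∀
          f-anti : Antisymmetric f
          f-anti e = trans (cong₂ _+_ (g°-anti e) (r-anti e)) (sym (ℤ.neg-distrib-+ (g° e true) (r e true)))
          f-≤ : ∀ e b → f e b ≤ cap N e b
          f-≤ e b with along e b | r-support e b
          ... | true  | _       = subst (_≤ cap N e b) (lem (g e b) (r e b)) (r-≤ e b)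
            where
            lem : ∀ a b → b ≡ a - a + b
            lem = solve-∀
          ... | false | inj₁ eq = subst (_≤ cap N e b) (trans (lem (g e b)) (cong (λ x → g e b - 0ℤ + x) (sym eq))) (g-≤ e b)
            where
            lem : ∀ a → a ≡ a - 0ℤ + 0ℤ
            lem = solve-∀
          ... | false | inj₂ ()
          along-ends : ∀ e b → along e b ≡ true →
            (ends e b ≡ v₀ × ends e (not b) ≡ w) ⊎ (ends e b ≡ w × ends e (not b) ≡ v₀)
          along-ends e b with v₀ ≟ ends e b | w ≟ ends e (not b) | w ≟ ends e b | v₀ ≟ ends e (not b)
          ... | yes p | yes p′ | _ | _ = λ _ → inj₁ (sym p , sym p′)
          ... | _ | _ | yes p | yes p′ = λ _ → inj₂ (sym p , sym p′)
          ... | yes _ | no _ | yes _ | no _  = λ ()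
          ... | yes _ | no _ | no _ | _      = λ ()
          ... | no _ | _ | yes _ | no _ = λ ()
          ... | no _ | _ | no _ | _ = λ ()
          f-fixed : ∀ e b → active N (ends e b) ≡ false → f e b ≡ 0ℤ
          f-fixed e b ∉ with along e b in eq | r-support e b
          ... | true | _ = case along-ends e b eq of λ
              { (inj₁ (p , _)) → ⊥-elim (true≢false (trans (cong (active N) p) v₀∈) ∉)
              ; (inj₂ (p , _)) → ⊥-elim (true≢false (trans (cong (active N) p) w∈) ∉) }
          ... | false | inj₁ eq′ = cong₂ (λ a b → a - 0ℤ + b) (fixed₁ e b ∉) eq′
          ... | false | inj₂ ()
          D : Darts ℤ (size N)
          D = dem N +ᵈ f
          net-D : ∀ X → net ends D X ≡ net ends (dem N) X + net ends g° X + t * (X w - X v₀)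
          net-D X = trans (cut-+ ends (dem N) f X)
            (trans (cong (λ x → net ends (dem N) X + x) (trans (cut-+ ends g° r X) (cong (λ x → net ends g° X + x) (amount X))))
                   (sym (ℤ.+-assoc (net ends (dem N) X) (net ends g° X) _)))
          saturated : ∀ {B} → B ⊆ active N → B w ≡ B v₀ → ∃[ j ] net ends D (𝟙 ∘ B) ≡ q * j
          saturated {B} B⊆ eq = case contract-meets N valid w∈ v₀∈ w≢v₀ w≢v₀ g-meets {B} B⊆ eq of λ (j , met) →
            j , trans (net-D (𝟙 ∘ B)) (trans (cong₂ (λ a b → net ends (dem N) (𝟙 ∘ B) + a + t * (𝟙 b - 𝟙 (B v₀)))
                  (trans (cut-- ends g κ (𝟙 ∘ B)) (cong (λ x → net ends g (𝟙 ∘ B) - x) κ-zero)) eq)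
                (trans (lem (net ends (dem N) (𝟙 ∘ B)) (net ends g (𝟙 ∘ B)) t (𝟙 (B v₀)))
                       (trans (sym (cut-+ ends (dem N) g (𝟙 ∘ B))) met)))
            where
            lem : ∀ d g t x → d + (g - 0ℤ) + t * (x - x) ≡ d + g
            lem = solve-∀
            κ-zero : net ends κ (𝟙 ∘ B) ≡ 0ℤ
            κ-zero = trans (net-antisym ends κ-anti (𝟙 ∘ B)) (out-zero ends B zero-term)
              where
              zero-term : ∀ e b → B (ends e b) ≡ true → B (ends e (not b)) ≡ false → κ e b ≡ 0ℤ
              zero-term e b h h′ with along e b in eq′
              ... | false = refl
              ... | true = case along-ends e b eq′ of λ
                { (inj₁ (p , p′)) → ⊥-elim (true≢false (trans (sym (cong B p)) h) (trans (sym eq) (trans (sym (cong B p′)) h′)))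
                ; (inj₂ (p , p′)) → ⊥-elim (true≢false (trans (sym eq) (trans (sym (cong B p)) h)) (trans (sym (cong B p′)) h′)) }
          at-v₀ : net ends D (𝟙 ∘ ⟦ v₀ ⟧) ≡ q * j
          at-v₀ = trans (net-D (𝟙 ∘ ⟦ v₀ ⟧)) (trans
            (cong₂ (λ a b → demand N ⟦ v₀ ⟧ + a + t * b) g°-zero (cong₂ (λ a b → 𝟙 a - 𝟙 b) (∉⟦⟧ (≢-sym w≢v₀)) (∈⟦⟧ v₀)))
            (trans (lem (demand N ⟦ v₀ ⟧) t) met))
            where
            lem : ∀ d t → d + 0ℤ + t * -1ℤ ≡ d - t
            lem = solve-∀
            g°-zero : net ends g° (𝟙 ∘ ⟦ v₀ ⟧) ≡ 0ℤ
            g°-zero = trans (net-antisym ends g°-anti (𝟙 ∘ ⟦ v₀ ⟧)) (out-zero ends ⟦ v₀ ⟧ zero-term)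
              where
              zero-term : ∀ e b → ⟦ v₀ ⟧ (ends e b) ≡ true → ⟦ v₀ ⟧ (ends e (not b)) ≡ false → g° e b ≡ 0ℤ
              zero-term e b h h′ with along e b in eq′
              ... | true  = ℤ.+-inverseʳ (g e b)
              ... | false = cong (_- 0ℤ) (ℤ.≤-antisym g≤0 0≤g)
                where
                src≡ : ends e b ≡ v₀
                src≡ = sym (∈⟦⟧⇒≡ h)
                tgt≢v₀ : ends e (not b) ≢ v₀
                tgt≢v₀ eq = true≢false (trans (cong ⟦ v₀ ⟧ eq) (∈⟦⟧ v₀)) h′
                tgt≢w : ends e (not b) ≢ w
                tgt≢w eq = true≢false along≡true eq′
                  where
                  along≡true : along e b ≡ true
                  along≡true rewrite src≡ | eq | ∈⟦⟧ v₀ | ∈⟦⟧ w = refl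
                g≤0 : g e b ≤ 0ℤ
                g≤0 = subst (g e b ≤_) (proj₁ (only e b src≡ tgt≢v₀ tgt≢w)) (g-≤ e b)
                0≤g : 0ℤ ≤ g e b
                0≤g = by-gap (gap (subst₂ _≤_ (antisym {g = g} g-anti e b) (only′ e b src≡ tgt≢v₀ tgt≢w) (g-≤ e (not b)))) (lem′ (g e b))
                  where
                  lem′ : ∀ x → 0ℤ - - x ≡ x - 0ℤ
                  lem′ = solve-∀
          f-meets : ∀ {B} → B ⊆ active N → ∃[ j ] net ends D (𝟙 ∘ B) ≡ q * j
          f-meets {B} B⊆ = cases (B v₀) (B w) refl refl
            where
            cases : ∀ b b′ → B v₀ ≡ b → B w ≡ b′ → ∃[ j ] net ends D (𝟙 ∘ B) ≡ q * j
            cases true  true  eq eq′ = saturated B⊆ (trans eq′ (sym eq))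
            cases false false eq eq′ = saturated B⊆ (trans eq′ (sym eq))
            cases true false eq eq′ = case saturated {B′} B′⊆ (trans B′w (sym B′v)) of λ (j′ , met′) →
              j′ + j , trans (cut-cong ends D split) (trans (net-+ˣ ends D (𝟙 ∘ B′) (𝟙 ∘ ⟦ v₀ ⟧))
                (trans (cong₂ _+_ met′ at-v₀) (sym (ℤ.*-distribˡ-+ q j′ j))))
              where
              B′ = B ∖ ⟦ v₀ ⟧
              B′⊆ : B′ ⊆ active N
              B′⊆ l = B⊆ l ∘ ∖⊆ B ⟦ v₀ ⟧ l
              B′w : B′ w ≡ false
              B′w rewrite eq′ = refl
              B′v : B′ v₀ ≡ false
              B′v rewrite ∈⟦⟧ v₀ | eq = refl
              split : ∀ l → 𝟙 (B l) ≡ 𝟙 (B′ l) + 𝟙 (⟦ v₀ ⟧ l)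
              split l with v₀ ≟ l
              ... | yes refl rewrite eq = refl
              ... | no _ with B l
              ...   | true  = refl
              ...   | false = refl
            cases false true eq eq′ = case saturated {B′} B′⊆ (trans B′w (sym B′v)) of λ (j′ , met′) →
              j′ - j , trans (lem (net ends D (𝟙 ∘ B)) (net ends D (𝟙 ∘ ⟦ v₀ ⟧)))
                (trans (cong₂ _-_ (trans (sym (net-+ˣ ends D (𝟙 ∘ B) (𝟙 ∘ ⟦ v₀ ⟧))) (trans (sym (cut-cong ends D split)) met′)) at-v₀)
                       (lem′ q j′ j))
              where
              B′ : Fin (suc n) → Bool
              B′ l = B l ∨ ⟦ v₀ ⟧ l
              lem : ∀ a b → a ≡ a + b - b
              lem = solve-∀
              lem′ : ∀ q a b → q * a - q * b ≡ q * (a - b)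
              lem′ = solve-∀
              B′⊆ : B′ ⊆ active N
              B′⊆ l h with B l in eqB | v₀ ≟ l
              ... | true  | _ = B⊆ l eqB
              ... | false | yes refl = v₀∈
              B′⊆ l () | false | no _
              B′w : B′ w ≡ true
              B′w rewrite eq′ = refl
              B′v : B′ v₀ ≡ true
              B′v rewrite ∈⟦⟧ v₀ | eq = refl
              split : ∀ l → 𝟙 (B′ l) ≡ 𝟙 (B l) + 𝟙 (⟦ v₀ ⟧ l)
              split l with v₀ ≟ l
              ... | yes refl rewrite eq = refl
              ... | no _ with B l
              ...   | true  = refl
              ...   | false = refl

    -- Excluding exempt vertices

    module _ {N : Network} {v₀ : Fin (suc n)} (ce : Counterexample N v₀) where
      open Counterexample ce

      module _ (v₀∈ : active N v₀ ≡ true) where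

        -- Splitting off needs a directed path through `v₀`. If both darts enter `v₀` or both leave
        -- it, the one at `w` is reversed first, which is allowed because `w` is active.
        no-two-neighbours : ∀ {u w} → u ≢ v₀ → w ≢ v₀ → u ≢ w → active N w ≡ true →
          Adjacent N v₀ u → Adjacent N v₀ w → ⊥
        no-two-neighbours u≢v₀ w≢v₀ u≢w w∈ (i , β , s , t , inj₂ 1≤capᵢ) (k , γ , s′ , t′ , inj₁ 1≤capₖ) =
          Lift.lift ce v₀∈ u≢w u≢v₀ w≢v₀ (inj₂ w∈)
            i (not β) t (trans (cong (end N i) (not-involutive β)) s) 1≤capᵢ
            k γ s′ t′ 1≤capₖ
        no-two-neighbours u≢v₀ w≢v₀ u≢w w∈ (i , β , s , t , inj₁ 1≤capᵢ) (k , γ , s′ , t′ , inj₂ 1≤capₖ) =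
          Lift.lift ce v₀∈ (≢-sym u≢w) w≢v₀ u≢v₀ (inj₁ w∈)
            k (not γ) t′ (trans (cong (end N k) (not-involutive γ)) s′) 1≤capₖ
            i β s t 1≤capᵢ
        no-two-neighbours u≢v₀ w≢v₀ u≢w w∈ (i , β , s , t , inj₂ 1≤capᵢ) (k , γ , s′ , t′ , inj₂ 1≤capₖ) =
          Lift.lift (shift-counterexample ce (unit-anti k (not γ)) (unit-≤cap ce k (not γ) 1≤capₖ)
              (unit-fixed ce k (not γ) (trans (cong (active N) t′) w∈) (trans (cong (active N) s″) v₀∈)))
            v₀∈ u≢w u≢v₀ w≢v₀ (inj₂ w∈)
            i (not β) t (trans (cong (end N i) (not-involutive β)) s)
              (kept ce i (not β) k (not γ) (λ { refl eq → u≢w (trans (sym t) (trans (cong (end N i) (sym eq)) t′)) }) 1≤capᵢ)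
            k γ s′ t′
              (subst (λ b → 1ℤ ≤ cap N k b - unit k (not γ) k b) (not-involutive γ) (reversed ce k (not γ)))
          where
          s″ : end N k (not (not γ)) ≡ v₀
          s″ = trans (cong (end N k) (not-involutive γ)) s′
        no-two-neighbours u≢v₀ w≢v₀ u≢w w∈ (i , β , s , t , inj₁ 1≤capᵢ) (k , γ , s′ , t′ , inj₁ 1≤capₖ) =
          Lift.lift (shift-counterexample ce (unit-anti k γ) (unit-≤cap ce k γ 1≤capₖ)
              (unit-fixed ce k γ (trans (cong (active N) s′) v₀∈) (trans (cong (active N) t′) w∈)))
            v₀∈ (≢-sym u≢w) w≢v₀ u≢v₀ (inj₁ w∈)
            k (not γ) t′ (trans (cong (end N k) (not-involutive γ)) s′) (reversed ce k γ)
            i β s t (kept ce i β k γ (λ { refl refl → u≢w (trans (sym t) t′) }) 1≤capᵢ)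

        -- Without active neighbours, `v₀` is separated from the other active vertices, and then
        -- `balanced-uncut⇒≤0` excludes edges to inactive vertices as well.
        isolated : (∀ w → w ≢ v₀ → active N w ≡ true → ¬ Adjacent N v₀ w) → ∀ {w} → active N w ≡ true → w ≢ v₀ →
          ∀ x → x ≢ v₀ → ¬ Adjacent N v₀ x
        isolated ¬adj {w} w∈ w≢v₀ x x≢v₀ (e , b , s , t , 1≤cap) =
          good (proper (∖⊆ (active N) ⟦ v₀ ⟧) (∈∖ {X = active N} {Y = ⟦ v₀ ⟧} w w∈ (∉⟦⟧ (≢-sym w≢v₀))) w≢v₀ v₀∈ v₀∉) λ within →
          contra 1≤cap (balanced-uncut⇒≤0 (proj₁ total) (balanced v₀∈) within root
            (L-separated N (⟦⟧⊆ {A = active N} v₀∈) separated (proj₂ total))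
            (U-separated N (⟦⟧⊆ {A = active N} v₀∈) separated (proj₂ total)))
          where
          v₀∉ : (active N ∖ ⟦ v₀ ⟧) v₀ ≡ false
          v₀∉ rewrite v₀∈ | ∈⟦⟧ v₀ = refl
          separated : Separated N ⟦ v₀ ⟧ (active N ∖ ⟦ v₀ ⟧)
          separated = separated-if valid {⟦ v₀ ⟧} {active N ∖ ⟦ v₀ ⟧} λ a y a∈ y∈ adj →
            ¬adj y (λ { refl → true≢false y∈ v₀∉ }) (∖⊆ (active N) ⟦ v₀ ⟧ y y∈)
              (subst (λ a → Adjacent N a y) (sym (∈⟦⟧⇒≡ a∈)) adj)
          src∈ : ⟦ v₀ ⟧ (end N e b) ≡ true
          src∈ = trans (cong ⟦ v₀ ⟧ s) (∈⟦⟧ v₀)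
          tgt∉ : ⟦ v₀ ⟧ (end N e (not b)) ≡ false
          tgt∉ = trans (cong ⟦ v₀ ⟧ t) (∉⟦⟧ (≢-sym x≢v₀))
          o i d : ℤ
          o = leaving N ⟦ v₀ ⟧
          i = entering N ⟦ v₀ ⟧
          d = demand N ⟦ v₀ ⟧
          lem : ∀ o i d → o - 1ℤ + (i - 0ℤ) + (0ℤ - (d + o + (i - d))) ≡ -1ℤ
          lem = solve-∀
          lem′ : ∀ o i d → o - 0ℤ + (i - 1ℤ) + (0ℤ - (d + o + (i - d))) ≡ -1ℤ
          lem′ = solve-∀
          contra : 1ℤ ≤ cap N e b ⊎ 1ℤ ≤ cap N e (not b) → L N ⟦ v₀ ⟧ + U N ⟦ v₀ ⟧ ≤ 0ℤ → ⊥
          contra (inj₁ h) ≤0 = absurd-gap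
            (gap (ℤ.≤-trans h (cap≤out (end N) 0≤cap ⟦ v₀ ⟧ e b src∈ tgt∉)) ⊕ gap (0≤inn (end N) 0≤cap ⟦ v₀ ⟧) ⊕ gap ≤0)
            (lem o i d)
          contra (inj₂ h) ≤0 = absurd-gap
            (gap (0≤out (end N) 0≤cap ⟦ v₀ ⟧)
              ⊕ gap (ℤ.≤-trans h (cap≤inn (end N) 0≤cap ⟦ v₀ ⟧ e (not b) tgt∉ (trans (cong (⟦ v₀ ⟧ ∘ end N e) (not-involutive b)) src∈)))
              ⊕ gap ≤0)
            (lem′ o i d)

        no-exempt : ∀ {w} → active N w ≡ true → w ≢ v₀ → ⊥
        no-exempt {w} w∈ w≢v₀ =
          by-cases {A = ∃₂ λ u y → u ≢ v₀ × y ≢ v₀ × u ≢ y × active N y ≡ true × Adjacent N v₀ u × Adjacent N v₀ y}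
            (λ (_ , _ , u≢ , y≢ , u≢y , y∈ , adj , adj′) → no-two-neighbours u≢ y≢ u≢y y∈ adj adj′) λ ¬two →
          by-cases {A = ∃[ y ] (y ≢ v₀ × active N y ≡ true × Adjacent N v₀ y)}
            (λ (y , y≢ , y∈ , adj) → DeadEnd.dead-end ce v₀∈ y≢ y∈ λ e b s t≢v₀ t≢y →
              nonadjacent valid e b λ adj′ → ¬two (_ , y , t≢v₀ , y≢ , t≢y , y∈ , subst (λ a → Adjacent N a _) s adj′ , adj)) λ ¬one →
          -- There are no edges at `v₀`, so any other active vertex can serve as its neighbour.
          DeadEnd.dead-end ce v₀∈ w≢v₀ w∈ λ e b s t≢v₀ _ → nonadjacent valid e b λ adj →
            isolated (λ y y≢ y∈ adj′ → ¬one (y , y≢ , y∈ , adj′)) w∈ w≢v₀ _ t≢v₀ (subst (λ a → Adjacent N a _) s adj)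

    -- Connectivity, and moving a vertex to the other end of its window

    module _ {N : Network} (ce : Counterexample N zero) where
      open Counterexample ce

      -- Two separated parts would both be in their windows, and their margins together exceed what
      -- `Root` allows at z₀.
      connected : ∀ {A} → A ⊆ active N → ∀ {x z} → A x ≡ true → active N z ≡ true → A z ≡ false →
        ¬ (∀ a b → A a ≡ true → (active N ∖ A) b ≡ true → ¬ Adjacent N a b)
      connected {A} A⊆ {x} {z} x∈ z∈ z∉ ¬adj =
        good (proper A⊆ x∈ (active-≢zero valid (A⊆ x x∈)) z∈ z∉) λ w →
        good (proper (∖⊆ (active N) A) (∈∖ {X = active N} {Y = A} z z∈ z∉) (active-≢zero valid z∈) (A⊆ x x∈) x∉) λ w′ →
        uncut⇒⊥ (proj₁ total) w w′ root (L-separated N A⊆ separated (proj₂ total)) (U-separated N A⊆ separated (proj₂ total))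
        where
        x∉ : (active N ∖ A) x ≡ false
        x∉ rewrite A⊆ x x∈ | x∈ = refl
        separated : Separated N A (active N ∖ A)
        separated = separated-if valid {A} {active N ∖ A} ¬adj

    -- D consists of d darts leading from x to z₀.
    module Flip {N : Network} (ce : Counterexample N zero) {x : Fin (suc n)} (x∈ : active N x ≡ true)
      (right : ∀ y → active N y ≡ true → Within p q (L N ⟦ y ⟧) (U N ⟦ y ⟧))
      (d : ℤ) (d≤1 : d ≤ 1ℤ) (D : Darts ℤ (size N)) (0≤D : ∀ e b → 0ℤ ≤ D e b) (D≤cap : ∀ e b → D e b ≤ cap N e b)
      (out-D : ∀ {A} → A ⊆ active N → out (end N) D (𝟙 ∘ A) ≡ 𝟙 (A x) * d)
      (inn-D : ∀ {A} → A ⊆ active N → inn (end N) D (𝟙 ∘ A) ≡ 0ℤ)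
      (inside-D : inside (end N) D (𝟙 ∘ active N) ≡ 0ℤ)
      (entering≡0 : entering N (active N) ≡ 0ℤ)
      (root′ : Root (q - d) (leaving N (active N) - d))
      where
      open Counterexample ce

      N′ : Network
      N′ = add-edge N zero x (q - d) (cap N -ᵈ D)

      zero∉ : ∀ {A} → A ⊆ active N → A zero ≡ false
      zero∉ {A} A⊆ with A zero in eq
      ... | false = refl
      ... | true  = ⊥-elim (true≢false (A⊆ zero eq) inactive)

      leaving-flip : ∀ {A} → A ⊆ active N → leaving N′ A ≡ leaving N A - 𝟙 (A x) * d
      leaving-flip {A} A⊆ = trans (leaving-add N zero x (q - d) (cap N -ᵈ D) A) (trans
        (cong₂ (λ a o → 𝟙 a * (1ℤ - 𝟙 (A x)) * (q - d) + o) (zero∉ A⊆)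
          (trans (cut-- (end N) (cap N) D (𝟙 ∘ A)) (cong (λ r → leaving N A - r) (out-D A⊆))))
        (lem (𝟙 (A x)) (q - d) (leaving N A) d))
        where
        lem : ∀ x k o d → 0ℤ * (1ℤ - x) * k + (o - x * d) ≡ o - x * d
        lem = solve-∀

      entering-flip : ∀ {A} → A ⊆ active N → entering N′ A ≡ entering N A + 𝟙 (A x) * (q - d)
      entering-flip {A} A⊆ = trans (entering-add N zero x (q - d) (cap N -ᵈ D) A) (trans
        (cong₂ (λ a i → (1ℤ - 𝟙 a) * 𝟙 (A x) * (q - d) + i) (zero∉ A⊆)
          (trans (cut-- (end N) (cap N) D (𝟙 ∘ A)) (cong (λ r → entering N A - r) (inn-D A⊆))))
        (lem (𝟙 (A x)) (q - d) (entering N A)))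
        where
        lem : ∀ x k i → (1ℤ - 0ℤ) * x * k + (i - 0ℤ) ≡ i + x * k
        lem = solve-∀

      L-flip : ∀ {A} → A ⊆ active N → L N′ A ≡ L N A - 𝟙 (A x) * d
      L-flip {A} A⊆ = trans (cong₂ _+_ (demand-add N zero x (q - d) (cap N -ᵈ D) A) (leaving-flip A⊆))
        (sym (ℤ.+-assoc (demand N A) (leaving N A) _))

      U-flip : ∀ {A} → A ⊆ active N → U N′ A ≡ U N A + 𝟙 (A x) * (q - d)
      U-flip {A} A⊆ = trans (cong₂ _-_ (entering-flip A⊆) (demand-add N zero x (q - d) (cap N -ᵈ D) A))
        (lem (entering N A) (demand N A) (𝟙 (A x) * (q - d)))
        where
        lem : ∀ i d x → i + x - d ≡ i - d + x
        lem = solve-∀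

      flipped-window : ∀ {A a b} → A ⊆ active N → A x ≡ true → Within a b (L N A - d) (U N A + (q - d)) → Within a b (L N′ A) (U N′ A)
      flipped-window {A} {a} {b} A⊆ x∈A = subst₂ (Within a b)
        (trans (cong (λ r → L N A - r) (trans (sym (ℤ.*-identityˡ d)) (cong (λ a → 𝟙 a * d) (sym x∈A)))) (sym (L-flip A⊆)))
        (trans (cong (λ r → U N A + r) (trans (sym (ℤ.*-identityˡ (q - d))) (cong (λ a → 𝟙 a * (q - d)) (sym x∈A)))) (sym (U-flip A⊆)))

      unflipped-window : ∀ {A a b} → A ⊆ active N → A x ≡ false → Within a b (L N A) (U N A) → Within a b (L N′ A) (U N′ A)
      unflipped-window {A} {a} {b} A⊆ x∉A = subst₂ (Within a b)
        (trans (sym (ℤ.+-identityʳ (L N A))) (trans (cong (λ a → L N A - 𝟙 a * d) (sym x∉A)) (sym (L-flip A⊆))))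
        (trans (sym (ℤ.+-identityʳ (U N A))) (trans (cong (λ a → U N A + 𝟙 a * (q - d)) (sym x∉A)) (sym (U-flip A⊆))))

      flip-valid : Valid N′ zero
      flip-valid = record
        { 0≤cap    = λ { zero true → 0≤q-d ; zero false → +≤+ z≤n ; (suc e) b → gap (D≤cap e b) }
        ; inactive = inactive
        ; total    = proj₁ total , trans (demand-add N zero x (q - d) (cap N -ᵈ D) (active N)) (proj₂ total)
        ; root     = subst₂ Root (sym entering≡) (sym leaving≡) root′
        ; good     = λ { {A} (proper A⊆ z∈ z≢ w∈ w∉) → window (proper A⊆ z∈ z≢ w∈ w∉) (A x) refl }
        ; balanced = λ zero∈ → ⊥-elim (true≢false zero∈ inactive)
        }
        where
        0≤q-d : 0ℤ ≤ q - d
        0≤q-d = by-gap (q≥ ⊕ gap 1≤p ⊕ gap d≤1 ⊕ +≤+ {n = 1} z≤n) (lem p q d)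
          where
          lem : ∀ p q d → q - (1ℤ + p) + (p - 1ℤ) + (1ℤ - d) + 1ℤ ≡ q - d - 0ℤ
          lem = solve-∀
        entering≡ : entering N′ (active N) ≡ q - d
        entering≡ = trans (entering-flip (λ _ → id)) (trans (cong₂ (λ i a → i + 𝟙 a * (q - d)) entering≡0 x∈)
          (trans (ℤ.+-identityˡ _) (ℤ.*-identityˡ (q - d))))
        leaving≡ : leaving N′ (active N) ≡ leaving N (active N) - d
        leaving≡ = trans (leaving-flip (λ _ → id)) (trans (cong (λ a → leaving N (active N) - 𝟙 a * d) x∈)
          (cong (λ r → leaving N (active N) - r) (ℤ.*-identityˡ d)))
        window : ∀ {A} → Proper N zero A → ∀ b → A x ≡ b → ¬ ¬ Within p p (L N′ A) (U N′ A)
        window {A} A-proper false x∉A ¬w = good A-proper (¬w ∘ unflipped-window (Proper.sub A-proper) x∉A)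
        window {A} (proper A⊆ z∈ z≢ w∈ w∉) true x∈A ¬w with another A x x∈A
        ... | inj₁ same = ¬w (flipped-window A⊆ x∈A (within-weaken p≤q ℤ.≤-refl (flip-window d d≤1 (LU-cong N same (right x x∈)))))
        ... | inj₂ (y , y∈ , y≢x) = strict ce (proper A⊆ x∈A (active-≢zero valid x∈) w∈ w∉) y∈ y≢x λ w →
          ¬w (flipped-window A⊆ x∈A (within-mono {q} {q} {L N A} {U N A} {p} {p}
            (by-gap (gap d≤1 ⊕ q≥) (lem p q d (L N A)))
            (by-gap (q≥ ⊕ q≥ ⊕ gap d≤1 ⊕ gap 1≤p ⊕ +≤+ {n = 2} z≤n) (lem′ p q d (U N A))) w))
          where
          lem : ∀ p q d l → 1ℤ - d + (q - (1ℤ + p)) ≡ l - d - l - (p - q)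
          lem = solve-∀
          lem′ : ∀ p q d u → q - (1ℤ + p) + (q - (1ℤ + p)) + (1ℤ - d) + (p - 1ℤ) + + 2 ≡ u + (q - d) - u - (p - q)
          lem′ = solve-∀

      -- The added edge ends at the inactive label `zero`, so it is never reversed and can simply be
      -- forgotten.
      flip-solution : Solution N′ → Solution N
      flip-solution sol = record
        { flow  = λ e → flow (suc e)
        ; anti  = λ e → anti (suc e)
        ; ≤cap  = λ e b → ℤ.≤-trans (≤cap (suc e) b) (by-gap (0≤D e b) (lem (cap N e b) (D e b)))
        ; fixed = λ e → fixed (suc e)
        ; meets = λ {B} B⊆ → case meets {B} B⊆ of λ (j , eq) →
            j , trans (lem′ (𝟙 (B zero)) (𝟙 (B x)) _) (trans
              (cong₂ (λ a b → 𝟙 (B zero) * a + 𝟙 (B x) * b + net (end N) (dem N +ᵈ (λ e → flow (suc e))) (𝟙 ∘ B))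
                (sym zero-true) (sym (trans (anti zero) (cong -_ zero-true))))
              (trans (sym (meets-add N zero x (q - d) (cap N -ᵈ D) flow (𝟙 ∘ B))) eq))
        }
        where
        open Solution sol
        zero-true : flow zero true ≡ 0ℤ
        zero-true = fixed zero true inactive
        lem : ∀ c d → d ≡ c - (c - d)
        lem = solve-∀
        lem′ : ∀ a b n → n ≡ a * 0ℤ + b * 0ℤ + n
        lem′ = solve-∀

      flipped : Counterexample N′ zero
      flipped = record
        { valid = flip-valid ; card≡ = card≡
        ; energy≡ = trans (energy-add N zero x (q - d) (cap N -ᵈ D)) (trans
            (cong₂ (λ a i → 𝟙 a * 𝟙 (active N x) * (q - d) + i) inactive
              (trans (cut-- (end N) (cap N) D (𝟙 ∘ active N)) (cong (λ r → energy N - r) inside-D)))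
            (trans (lem (𝟙 (active N x)) (q - d) (energy N)) energy≡))
        ; unsolvable = unsolvable ∘ flip-solution }
        where
        lem : ∀ a k e → 0ℤ * a * k + (e - 0ℤ) ≡ e
        lem = solve-∀

      -- By connectivity an edge joins `x`, which now has room on the left, to a vertex that still
      -- has room on the right.
      flip : ∀ {y} → active N y ≡ true → y ≢ x → ⊥
      flip {y} y∈ y≢x = connected flipped (⟦⟧⊆ {A = active N} x∈) (∈⟦⟧ x) y∈ (∉⟦⟧ (≢-sym y≢x)) ¬adj
        where
        left-x : Within q p (L N′ ⟦ x ⟧) (U N′ ⟦ x ⟧)
        left-x = flipped-window (⟦⟧⊆ {A = active N} x∈) (∈⟦⟧ x) (flip-window d d≤1 (right x x∈))
        ¬adj : ∀ a b → ⟦ x ⟧ a ≡ true → (active N ∖ ⟦ x ⟧) b ≡ true → ¬ Adjacent N′ a b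
        ¬adj a z a∈ z∈′ (e , b , s , t , 1≤cap) = contra 1≤cap
          where
          z∈ : active N z ≡ true
          z∈ = ∖⊆ (active N) ⟦ x ⟧ z z∈′
          s′ : end N′ e b ≡ x
          s′ = trans s (sym (∈⟦⟧⇒≡ a∈))
          right-z : Within p q (L N′ ⟦ z ⟧) (U N′ ⟦ z ⟧)
          right-z = unflipped-window (⟦⟧⊆ {A = active N} z∈)
            (∉⟦⟧ λ { refl → true≢false (∈⟦⟧ x) (∉∖ (active N) ⟦ x ⟧ z z∈′) }) (right z z∈)
          contra : 1ℤ ≤ cap N′ e b ⊎ 1ℤ ≤ cap N′ e (not b) → ⊥
          contra (inj₁ h) = no-dart flipped e b s′ t h x∈ z∈ left-x right-z
          contra (inj₂ h) = no-dart′ flipped e (not b) t (trans (cong (end N′ e) (not-involutive b)) s′) h z∈ x∈ right-z left-x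

  -- The induction step

  module Step (c : ℕ) (ε φ : ℤ)
    (IH₁ : ∀ N v₀ → Valid N v₀ → card (active N) ℕ.< c → ¬ ¬ Solution N)
    (IH₂ : ∀ N v₀ → Valid N v₀ → card (active N) ≡ c → energy N < ε → ¬ ¬ Solution N)
    (IH₃ : ∀ N v₀ → Valid N v₀ → card (active N) ≡ c → energy N ≡ ε → fringe N < φ → ¬ ¬ Solution N)
    where
    open Minimal c ε IH₁ IH₂

    -- Since every vertex has room on the right, an edge entering from z₀ could be deleted, so there
    -- is none. Therefore `Root` admits the new entering edges: q - 1 = p of them if a leaving edge
    -- is exchanged, and q of them if no edge leaves.
    all-right : ∀ {N} → Counterexample N zero → fringe N ≡ φ →
      ∀ {x y} → active N x ≡ true → active N y ≡ true → x ≢ y →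
      (∀ z → active N z ≡ true → Within p q (L N ⟦ z ⟧) (U N ⟦ z ⟧)) → ⊥
    all-right {N} ce fringe≡ {x} {y} x∈ y∈ x≢y right =
      by-cases {A = ∃₂ λ e b → active N (end N e b) ≡ false × active N (end N e (not b)) ≡ true × 1ℤ ≤ cap N e b}
        remove λ ¬in →
      by-cases {A = ∃₂ λ e b → active N (end N e b) ≡ true × active N (end N e (not b)) ≡ false × 1ℤ ≤ cap N e b}
        (swap (no-entering ¬in)) (add (no-entering ¬in))
      where
      open Counterexample ce
      remove : (∃₂ λ e b → active N (end N e b) ≡ false × active N (end N e (not b)) ≡ true × 1ℤ ≤ cap N e b) → ⊥
      remove (i , β , s∉ , t∈ , 1≤cap) = IH₃ (delete N i β) zero
        (delete-valid N i β valid 1≤cap inactive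
          (λ P s∈A _ → ⊥-elim (true≢false (Proper.sub P _ s∈A) s∉))
          (λ P _ t∈A → around ce p≤q ℤ.≤-refl P _ t∈A (active-≢zero valid t∈) (right _ t∈)))
        card≡
        (trans (energy-delete N i β) (trans (cong (λ a → energy N - 𝟙 a * 𝟙 (active N (end N i (not β)))) s∉)
          (trans (ℤ.+-identityʳ (energy N)) energy≡)))
        (ℤ.suc[i]≤j⇒i<j (ℤ.≤-reflexive (trans (cong (λ r → 1ℤ + r) fringe-delete) (trans (lem (fringe N)) fringe≡))))
        (unsolvable ∘ delete-solution N i β)
        where
        lem : ∀ f → 1ℤ + (f - 1ℤ) ≡ f
        lem = solve-∀
        lem′ : ∀ i o → i - 1ℤ + (o - 0ℤ) ≡ i + o - 1ℤ
        lem′ = solve-∀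
        fringe-delete : fringe (delete N i β) ≡ fringe N - 1ℤ
        fringe-delete = trans (cong₂ _+_ (entering-delete N i β (active N)) (leaving-delete N i β (active N))) (trans
          (cong₂ (λ s t → entering N (active N) - (1ℤ - 𝟙 s) * 𝟙 t + (leaving N (active N) - 𝟙 s * (1ℤ - 𝟙 t))) s∉ t∈)
          (lem′ (entering N (active N)) (leaving N (active N))))
      ≡0 : ∀ e b → ¬ 1ℤ ≤ cap N e b → cap N e b ≡ 0ℤ
      ≡0 e b ¬1≤ with cap N e b ℤ.≟ 0ℤ
      ... | yes eq = eq
      ... | no ne = ⊥-elim (¬1≤ (positive (0≤cap e b) ne))
      no-entering : ¬ (∃₂ λ e b → active N (end N e b) ≡ false × active N (end N e (not b)) ≡ true × 1ℤ ≤ cap N e b) →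
        entering N (active N) ≡ 0ℤ
      no-entering ¬in = inn-zero (end N) (active N) λ e b s∉ t∈ → ≡0 e b λ 1≤cap → ¬in (e , b , s∉ , t∈ , 1≤cap)
      outside : ∀ {A l} → A ⊆ active N → active N l ≡ false → A l ≡ false
      outside {A} {l} A⊆ ∉ with A l in eq
      ... | false = refl
      ... | true  = ⊥-elim (true≢false (A⊆ l eq) ∉)
      leaving≤ : leaving N (active N) ≤ p + q
      leaving≤ = case root of λ
        { (inj₁ (_ , h)) → h
        ; (inj₂ (_ , h)) → by-gap (gap h ⊕ 0≤q) (lem p q (leaving N (active N))) }
        where
        lem : ∀ p q l → p - l + q ≡ p + q - l
        lem = solve-∀
      swap : entering N (active N) ≡ 0ℤ →
        (∃₂ λ e b → active N (end N e b) ≡ true × active N (end N e (not b)) ≡ false × 1ℤ ≤ cap N e b) → ⊥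
      swap entering≡0 (i , β , s∈ , t∉ , 1≤cap) = other x x∈ y y∈ x≢y
        where
        s : Fin (suc n)
        s = end N i β
        flip-at : ∀ {z} → active N z ≡ true → z ≢ s → ⊥
        flip-at = Flip.flip ce s∈ right 1ℤ ℤ.≤-refl (δ i β) (0≤δ i β) (δ≤ 0≤cap i β 1≤cap)
          (λ {A} A⊆ → trans (cut-δ (end N) i β (𝟙 ∘ A)) (cong (λ t → 𝟙 (A s) * (1ℤ - 𝟙 t)) (outside {A} A⊆ t∉)))
          (λ {A} A⊆ → trans (cut-δ (end N) i β (𝟙 ∘ A)) (trans (cong (λ t → (1ℤ - 𝟙 (A s)) * 𝟙 t) (outside {A} A⊆ t∉)) (ℤ.*-zeroʳ (1ℤ - 𝟙 (A s)))))
          (trans (cut-δ (end N) i β (𝟙 ∘ active N)) (trans (cong (λ t → 𝟙 (active N s) * 𝟙 t) t∉) (ℤ.*-zeroʳ (𝟙 (active N s)))))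
          entering≡0
          (inj₁ (by-gap q≤ (lem p q) , by-gap (gap leaving≤ ⊕ +≤+ {n = 1} z≤n) (lem′ (p + q) (leaving N (active N)))))
          where
          lem : ∀ p q → 1ℤ + p - q ≡ p - (q - 1ℤ)
          lem = solve-∀
          lem′ : ∀ a l → a - l + 1ℤ ≡ a - (l - 1ℤ)
          lem′ = solve-∀
        other : ∀ x → active N x ≡ true → ∀ y → active N y ≡ true → x ≢ y → ⊥
        other x x∈ y y∈ x≢y with x ≟ s
        ... | yes refl = flip-at y∈ (≢-sym x≢y)
        ... | no  x≢s  = flip-at x∈ x≢s
      add : entering N (active N) ≡ 0ℤ →
        ¬ (∃₂ λ e b → active N (end N e b) ≡ true × active N (end N e (not b)) ≡ false × 1ℤ ≤ cap N e b) → ⊥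
      add entering≡0 ¬out = Flip.flip ce x∈ right 0ℤ (+≤+ z≤n) (λ _ _ → 0ℤ) (λ _ _ → +≤+ z≤n) 0≤cap
        (λ {A} _ → trans (out-zero (end N) A λ _ _ _ _ → refl) (sym (ℤ.*-zeroʳ (𝟙 (A x)))))
        (λ {A} _ → inn-zero (end N) A λ _ _ _ _ → refl)
        (inside-antisym (end N) {λ _ _ → 0ℤ} (λ _ → refl) (𝟙 ∘ active N))
        entering≡0
        (inj₂ ( by-gap (ℤ.≤-trans (+≤+ z≤n) 1≤p) (lem p q)
              , subst (λ l → l - 0ℤ ≤ p) (sym leaving≡0) (ℤ.≤-trans (+≤+ z≤n) 1≤p)))
        y∈ (≢-sym x≢y)
        where
        lem : ∀ p q → p ≡ p + q - (q - 0ℤ)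
        lem = solve-∀
        leaving≡0 : leaving N (active N) ≡ 0ℤ
        leaving≡0 = out-zero (end N) (active N) λ e b s∈ t∉ → ≡0 e b λ 1≤cap → ¬out (e , b , s∈ , t∉ , 1≤cap)

    transpose-counterexample : ∀ {N v₀} → Counterexample N v₀ → Counterexample (transpose N) v₀
    transpose-counterexample {N} ce = record
      { valid = transpose-valid N valid ; card≡ = card≡ ; energy≡ = trans (energy-transpose N) energy≡
      ; unsolvable = unsolvable ∘ transpose-solution N }
      where open Counterexample ce

    -- No edge joins a vertex with room on the left to one with room on the right, so by
    -- connectivity all vertices are of one kind; `transpose` turns the left kind into the right
    -- one.
    unbalanced : ∀ {N} → Counterexample N zero → fringe N ≡ φ →
      ∀ {x y} → active N x ≡ true → active N y ≡ true → x ≢ y →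
      (∀ z → active N z ≡ true → ¬ Balanced (L N ⟦ z ⟧) (U N ⟦ z ⟧)) → ⊥
    unbalanced {N} ce fringe≡ {x} {y} x∈ y∈ x≢y ¬bal = ¬¬-∀ classify uniform
      where
      open Counterexample ce
      Left Right : Fin (suc n) → Set
      Left  z = Within q p (L N ⟦ z ⟧) (U N ⟦ z ⟧)
      Right z = Within p q (L N ⟦ z ⟧) (U N ⟦ z ⟧)
      Class : Fin (suc n) → Set
      Class z = (active N z ≡ true → Left z) ⊎ (¬ Left z × (active N z ≡ true → Right z))
      proper-single : ∀ z → active N z ≡ true → Proper N zero ⟦ z ⟧
      proper-single z z∈ with z ≟ x
      ... | yes refl = proper (⟦⟧⊆ {A = active N} z∈) (∈⟦⟧ z) (active-≢zero valid z∈) y∈ (∉⟦⟧ x≢y)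
      ... | no  z≢x  = proper (⟦⟧⊆ {A = active N} z∈) (∈⟦⟧ z) (active-≢zero valid z∈) x∈ (∉⟦⟧ z≢x)
      classify : ∀ z → ¬ ¬ Class z
      classify z ¬class = by-cases {A = active N z ≡ true}
        (λ z∈ → good (proper-single z z∈) λ w → by-cases {A = Left z}
          (λ l → ¬class (inj₁ λ _ → l))
          (λ ¬l → case left-or-right w (¬bal z z∈) of λ
            { (inj₁ l) → ¬l l ; (inj₂ r) → ¬class (inj₂ (¬l , λ _ → r)) }))
        (λ z∉ → ¬class (inj₁ λ z∈ → ⊥-elim (z∉ z∈)))
      uniform : (∀ z → Class z) → ⊥
      uniform class = mixed (any? (λ z → A z ≟ᵇ true)) (any? (λ z → (active N ∖ A) z ≟ᵇ true))
        where
        isLeft : ∀ {z} → Class z → Bool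
        isLeft (inj₁ _) = true
        isLeft (inj₂ _) = false
        A : Fin (suc n) → Bool
        A z = active N z ∧ isLeft (class z)
        A⊆ : A ⊆ active N
        A⊆ z h with active N z
        ... | true = refl
        A-left : ∀ z → A z ≡ true → Left z
        A-left z h = from (class z) (active N z) refl h
          where
          from : ∀ cl b → active N z ≡ b → b ∧ isLeft cl ≡ true → Left z
          from (inj₁ l) true eq _ = l eq
          from (inj₂ _) true _ ()
          from _ false _ ()
        A-right : ∀ z → active N z ≡ true → A z ≡ false → Right z
        A-right z z∈ h = from (class z) (trans (cong (_∧ isLeft (class z)) (sym z∈)) h)
          where
          from : ∀ cl → isLeft cl ≡ false → Right z
          from (inj₂ (_ , r)) _ = r z∈
        mixed : Dec (∃[ z ] A z ≡ true) → Dec (∃[ z ] (active N ∖ A) z ≡ true) → ⊥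
        mixed (yes (a , a∈)) (yes (b , b∈)) =
          connected ce A⊆ a∈ (∖⊆ (active N) A b b∈) (∉∖ (active N) A b b∈) λ
            { s t s∈ t∈ (e , β , eq , eq′ , inj₁ h) → no-dart ce e β eq eq′ h (A⊆ s s∈) (∖⊆ (active N) A t t∈)
                (A-left s s∈) (A-right t (∖⊆ (active N) A t t∈) (∉∖ (active N) A t t∈))
            ; s t s∈ t∈ (e , β , eq , eq′ , inj₂ h) → no-dart′ ce e (not β) eq′ (trans (cong (end N e) (not-involutive β)) eq) h
                (∖⊆ (active N) A t t∈) (A⊆ s s∈)
                (A-right t (∖⊆ (active N) A t t∈) (∉∖ (active N) A t t∈)) (A-left s s∈) }
        mixed (no none) _ = all-right ce fringe≡ x∈ y∈ x≢y λ z z∈ → A-right z z∈ (absent z)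
          where
          absent : ∀ z → A z ≡ false
          absent z with A z in eq
          ... | false = refl
          ... | true  = ⊥-elim (none (z , eq))
        mixed _ (no none) = all-right (transpose-counterexample ce) (trans (fringe-transpose N) fringe≡) x∈ y∈ x≢y
          λ z z∈ → within-transpose N (A-left z (present z z∈))
          where
          present : ∀ z → active N z ≡ true → A z ≡ true
          present z z∈ with A z in eq
          ... | true  = refl
          ... | false = ⊥-elim (none (z , ∈∖ {X = active N} {Y = A} z z∈ eq))

    without-exemption : ∀ {N v₀} → Valid N v₀ → active N v₀ ≡ false → Valid N zero
    without-exemption valid v₀∉ = record
      { 0≤cap = 0≤cap ; inactive = inactive ; total = total ; root = root
      ; good = λ { (proper A⊆ x∈ x≢ z∈ z∉) → good (proper A⊆ x∈ (λ { refl → true≢false (A⊆ _ x∈) v₀∉ }) z∈ z∉) }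
      ; balanced = λ zero∈ → ⊥-elim (true≢false zero∈ inactive) }
      where open Valid valid

    with-exemption : ∀ {N} → Valid N zero → ∀ {v₀} → Balanced (L N ⟦ v₀ ⟧) (U N ⟦ v₀ ⟧) → Valid N v₀
    with-exemption valid bal = record
      { 0≤cap = 0≤cap ; inactive = inactive ; total = total ; root = root
      ; good = λ { (proper A⊆ x∈ x≢ z∈ z∉) → good (proper A⊆ x∈ (active-≢zero valid (A⊆ _ x∈)) z∈ z∉) }
      ; balanced = λ _ → bal }
      where open Valid valid

    -- A balanced vertex may be declared exempt and then falls under `no-exempt`. Hence the
    -- remaining case is that no active vertex is balanced.
    two-vertices : ∀ {N v₀} → Counterexample N v₀ → fringe N ≡ φ →
      ∀ {x y} → active N x ≡ true → active N y ≡ true → x ≢ y → ⊥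
    two-vertices {N} {v₀} ce fringe≡ {x} {y} x∈ y∈ x≢y = split (active N v₀) refl
      where
      open Counterexample ce
      exempt : ∀ {v} → Valid N v → active N v ≡ true → ⊥
      exempt {v} valid′ v∈ with x ≟ v
      ... | yes refl = no-exempt (record { valid = valid′ ; card≡ = card≡ ; energy≡ = energy≡ ; unsolvable = unsolvable }) v∈ y∈ (≢-sym x≢y)
      ... | no  x≢v  = no-exempt (record { valid = valid′ ; card≡ = card≡ ; energy≡ = energy≡ ; unsolvable = unsolvable }) v∈ x∈ x≢v
      split : ∀ b → active N v₀ ≡ b → ⊥
      split true  v₀∈ = exempt valid v₀∈
      split false v₀∉ = by-cases {A = ∃[ z ] (active N z ≡ true × Balanced (L N ⟦ z ⟧) (U N ⟦ z ⟧))}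
        (λ (z , z∈ , bal) → exempt (with-exemption valid₀ bal) z∈) λ ¬bal →
        unbalanced (record { valid = valid₀ ; card≡ = card≡ ; energy≡ = energy≡ ; unsolvable = unsolvable })
          fringe≡ x∈ y∈ x≢y λ z z∈ bal → ¬bal (z , z∈ , bal)
        where
        valid₀ = without-exemption valid v₀∉

  one-vertex : ∀ {N v₀} → Valid N v₀ → (∀ x y → active N x ≡ true → active N y ≡ true → x ≡ y) → Solution N
  one-vertex {N} valid unique = record
    { flow = λ _ _ → 0ℤ ; anti = λ _ → refl ; ≤cap = 0≤cap ; fixed = λ _ _ _ → refl
    ; meets = λ {B} B⊆ → case meets B⊆ of λ (j , eq) →
        j , trans (cut-≗ (end N) (𝟙 ∘ B) λ e b → ℤ.+-identityʳ (dem N e b)) eq }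
    where
    open Valid valid
    meets : ∀ {B} → B ⊆ active N → ∃[ j ] demand N B ≡ q * j
    meets {B} B⊆ with any? (λ z → B z ≟ᵇ true)
    ... | yes (z , z∈) = proj₁ total , trans (cut-cong (end N) (dem N) λ l → cong 𝟙 (same l)) (proj₂ total)
      where
      same : ∀ l → B l ≡ active N l
      same l = ≡-from-⊆ (B⊆ l) λ l∈ → subst (λ l → B l ≡ true) (unique z l (B⊆ z z∈) l∈) z∈
    ... | no none = 0ℤ , trans (cut-zero (end N) (𝟙 ∘ B) (λ e b → inj₁ (cong 𝟙 (empty (end N e b))))) (sym (ℤ.*-zeroʳ q))
      where
      empty : ∀ l → B l ≡ false
      empty l with B l in eq
      ... | false = refl
      ... | true  = ⊥-elim (none (l , eq))

  -- Lexicographic induction: contracting and restricting lower the number of active vertices,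
  -- splitting off and deleting darts between active vertices lower `energy`, and deleting darts
  -- from z₀ lowers `fringe`.
  solve : ∀ N v₀ → Valid N v₀ → ¬ ¬ Solution N
  solve N v₀ valid = <-rec P₁ step₁ (card (active N)) N v₀ valid refl
    where
    P₁ : ℕ → Set
    P₁ c = ∀ N v₀ → Valid N v₀ → card (active N) ≡ c → ¬ ¬ Solution N
    ∣∣-< : ∀ {i j} → 0ℤ ≤ i → i < j → ∣ i ∣ ℕ.< ∣ j ∣
    ∣∣-< {+ i} {+ j} _ i<j = ℤ.drop‿+<+ i<j
    0≤energy : ∀ {N v₀} → Valid N v₀ → 0ℤ ≤ energy N
    0≤energy {N} valid = 0≤inside (end N) (Valid.0≤cap valid) (active N)
    0≤fringe : ∀ {N v₀} → Valid N v₀ → 0ℤ ≤ fringe N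
    0≤fringe {N} valid = 0≤inn (end N) (Valid.0≤cap valid) (active N) ⊕ 0≤out (end N) (Valid.0≤cap valid) (active N)
    step₁ : ∀ c → (∀ {c′} → c′ ℕ.< c → P₁ c′) → P₁ c
    step₁ c IH₁ N v₀ valid card≡ = <-rec P₂ step₂ ∣ energy N ∣ N v₀ valid card≡ refl
      where
      P₂ : ℕ → Set
      P₂ m = ∀ N v₀ → Valid N v₀ → card (active N) ≡ c → ∣ energy N ∣ ≡ m → ¬ ¬ Solution N
      step₂ : ∀ m → (∀ {m′} → m′ ℕ.< m → P₂ m′) → P₂ m
      step₂ m IH₂ N v₀ valid card≡ energy≡ = <-rec P₃ step₃ ∣ fringe N ∣ N v₀ valid card≡ energy≡ refl
        where
        P₃ : ℕ → Set
        P₃ k = ∀ N v₀ → Valid N v₀ → card (active N) ≡ c → ∣ energy N ∣ ≡ m → ∣ fringe N ∣ ≡ k → ¬ ¬ Solution N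
        step₃ : ∀ k → (∀ {k′} → k′ ℕ.< k → P₃ k′) → P₃ k
        step₃ k IH₃ N v₀ valid card≡ energy≡ fringe≡ unsolvable =
          case any? (λ x → any? (λ y → (active N x ≟ᵇ true) ×-dec ((active N y ≟ᵇ true) ×-dec ¬? (x ≟ y)))) of λ
            { (yes (x , y , x∈ , y∈ , x≢y)) → two-vertices
                (record { valid = valid ; card≡ = card≡ ; energy≡ = refl ; unsolvable = unsolvable }) refl x∈ y∈ x≢y
            ; (no none) → unsolvable (one-vertex valid λ x y x∈ y∈ → case x ≟ y of λ
                { (yes eq) → eq ; (no ne) → ⊥-elim (none (x , y , x∈ , y∈ , ne)) }) }
          where
          open Step c (energy N) (fringe N)
            (λ N′ v valid′ lt → IH₁ lt N′ v valid′ refl)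
            (λ N′ v valid′ card≡′ lt → IH₂ (subst (∣ energy N′ ∣ ℕ.<_) energy≡ (∣∣-< (0≤energy valid′) lt)) N′ v valid′ card≡′ refl)
            (λ N′ v valid′ card≡′ energy≡′ lt → IH₃ (subst (∣ fringe N′ ∣ ℕ.<_) fringe≡ (∣∣-< (0≤fringe valid′) lt))
              N′ v valid′ card≡′ (trans (cong ∣_∣ energy≡′) energy≡) refl)

-- Signed graphs

sum-linear : ∀ {m} (f g : Fin m → ℤ) k → sum (λ i → f i + k * g i) ≡ sum f + k * sum g
sum-linear f g k = trans (∑-distrib-+ f (λ i → k * g i)) (cong (λ r → sum f + r) (sym (*-distribˡ-sum k g)))

count-tabulate : ∀ {A : Set} {P : A → Set} (P? : Decidable P) {m} (f : Fin m → A) →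
  + count P? (tabulate f) ≡ sum (λ i → 𝟙 (does (P? (f i))))
count-tabulate P? {zero} f = refl
count-tabulate P? {suc m} f with does (P? (f zero))
... | true  = cong (λ r → 1ℤ + r) (count-tabulate P? (f ∘ suc))
... | false = trans (count-tabulate P? (f ∘ suc)) (sym (ℤ.+-identityˡ _))

sgn : Sign → ℤ
sgn Sign.+ = 1ℤ
sgn Sign.- = -1ℤ

sgn-* : ∀ s t → sgn (s Sign.* t) ≡ sgn s * sgn t
sgn-* Sign.+ Sign.+ = refl
sgn-* Sign.+ Sign.- = refl
sgn-* Sign.- Sign.+ = refl
sgn-* Sign.- Sign.- = refl

negative : Sign → ℤ
negative Sign.+ = 0ℤ
negative Sign.- = 1ℤ

-- An edge orientation is determined by its first mark, so orientations of the graph can be handled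
-- as functions into `Sign`.
orientation : ∀ s → Sign → EdgeOrientation s
orientation Sign.+ Sign.+ = 1→2
orientation Sign.+ Sign.- = 2→1
orientation Sign.- Sign.+ = sink
orientation Sign.- Sign.- = source

sgn-mark₁ : ∀ s t → sgn (mark₁ (orientation s t)) ≡ sgn t
sgn-mark₁ Sign.+ Sign.+ = refl
sgn-mark₁ Sign.+ Sign.- = refl
sgn-mark₁ Sign.- Sign.+ = refl
sgn-mark₁ Sign.- Sign.- = refl

sgn-mark₂ : ∀ s t → sgn (mark₂ (orientation s t)) ≡ - (sgn s * sgn t)
sgn-mark₂ Sign.+ Sign.+ = refl
sgn-mark₂ Sign.+ Sign.- = refl
sgn-mark₂ Sign.- Sign.+ = refl
sgn-mark₂ Sign.- Sign.- = refl

¬¬-minimum : {A : Set} (f : A → ℕ) → A → ¬ ¬ (∃[ x ] ∀ y → f x ℕ.≤ f y)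
¬¬-minimum {A} f a = <-rec (λ m → ∀ a → f a ≡ m → ¬ ¬ (∃[ x ] ∀ y → f x ℕ.≤ f y)) step (f a) a refl
  where
  step : ∀ m → (∀ {m′} → m′ ℕ.< m → ∀ a → f a ≡ m′ → ¬ ¬ (∃[ x ] ∀ y → f x ℕ.≤ f y)) →
    ∀ a → f a ≡ m → ¬ ¬ (∃[ x ] ∀ y → f x ℕ.≤ f y)
  step m rec a refl ¬min = ¬min (a , λ y → case f a ℕ.≤? f y of λ
    { (yes le) → le ; (no ¬le) → ⊥-elim (rec (ℕ.≰⇒> ¬le) y refl ¬min) })

square : ∀ {m} (f : Fin m → ℤ) → (∀ u → f u * f u ≡ 1ℤ) → ∀ u σ → σ ≡ f u * f u * σ
square f f² u σ = trans (sym (ℤ.*-identityˡ σ)) (cong (_* σ) (sym (f² u)))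

-- Here `f` is 1 or -1 at each vertex, negative where it is switched. If `x` is an end of the edge,
-- the square of `f x` cancels; otherwise both sides are 0.
switched-term : ∀ {m} (f : Fin m → ℤ) → (∀ u → f u * f u ≡ 1ℤ) → ∀ μ σ {u w x} (d₁ : Dec (u ≡ x)) (d₂ : Dec (w ≡ x)) →
  f u * μ * (𝟙 ⌊ d₁ ⌋ - σ * 𝟙 ⌊ d₂ ⌋) ≡ f x * (μ * (𝟙 ⌊ d₁ ⌋ - f u * f w * σ * 𝟙 ⌊ d₂ ⌋))
switched-term f f² μ σ {u} (yes refl) (yes refl) = trans
  (cong (λ r → f u * μ * (1ℤ - r * 1ℤ)) (square f f² u σ)) (lem (f u) μ σ)
  where
  lem : ∀ a m s → a * m * (1ℤ - a * a * s * 1ℤ) ≡ a * (m * (1ℤ - a * a * s * 1ℤ))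
  lem = solve-∀
switched-term f f² μ σ {u} {w} (yes refl) (no _) = lem (f u) μ σ (f w)
  where
  lem : ∀ a m s b → a * m * (1ℤ - s * 0ℤ) ≡ a * (m * (1ℤ - a * b * s * 0ℤ))
  lem = solve-∀
switched-term f f² μ σ {u} {w} (no _) (yes refl) = trans
  (cong (λ r → f u * μ * (0ℤ - r * 1ℤ)) (square f f² w σ)) (lem (f u) (f w) μ σ)
  where
  lem : ∀ a b m s → a * m * (0ℤ - b * b * s * 1ℤ) ≡ b * (m * (0ℤ - a * b * s * 1ℤ))
  lem = solve-∀
switched-term f f² μ σ {u} {w} {x} (no _) (no _) = lem (f u) (f x) μ σ (f w)
  where
  lem : ∀ a x m s b → a * m * (0ℤ - s * 0ℤ) ≡ x * (m * (0ℤ - a * b * s * 0ℤ))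
  lem = solve-∀

-- Excess and switching

module Excess (G : Graph) where
  open Graph G

  incidence : Signature → Edge → Vertex → ℤ
  incidence σ e x = 𝟙 ⌊ end₁ e ≟ x ⌋ - sgn (σ e) * 𝟙 ⌊ end₂ e ≟ x ⌋

  -- d⁺ − d⁻ for the orientation in which the first mark of e is μ e.
  excess : Signature → (Edge → Sign) → Vertex → ℤ
  excess σ μ x = sum λ e → sgn (μ e) * incidence σ e x

  Realizable : ℤ → Signature → (Vertex → ℤ) → Set
  Realizable q σ β = ∃[ μ ] ∀ x → ∃[ j ] excess σ μ x ≡ β x + q * j

  sign-at : Vertex → Vertex → Sign
  sign-at v u = if ⌊ u ≟ v ⌋ then Sign.- else Sign.+

  sgn² : ∀ s → sgn s * sgn s ≡ 1ℤ
  sgn² Sign.+ = refl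
  sgn² Sign.- = refl

  -- Switching at `v` while exchanging the two marks at all edge ends at `v` negates the excess at
  -- `v` and keeps it elsewhere, so the demand at `v` has to be negated too.
  switch-realizable : ∀ {q} σ v → (∀ β → Realizable q (switch σ v) β) → ∀ β → Realizable q σ β
  switch-realizable {q} σ v realize β = case realize (λ x → sgn (sign-at v x) * β x) of λ (μ , met) →
    (λ e → sign-at v (end₁ e) Sign.* μ e) , λ x → case met x of λ (j , eq) → sgn (sign-at v x) * j , (begin
      sum (λ e → sgn (sign-at v (end₁ e) Sign.* μ e) * incidence σ e x)
        ≡⟨ sum-cong-≗ (λ e → term x μ e) ⟩
      sum (λ e → sgn (sign-at v x) * (sgn (μ e) * incidence (switch σ v) e x))
        ≡⟨ sym (*-distribˡ-sum (sgn (sign-at v x)) (λ e → sgn (μ e) * incidence (switch σ v) e x)) ⟩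
      sgn (sign-at v x) * excess (switch σ v) μ x
        ≡⟨ cong (sgn (sign-at v x) *_) eq ⟩
      sgn (sign-at v x) * (sgn (sign-at v x) * β x + q * j)
        ≡⟨ lem (sgn (sign-at v x)) (β x) q j ⟩
      sgn (sign-at v x) * sgn (sign-at v x) * β x + q * (sgn (sign-at v x) * j)
        ≡⟨ cong (λ r → r * β x + q * (sgn (sign-at v x) * j)) (sgn² (sign-at v x)) ⟩
      1ℤ * β x + q * (sgn (sign-at v x) * j)
        ≡⟨ cong (λ r → r + q * (sgn (sign-at v x) * j)) (ℤ.*-identityˡ (β x)) ⟩
      β x + q * (sgn (sign-at v x) * j) ∎)
    where
    open ≡-Reasoning
    lem : ∀ s b q j → s * (s * b + q * j) ≡ s * s * b + q * (s * j)
    lem = solve-∀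
    term : ∀ x μ e → sgn (sign-at v (end₁ e) Sign.* μ e) * incidence σ e x
      ≡ sgn (sign-at v x) * (sgn (μ e) * incidence (switch σ v) e x)
    term x μ e = trans (cong (_* incidence σ e x) (sgn-* (sign-at v (end₁ e)) (μ e))) (trans
      (switched-term (sgn ∘ sign-at v) (sgn² ∘ sign-at v) (sgn (μ e)) (sgn (σ e)) (end₁ e ≟ x) (end₂ e ≟ x))
      (cong (λ r → sgn (sign-at v x) * (sgn (μ e) * (𝟙 ⌊ end₁ e ≟ x ⌋ - r * 𝟙 ⌊ end₂ e ≟ x ⌋)))
        (sym (trans (sgn-* (sign-at v (end₁ e) Sign.* sign-at v (end₂ e)) (σ e))
                    (cong (_* sgn (σ e)) (sgn-* (sign-at v (end₁ e)) (sign-at v (end₂ e))))))))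

  switches-realizable : ∀ {q} vs σ → (∀ β → Realizable q (foldl switch σ vs) β) → ∀ β → Realizable q σ β
  switches-realizable []       σ realize = realize
  switches-realizable {q} (v ∷ vs) σ realize = switch-realizable {q} σ v (switches-realizable {q} vs (switch σ v) realize)

  sign-of : List Vertex → Vertex → Sign
  sign-of []       u = Sign.+
  sign-of (v ∷ vs) u = sign-at v u Sign.* sign-of vs u

  sgn-switches : ∀ vs σ e → sgn (foldl switch σ vs e) ≡ sgn (sign-of vs (end₁ e)) * sgn (sign-of vs (end₂ e)) * sgn (σ e)
  sgn-switches []       σ e = sym (ℤ.*-identityˡ (sgn (σ e)))
  sgn-switches (v ∷ vs) σ e = trans (sgn-switches vs (switch σ v) e) (trans
    (cong (λ r → sgn (sign-of vs (end₁ e)) * sgn (sign-of vs (end₂ e)) * r)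
      (trans (sgn-* (sign-at v (end₁ e) Sign.* sign-at v (end₂ e)) (σ e)) (cong (_* sgn (σ e)) (sgn-* (sign-at v (end₁ e)) (sign-at v (end₂ e))))))
    (trans (lem (sgn (sign-of vs (end₁ e))) (sgn (sign-of vs (end₂ e))) (sgn (sign-at v (end₁ e))) (sgn (sign-at v (end₂ e))) (sgn (σ e)))
      (cong₂ (λ a b → a * b * sgn (σ e)) (sym (sgn-* (sign-at v (end₁ e)) (sign-of vs (end₁ e)))) (sym (sgn-* (sign-at v (end₂ e)) (sign-of vs (end₂ e)))))))
    where
    lem : ∀ a b c d s → a * b * (c * d * s) ≡ (c * a) * (d * b) * s
    lem = solve-∀

  negatives : ∀ σ → + negativeEdges σ ≡ sum (λ e → negative (σ e))
  negatives σ = trans (count-tabulate (λ e → σ e Sign.≟ Sign.-) (λ e → e)) (sum-cong-≗ λ e → eq (σ e))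
    where
    eq : ∀ s → 𝟙 (does (s Sign.≟ Sign.-)) ≡ negative s
    eq Sign.+ = refl
    eq Sign.- = refl

-- Switching a set of vertices, and its cut

members : ∀ {m} → (Fin m → Bool) → List (Fin m)
members {zero}  A = []
members {suc m} A = (if A zero then (λ xs → zero ∷ xs) else id) (List.map suc (members (A ∘ suc)))

module _ (G : Graph) where
  open Graph G
  open Excess G

  private
    -- A copy of `sign-of` for an arbitrary number of vertices, because the induction in
    -- `sign-members` removes vertices.
    sign-list : ∀ {m} → List (Fin m) → Fin m → Sign
    sign-list []       u = Sign.+
    sign-list (v ∷ vs) u = (if ⌊ u ≟ v ⌋ then Sign.- else Sign.+) Sign.* sign-list vs u

    sign-list-zero : ∀ {m} (vs : List (Fin m)) → sign-list (List.map suc vs) zero ≡ Sign.+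
    sign-list-zero []       = refl
    sign-list-zero (v ∷ vs) = sign-list-zero vs

    sign-list-suc : ∀ {m} (vs : List (Fin m)) u → sign-list (List.map suc vs) (suc u) ≡ sign-list vs u
    sign-list-suc []       u = refl
    sign-list-suc (v ∷ vs) u = cong₂ Sign._*_ eq (sign-list-suc vs u)
      where
      eq : (if ⌊ suc u ≟ suc v ⌋ then Sign.- else Sign.+) ≡ (if ⌊ u ≟ v ⌋ then Sign.- else Sign.+)
      eq with u ≟ v
      ... | yes _ = refl
      ... | no _  = refl

    sign-members : ∀ {m} (A : Fin m → Bool) u → sign-list (members A) u ≡ (if A u then Sign.- else Sign.+)
    sign-members {suc m} A zero with A zero
    ... | true  = cong Sign.opposite (sign-list-zero (members (A ∘ suc)))
    ... | false = sign-list-zero (members (A ∘ suc))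
    sign-members {suc m} A (suc u) with A zero
    ... | true  = trans (sign-list-suc (members (A ∘ suc)) u) (sign-members (A ∘ suc) u)
    ... | false = trans (sign-list-suc (members (A ∘ suc)) u) (sign-members (A ∘ suc) u)

    sign-of≡sign-list : ∀ vs u → sign-of vs u ≡ sign-list vs u
    sign-of≡sign-list []       u = refl
    sign-of≡sign-list (v ∷ vs) u = cong (sign-at v u Sign.*_) (sign-of≡sign-list vs u)

  crossing : (Vertex → Bool) → Edge → ℤ
  crossing A e = 𝟙 (A (end₁ e)) * (1ℤ - 𝟙 (A (end₂ e))) + (1ℤ - 𝟙 (A (end₁ e))) * 𝟙 (A (end₂ e))

  -- Switching at all members of `A` negates exactly the edges crossing `A`, and each of them
  -- changes the count by its old sign.
  negatives-switched : ∀ σ A → ∃[ vs ] (sum (λ e → negative (foldl switch σ vs e))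
    ≡ sum (λ e → negative (σ e)) + sum (λ e → crossing A e * sgn (σ e)))
  negatives-switched σ A = members A , trans (sum-cong-≗ term) (∑-distrib-+ (λ e → negative (σ e)) (λ e → crossing A e * sgn (σ e)))
    where
    bits : ∀ a b s t → sgn t ≡ sgn (if a then Sign.- else Sign.+) * sgn (if b then Sign.- else Sign.+) * sgn s →
      negative t ≡ negative s + (𝟙 a * (1ℤ - 𝟙 b) + (1ℤ - 𝟙 a) * 𝟙 b) * sgn s
    bits true  true  Sign.+ Sign.+ _ = refl
    bits true  true  Sign.- Sign.- _ = refl
    bits true  false Sign.+ Sign.- _ = refl
    bits true  false Sign.- Sign.+ _ = refl
    bits false true  Sign.+ Sign.- _ = refl
    bits false true  Sign.- Sign.+ _ = refl
    bits false false Sign.+ Sign.+ _ = refl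
    bits false false Sign.- Sign.- _ = refl
    term : ∀ e → negative (foldl switch σ (members A) e) ≡ negative (σ e) + crossing A e * sgn (σ e)
    term e = bits (A (end₁ e)) (A (end₂ e)) (σ e) (foldl switch σ (members A) e) (trans (sgn-switches (members A) σ e)
      (cong₂ (λ a b → sgn a * sgn b * sgn (σ e))
        (trans (sign-of≡sign-list (members A) (end₁ e)) (sign-members A (end₁ e)))
        (trans (sign-of≡sign-list (members A) (end₂ e)) (sign-members A (end₂ e)))))

  -- With the crossing edges as the removed set, a walk can never leave `A`.
  crossing-bound : ∀ {l} → EdgeConnected l → ∀ A {x z} → A x ≡ true → A z ≡ false → + l ≤ sum (crossing A)
  crossing-bound {l} connected A {x} {z} x∈ z∉ = case l ℕ.≤? ∣ F ∣ˢ of λ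
    { (yes l≤) → subst (+ l ≤_) size≡ (+≤+ l≤)
    ; (no l≰)  → ⊥-elim (true≢false (constant (connected F (ℕ.≰⇒> l≰) x z) x∈) z∉) }
    where
    crosses : Edge → Bool
    crosses e = A (end₁ e) xor A (end₂ e)
    F : Subset size
    F = tabulate crosses
    size≡ : + ∣ F ∣ˢ ≡ sum (crossing A)
    size≡ = trans (count-tabulate (_≟ᵇ true) crosses) (sum-cong-≗ λ e → bits (A (end₁ e)) (A (end₂ e)))
      where
      bits : ∀ a b → 𝟙 (does ((a xor b) ≟ᵇ true)) ≡ 𝟙 a * (1ℤ - 𝟙 b) + (1ℤ - 𝟙 a) * 𝟙 b
      bits true  true  = refl
      bits true  false = refl
      bits false true  = refl
      bits false false = refl
    uncut : ∀ e → e ∉ F → A (end₁ e) ≡ A (end₂ e)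
    uncut e e∉ = agree (A (end₁ e)) (A (end₂ e)) λ eq → e∉ (lookup⇒[]= e F (trans (lookup∘tabulate crosses e) eq))
      where
      agree : ∀ a b → ¬ (a xor b) ≡ true → a ≡ b
      agree true  true  _ = refl
      agree true  false h = ⊥-elim (h refl)
      agree false true  h = ⊥-elim (h refl)
      agree false false _ = refl
    constant : ∀ {u v} → Star (λ x y → ∃[ e ] (e ∉ F × Joins e x y)) u v → A u ≡ true → A v ≡ true
    constant ε u∈ = u∈
    constant ((e , e∉ , inj₁ (refl , refl)) ◅ rest) u∈ = constant rest (trans (sym (uncut e e∉)) u∈)
    constant ((e , e∉ , inj₂ (refl , refl)) ◅ rest) u∈ = constant rest (trans (uncut e e∉) u∈)

-- Orienting the positive edges

opaque
  unfolding S

  S-def : ∀ {m} (f : Darts ℤ m) → S f ≡ sum (λ e → f e true + f e false)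
  S-def f = refl

positive-part : Sign → ℤ
positive-part s = 1ℤ - negative s

sum-⟦⟧ : ∀ {m} (u : Fin m) → sum (λ x → 𝟙 ⌊ u ≟ x ⌋) ≡ 1ℤ
sum-⟦⟧ {suc m} zero    = cong (λ r → 1ℤ + r) (sum-zero {m} λ _ → refl)
sum-⟦⟧ {suc m} (suc u) = trans (ℤ.+-identityˡ _) (trans (sum-cong-≗ eq) (sum-⟦⟧ u))
  where
  eq : ∀ x → 𝟙 ⌊ suc u ≟ suc x ⌋ ≡ 𝟙 ⌊ u ≟ x ⌋
  eq x with u ≟ x
  ... | yes _ = refl
  ... | no _  = refl

sum-select : ∀ {m} (f : Fin m → ℤ) x → sum (λ y → 𝟙 (⟦ Fin.suc x ⟧ (suc y)) * f y) ≡ f x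
sum-select {suc m} f zero = trans (cong₂ _+_ (ℤ.*-identityˡ (f zero)) (sum-zero λ y → ℤ.*-zeroˡ (f (suc y)))) (ℤ.+-identityʳ (f zero))
sum-select {suc m} f (suc x) = trans (cong₂ _+_ (ℤ.*-zeroˡ (f zero)) (trans (sum-cong-≗ λ y → cong (_* f (suc y)) (eq y)) (sum-select (f ∘ suc) x))) (ℤ.+-identityˡ (f (suc x)))
  where
  eq : ∀ y → 𝟙 (⟦ Fin.suc (suc x) ⟧ (suc (suc y))) ≡ 𝟙 (⟦ Fin.suc x ⟧ (suc y))
  eq y with x ≟ y
  ... | yes _ = refl
  ... | no _  = refl

⟦suc⟧ : ∀ {m} (x u : Fin m) → 𝟙 (⟦ Fin.suc x ⟧ (suc u)) ≡ 𝟙 ⌊ u ≟ x ⌋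
⟦suc⟧ x u with x ≟ u | u ≟ x
... | yes _ | yes _ = refl
... | no _  | no _  = refl
... | yes p | no ¬p = ⊥-elim (¬p (sym p))
... | no ¬p | yes p = ⊥-elim (¬p (sym p))

choose-sign : ℤ → Sign
choose-sign y = if ⌊ y ℤ.≟ 0ℤ ⌋ then Sign.+ else Sign.-

sgn-choose : ∀ {y} → 0ℤ ≤ y → y ≤ 1ℤ → sgn (choose-sign y) ≡ 1ℤ - + 2 * y
sgn-choose {+ 0} _ _ = refl
sgn-choose {+ 1} _ _ = refl
sgn-choose {+ suc (suc _)} _ (+≤+ (s≤s ()))

-- K K c is a quarter of c modulo q, because (2K)² = (q + 1)² = 1 + q (q + 2).
quarter : ∀ K q c t s → + 2 * K ≡ q + 1ℤ → K * K * c ≡ t + s * q →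
  K * (+ 4 * t - c) ≡ q * (K * (c * (q + + 2) - + 4 * s))
quarter K q c t s eq eq′ = begin
  K * (+ 4 * t - c)                                       ≡⟨ lem₁ K q c t s ⟩
  K * (+ 4 * (t + s * q) - + 4 * (s * q) - c)             ≡⟨ cong (λ r → K * (+ 4 * r - + 4 * (s * q) - c)) (sym eq′) ⟩
  K * (+ 4 * (K * K * c) - + 4 * (s * q) - c)             ≡⟨ lem₂ K q c s ⟩
  K * ((+ 2 * K) * (+ 2 * K) * c - + 4 * (s * q) - c)     ≡⟨ cong (λ r → K * (r * r * c - + 4 * (s * q) - c)) eq ⟩
  K * ((q + 1ℤ) * (q + 1ℤ) * c - + 4 * (s * q) - c)       ≡⟨ lem₃ K q c s ⟩
  q * (K * (c * (q + + 2) - + 4 * s))                     ∎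
  where
  open ≡-Reasoning
  lem₁ : ∀ K q c t s → K * (+ 4 * t - c) ≡ K * (+ 4 * (t + s * q) - + 4 * (s * q) - c)
  lem₁ = solve-∀
  lem₂ : ∀ K q c s → K * (+ 4 * (K * K * c) - + 4 * (s * q) - c) ≡ K * ((+ 2 * K) * (+ 2 * K) * c - + 4 * (s * q) - c)
  lem₂ = solve-∀
  lem₃ : ∀ K q c s → K * ((q + 1ℤ) * (q + 1ℤ) * c - + 4 * (s * q) - c) ≡ q * (K * (c * (q + + 2) - + 4 * s))
  lem₃ = solve-∀

-- K is the inverse of 2 modulo q.
module Core (p q K : ℤ) (1≤p : 1ℤ ≤ p) (q≡1+p : q ≡ 1ℤ + p) (2K≡q+1 : + 2 * K ≡ q + 1ℤ)
  (Q : ℕ) {{_ : ℕ.NonZero Q}} (q≡Q : q ≡ + Q) (G : Graph)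
  where
  open Graph G
  open Excess G
  open Networks order p q 1≤p q≡1+p hiding (size)

  module _ (σ : Signature)
    (many : q ≤ sum (λ e → negative (σ e)))
    (cuts : ∀ A {x z} → A x ≡ true → A z ≡ false → + 3 * p ≤ sum (λ e → crossing G A e * positive-part (σ e)))
    (β : Vertex → ℤ)
    where

    M B x₀ : ℤ
    M = sum (λ e → negative (σ e))
    B = sum β
    -- With t source edges the demands of the positive edges sum to K (4t - (2M - B)), so t has to
    -- be a quarter of 2M - B modulo q.
    x₀ = K * K * (+ 2 * M - B)

    t : ℕ
    t = x₀ %ℕ Q

    s : ℤ
    s = x₀ /ℕ Q

    x₀≡ : x₀ ≡ + t + s * q
    x₀≡ = trans (a≡a%ℕn+[a/ℕn]*n x₀ Q) (cong (λ r → + t + s * r) (sym q≡Q))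

    -- This is what unbalancedness is for: any residue below q must be available as a number of
    -- source edges.
    t≤M : + t ≤ M
    t≤M = ℤ.≤-trans (ℤ.≤-trans (+≤+ (ℕ.<⇒≤ (n%ℕd<d x₀ Q))) (ℤ.≤-reflexive (sym q≡Q))) many

    0≤negative : ∀ σ → 0ℤ ≤ negative σ
    0≤negative Sign.+ = +≤+ z≤n
    0≤negative Sign.- = +≤+ z≤n

    0≤positive : ∀ σ → 0ℤ ≤ positive-part σ
    0≤positive Sign.+ = +≤+ z≤n
    0≤positive Sign.- = +≤+ z≤n

    -- The negative edges on which h is 1 become source edges, the others sink edges.
    record Choice : Set where
      field
        h : Edge → ℤ
        0≤h : ∀ e → 0ℤ ≤ h e
        h≤ : ∀ e → h e ≤ negative (σ e)
        Σh : sum h ≡ + t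

    choice : Choice
    choice = record
      { h = λ e → h e true ; 0≤h = λ e → proj₁ (bounds e true) ; h≤ = λ e → proj₂ (bounds e true)
      ; Σh = trans (sum-cong-≗ λ e → trans (sym (ℤ.+-identityʳ (h e true))) (cong (λ r → h e true + r) (sym (ℤ.≤-antisym (proj₂ (bounds e false)) (proj₁ (bounds e false))))))
                   (trans (sym (S-def h)) Sh) }
      where
      -- `distribute` works on darts, so the second dart of each edge gets the bound 0.
      f : Darts ℤ size
      f e true  = negative (σ e)
      f e false = 0ℤ
      0≤f : ∀ e b → 0ℤ ≤ f e b
      0≤f e true  = 0≤negative (σ e)
      0≤f e false = +≤+ z≤n
      Sf : S f ≡ M
      Sf = trans (S-def f) (sum-cong-≗ λ e → ℤ.+-identityʳ (negative (σ e)))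
      d = distribute f 0≤f (+ t) (+≤+ z≤n) (subst (+ t ≤_) (sym Sf) t≤M)
      h : Darts ℤ size
      h = proj₁ d
      bounds = proj₁ (proj₂ d)
      Sh = proj₂ (proj₂ d)

    open Choice choice

    h-negative : ∀ e → h e * negative (σ e) ≡ h e
    h-negative e with σ e | 0≤h e | h≤ e
    ... | Sign.- | _  | _  = ℤ.*-identityʳ (h e)
    ... | Sign.+ | lo | hi = trans (ℤ.*-zeroʳ (h e)) (ℤ.≤-antisym lo hi)

    -- `initial` is the excess when all positive edges lead from their first to their second end. A
    -- reversal changes an excess by 2, so the number of reversals is the deficit times K, the
    -- inverse of 2.
    initial r : Vertex → ℤ
    initial x = sum λ e → (1ℤ - + 2 * h e) * incidence σ e x
    r x = K * (β x - initial x)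

    Σincidence : ∀ e → sum (incidence σ e) ≡ + 2 * negative (σ e)
    Σincidence e = begin
      sum (λ x → 𝟙 ⌊ end₁ e ≟ x ⌋ - sgn (σ e) * 𝟙 ⌊ end₂ e ≟ x ⌋)
        ≡⟨ sum-cong-≗ (λ x → lem (𝟙 ⌊ end₁ e ≟ x ⌋) (sgn (σ e)) (𝟙 ⌊ end₂ e ≟ x ⌋)) ⟩
      sum (λ x → 𝟙 ⌊ end₁ e ≟ x ⌋ + - sgn (σ e) * 𝟙 ⌊ end₂ e ≟ x ⌋)
        ≡⟨ sum-linear (λ x → 𝟙 ⌊ end₁ e ≟ x ⌋) (λ x → 𝟙 ⌊ end₂ e ≟ x ⌋) (- sgn (σ e)) ⟩
      sum (λ x → 𝟙 ⌊ end₁ e ≟ x ⌋) + - sgn (σ e) * sum (λ x → 𝟙 ⌊ end₂ e ≟ x ⌋)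
        ≡⟨ cong₂ (λ a b → a + - sgn (σ e) * b) (sum-⟦⟧ (end₁ e)) (sum-⟦⟧ (end₂ e)) ⟩
      1ℤ + - sgn (σ e) * 1ℤ
        ≡⟨ two (σ e) ⟩
      + 2 * negative (σ e) ∎
      where
      open ≡-Reasoning
      lem : ∀ a s b → a - s * b ≡ a + - s * b
      lem = solve-∀
      two : ∀ s → 1ℤ + - sgn s * 1ℤ ≡ + 2 * negative s
      two Sign.+ = refl
      two Sign.- = refl

    Σinitial : sum initial ≡ + 2 * M - + 4 * + t
    Σinitial = begin
      sum initial
        ≡⟨ ∑-comm (λ x e → (1ℤ - + 2 * h e) * incidence σ e x) ⟩
      sum (λ e → sum (λ x → (1ℤ - + 2 * h e) * incidence σ e x))
        ≡⟨ sum-cong-≗ (λ e → trans (sym (*-distribˡ-sum (1ℤ - + 2 * h e) (incidence σ e))) (cong ((1ℤ - + 2 * h e) *_) (Σincidence e))) ⟩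
      sum (λ e → (1ℤ - + 2 * h e) * (+ 2 * negative (σ e)))
        ≡⟨ sum-cong-≗ (λ e → trans (lem (h e) (negative (σ e))) (cong (λ y → + 2 * negative (σ e) + - + 4 * y) (h-negative e))) ⟩
      sum (λ e → + 2 * negative (σ e) + - + 4 * h e)
        ≡⟨ sum-linear (λ e → + 2 * negative (σ e)) h (- + 4) ⟩
      sum (λ e → + 2 * negative (σ e)) + - + 4 * sum h
        ≡⟨ cong₂ (λ a b → a + - + 4 * b) (sym (*-distribˡ-sum (+ 2) (λ e → negative (σ e)))) Σh ⟩
      + 2 * M + - + 4 * + t
        ≡⟨ lem′ (+ 2 * M) (+ t) ⟩
      + 2 * M - + 4 * + t ∎
      where
      open ≡-Reasoning
      lem : ∀ h n → (1ℤ - + 2 * h) * (+ 2 * n) ≡ + 2 * n + - + 4 * (h * n)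
      lem = solve-∀
      lem′ : ∀ a t → a + - + 4 * t ≡ a - + 4 * t
      lem′ = solve-∀

    Σr : ∃[ j ] sum r ≡ q * j
    Σr = K * ((+ 2 * M - B) * (q + + 2) - + 4 * s) , (begin
      sum r                                       ≡⟨ sym (*-distribˡ-sum K (λ x → β x - initial x)) ⟩
      K * sum (λ x → β x - initial x)
        ≡⟨ cong (K *_) (trans (sum-cong-≗ λ x → lem (β x) (initial x)) (sum-linear β initial (- 1ℤ))) ⟩
      K * (B + - 1ℤ * sum initial)                ≡⟨ cong (λ y → K * (B + - 1ℤ * y)) Σinitial ⟩
      K * (B + - 1ℤ * (+ 2 * M - + 4 * + t))      ≡⟨ lem′ K B M (+ t) ⟩
      K * (+ 4 * + t - (+ 2 * M - B))             ≡⟨ quarter K q (+ 2 * M - B) (+ t) s 2K≡q+1 x₀≡ ⟩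
      q * (K * ((+ 2 * M - B) * (q + + 2) - + 4 * s)) ∎)
      where
      open ≡-Reasoning
      lem : ∀ a b → a - b ≡ a + - 1ℤ * b
      lem = solve-∀
      lem′ : ∀ K B M t → K * (B + - 1ℤ * (+ 2 * M - + 4 * t)) ≡ K * (+ 4 * t - (+ 2 * M - B))
      lem′ = solve-∀

    -- The first edges are loops, one at each vertex, which carry the demands.
    private
      ends : Vertex ⊎ Edge → Bool → Fin (suc order)
      ends (inj₁ x) _     = suc x
      ends (inj₂ e) true  = suc (end₁ e)
      ends (inj₂ e) false = suc (end₂ e)
      caps dems : Vertex ⊎ Edge → Bool → ℤ
      caps (inj₁ x) _     = 0ℤ
      caps (inj₂ e) true  = positive-part (σ e)
      caps (inj₂ e) false = 0ℤ
      dems (inj₁ x) true  = r x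
      dems (inj₁ x) false = 0ℤ
      dems (inj₂ e) _     = 0ℤ

    -- Negative edges are kept with capacity 0. No edge ends at `zero`, so z₀ is isolated and `Root`
    -- holds trivially.
    positives : Network
    positives = record
      { size = order ℕ.+ size
      ; end = λ i → ends (splitAt order i) ; cap = λ i → caps (splitAt order i) ; dem = λ i → dems (splitAt order i)
      ; active = λ { zero → false ; (suc _) → true } }

    opaque
      unfolding cut S

      cut-split : ∀ {w} f X → cut w (end positives) f X ≡
        sum (λ x → w (X (suc x)) (X (suc x)) * (f (x ↑ˡ size) true + f (x ↑ˡ size) false))
        + sum (λ e → w (X (suc (end₁ e))) (X (suc (end₂ e))) * f (order ↑ʳ e) true
                   + w (X (suc (end₂ e))) (X (suc (end₁ e))) * f (order ↑ʳ e) false)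
      cut-split {w} f X = trans (S-++ order (λ i b → w (X (end positives i b)) (X (end positives i (not b))) * f i b))
        (cong₂ _+_ (sum-cong-≗ loop) (sum-cong-≗ edge))
        where
        loop : ∀ x → w (X (end positives (x ↑ˡ size) true)) (X (end positives (x ↑ˡ size) false)) * f (x ↑ˡ size) true
          + w (X (end positives (x ↑ˡ size) false)) (X (end positives (x ↑ˡ size) true)) * f (x ↑ˡ size) false
          ≡ w (X (suc x)) (X (suc x)) * (f (x ↑ˡ size) true + f (x ↑ˡ size) false)
        loop x rewrite splitAt-↑ˡ order x size = sym (ℤ.*-distribˡ-+ (w (X (suc x)) (X (suc x))) _ _)
        edge : ∀ e → w (X (end positives (order ↑ʳ e) true)) (X (end positives (order ↑ʳ e) false)) * f (order ↑ʳ e) true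
          + w (X (end positives (order ↑ʳ e) false)) (X (end positives (order ↑ʳ e) true)) * f (order ↑ʳ e) false
          ≡ w (X (suc (end₁ e))) (X (suc (end₂ e))) * f (order ↑ʳ e) true + w (X (suc (end₂ e))) (X (suc (end₁ e))) * f (order ↑ʳ e) false
        edge e rewrite splitAt-↑ʳ order size e = refl

    cut-caps : ∀ {w} X → cut w (end positives) (cap positives) X ≡ sum (λ e → w (X (suc (end₁ e))) (X (suc (end₂ e))) * positive-part (σ e))
    cut-caps {w} X = trans (cut-split (cap positives) X) (trans (cong₂ _+_ (sum-zero loop) (sum-cong-≗ edge)) (ℤ.+-identityˡ _))
      where
      loop : ∀ x → w (X (suc x)) (X (suc x)) * (cap positives (x ↑ˡ size) true + cap positives (x ↑ˡ size) false) ≡ 0ℤ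
      loop x rewrite splitAt-↑ˡ order x size = ℤ.*-zeroʳ (w (X (suc x)) (X (suc x)))
      lem : ∀ a b c → a * c + b * 0ℤ ≡ a * c
      lem = solve-∀
      edge : ∀ e → w (X (suc (end₁ e))) (X (suc (end₂ e))) * cap positives (order ↑ʳ e) true
        + w (X (suc (end₂ e))) (X (suc (end₁ e))) * cap positives (order ↑ʳ e) false
        ≡ w (X (suc (end₁ e))) (X (suc (end₂ e))) * positive-part (σ e)
      edge e rewrite splitAt-↑ʳ order size e = lem (w (X (suc (end₁ e))) (X (suc (end₂ e)))) (w (X (suc (end₂ e))) (X (suc (end₁ e)))) (positive-part (σ e))

    net-split : ∀ g X → net (end positives) (dem positives +ᵈ g) X ≡
      sum (λ x → X (suc x) * (r x + (g (x ↑ˡ size) true + g (x ↑ˡ size) false)))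
      + sum (λ e → X (suc (end₁ e)) * g (order ↑ʳ e) true + X (suc (end₂ e)) * g (order ↑ʳ e) false)
    net-split g X = trans (cut-split (dem positives +ᵈ g) X) (cong₂ _+_ (sum-cong-≗ loop) (sum-cong-≗ edge))
      where
      lem : ∀ r a b → r + a + (0ℤ + b) ≡ r + (a + b)
      lem = solve-∀
      loop : ∀ x → X (suc x) * (dem positives (x ↑ˡ size) true + g (x ↑ˡ size) true + (dem positives (x ↑ˡ size) false + g (x ↑ˡ size) false))
        ≡ X (suc x) * (r x + (g (x ↑ˡ size) true + g (x ↑ˡ size) false))
      loop x rewrite splitAt-↑ˡ order x size = cong (X (suc x) *_) (lem (r x) (g (x ↑ˡ size) true) (g (x ↑ˡ size) false))
      edge : ∀ e → X (suc (end₁ e)) * (dem positives (order ↑ʳ e) true + g (order ↑ʳ e) true)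
        + X (suc (end₂ e)) * (dem positives (order ↑ʳ e) false + g (order ↑ʳ e) false)
        ≡ X (suc (end₁ e)) * g (order ↑ʳ e) true + X (suc (end₂ e)) * g (order ↑ʳ e) false
      edge e rewrite splitAt-↑ʳ order size e = cong₂ (λ a b → X (suc (end₁ e)) * a + X (suc (end₂ e)) * b) (ℤ.+-identityˡ _) (ℤ.+-identityˡ _)

    positives-valid : Valid positives zero
    positives-valid = record
      { 0≤cap    = λ i → 0≤caps (splitAt order i)
      ; inactive = refl
      ; total    = proj₁ Σr , trans (trans (cut-≗ (end positives) X₁ λ i b → sym (ℤ.+-identityʳ (dem positives i b))) (net-split (λ _ _ → 0ℤ) X₁))
          (trans (cong₂ _+_ (sum-cong-≗ λ x → lem₁ (r x)) (sum-zero {size} λ _ → refl)) (trans (ℤ.+-identityʳ (sum r)) (proj₂ Σr)))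
      ; root     = subst₂ Root
          (sym (trans (cut-caps X₁) (sum-zero λ e → ℤ.*-zeroˡ (positive-part (σ e)))))
          (sym (trans (cut-caps X₁) (sum-zero λ e → ℤ.*-zeroˡ (positive-part (σ e)))))
          (inj₁ (0≤p , 0≤p ⊕ 0≤q))
      ; good     = λ { {A} (proper A⊆ {x} x∈ x≢ {z} z∈ z∉) ¬w → ¬w (window A (split A x x∈ (A⊆ x x∈) z z∈ z∉)) }
      ; balanced = λ ()
      }
      where
      X₁ : Fin (suc order) → ℤ
      X₁ = 𝟙 ∘ active positives
      0≤p : 0ℤ ≤ p
      0≤p = ℤ.≤-trans (+≤+ z≤n) 1≤p
      lem₁ : ∀ r → 1ℤ * (r + (0ℤ + 0ℤ)) ≡ r
      lem₁ = solve-∀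
      0≤caps : ∀ i b → 0ℤ ≤ caps i b
      0≤caps (inj₁ _) _     = +≤+ z≤n
      0≤caps (inj₂ e) true  = 0≤positive (σ e)
      0≤caps (inj₂ e) false = +≤+ z≤n
      total-cut : ∀ A → L positives A + U positives A ≡ sum (λ e → crossing G (A ∘ suc) e * positive-part (σ e))
      total-cut A = trans (lem (demand positives A) (leaving positives A) (entering positives A))
        (trans (cong₂ _+_ (cut-caps (𝟙 ∘ A)) (cut-caps (𝟙 ∘ A)))
          (trans (sym (∑-distrib-+ (λ e → 𝟙 (A (suc (end₁ e))) * (1ℤ - 𝟙 (A (suc (end₂ e)))) * positive-part (σ e)) _))
            (sum-cong-≗ λ e → sym (ℤ.*-distribʳ-+ (positive-part (σ e)) (𝟙 (A (suc (end₁ e))) * (1ℤ - 𝟙 (A (suc (end₂ e))))) _))))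
        where
        lem : ∀ d o i → d + o + (i - d) ≡ o + i
        lem = solve-∀
      split : ∀ A x → A x ≡ true → active positives x ≡ true → ∀ z → active positives z ≡ true → A z ≡ false →
        + 3 * p ≤ L positives A + U positives A
      split A zero    x∈ () z z∈ z∉
      split A (suc x) x∈ _ zero () z∉
      split A (suc x) x∈ _ (suc z) z∈ z∉ = subst (+ 3 * p ≤_) (sym (total-cut A)) (cuts (A ∘ suc) x∈ z∉)
      -- The multiple of q is chosen such that L exceeds p + q j by a remainder of at most p; as L +
      -- U is at least 3p, this leaves at least p for U + q j.
      window : ∀ A → + 3 * p ≤ L positives A + U positives A → Within p p (L positives A) (U positives A)
      window A 3p≤ = within (y /ℕ Q)
        (by-gap (+≤+ {n = y %ℕ Q} z≤n ⊕ gap (ℤ.≤-reflexive (sym y≡))) (lem₂ p q l (+ (y %ℕ Q)) (y /ℕ Q)))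
        (by-gap (gap 3p≤ ⊕ gap (ℤ.≤-reflexive y≡) ⊕ gap r≤p) (lem₃ p q l (U positives A) (+ (y %ℕ Q)) (y /ℕ Q)))
        where
        l y : ℤ
        l = L positives A
        y = l - p
        y≡ : y ≡ + (y %ℕ Q) + (y /ℕ Q) * q
        y≡ = trans (a≡a%ℕn+[a/ℕn]*n y Q) (cong (λ r → + (y %ℕ Q) + (y /ℕ Q) * r) (sym q≡Q))
        r≤p : + (y %ℕ Q) ≤ p
        r≤p = by-gap (gap (ℤ.≤-trans (ℤ.i<j⇒suc[i]≤j (+<+ (n%ℕd<d y Q))) (ℤ.≤-reflexive (trans (sym q≡Q) q≡1+p)))) (lem (+ (y %ℕ Q)) p)
          where
          lem : ∀ r p → 1ℤ + p - (1ℤ + r) ≡ p - r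
          lem = solve-∀
        lem₂ : ∀ p q l r j → r + (l - p - (r + j * q)) ≡ l - (p + q * j)
        lem₂ = solve-∀
        lem₃ : ∀ p q l u r j → l + u - + 3 * p + (r + j * q - (l - p)) + (p - r) ≡ u + q * j - p
        lem₃ = solve-∀

    -- The flow `a` lives on positive edges and `h` on negative ones, so a + h is 0 or 1 on every
    -- edge and determines the first mark.
    realized : Solution positives → Realizable q σ β
    realized sol = (λ e → choose-sign (a e + h e)) , met
      where
      open Solution sol
      a : Edge → ℤ
      a e = flow (order ↑ʳ e) true
      a-false : ∀ e → flow (order ↑ʳ e) false ≡ - a e
      a-false e = anti (order ↑ʳ e)
      a≤ : ∀ e → a e ≤ positive-part (σ e)
      a≤ e = subst (λ i → a e ≤ caps i true) (splitAt-↑ʳ order size e) (≤cap (order ↑ʳ e) true)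
      0≤a : ∀ e → 0ℤ ≤ a e
      0≤a e = by-gap (gap (subst₂ _≤_ (a-false e) (cong (λ i → caps i false) (splitAt-↑ʳ order size e)) (≤cap (order ↑ʳ e) false))) (lem (a e))
        where
        lem : ∀ a → 0ℤ - - a ≡ a - 0ℤ
        lem = solve-∀
      a+h≤1 : ∀ e → a e + h e ≤ 1ℤ
      a+h≤1 e = by-gap (gap (a≤ e) ⊕ gap (h≤ e)) (lem (a e) (h e) (negative (σ e)))
        where
        lem : ∀ a h n → 1ℤ - n - a + (n - h) ≡ 1ℤ - (a + h)
        lem = solve-∀
      met : ∀ x → ∃[ j ] excess σ (λ e → choose-sign (a e + h e)) x ≡ β x + q * j
      met x = case meets {⟦ suc x ⟧} (λ { zero () ; (suc _) _ → refl }) of λ (j , eq) → β x - initial x - + 2 * j , (begin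
        excess σ (λ e → choose-sign (a e + h e)) x
          ≡⟨ sum-cong-≗ (λ e → trans (cong (_* incidence σ e x) (sgn-choose (0≤a e ⊕ 0≤h e) (a+h≤1 e))) (lem₁ (a e) (h e) (incidence σ e x))) ⟩
        sum (λ e → (1ℤ - + 2 * h e) * incidence σ e x + - + 2 * (a e * incidence σ e x))
          ≡⟨ sum-linear (λ e → (1ℤ - + 2 * h e) * incidence σ e x) (λ e → a e * incidence σ e x) (- + 2) ⟩
        initial x + - + 2 * sum (λ e → a e * incidence σ e x)
          ≡⟨ cong (λ y → initial x + - + 2 * y) (routed j eq) ⟩
        initial x + - + 2 * (q * j - r x)
          ≡⟨ lem₂ (initial x) q j K (β x) ⟩
        initial x + (+ 2 * K) * (β x - initial x) + - + 2 * (q * j)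
          ≡⟨ cong (λ y → initial x + y * (β x - initial x) + - + 2 * (q * j)) 2K≡q+1 ⟩
        initial x + (q + 1ℤ) * (β x - initial x) + - + 2 * (q * j)
          ≡⟨ lem₃ (initial x) q j (β x) ⟩
        β x + q * (β x - initial x - + 2 * j) ∎)
        where
        open ≡-Reasoning
        lem₁ : ∀ a h w → (1ℤ - + 2 * (a + h)) * w ≡ (1ℤ - + 2 * h) * w + - + 2 * (a * w)
        lem₁ = solve-∀
        lem₂ : ∀ i q j K b → i + - + 2 * (q * j - K * (b - i)) ≡ i + (+ 2 * K) * (b - i) + - + 2 * (q * j)
        lem₂ = solve-∀
        lem₃ : ∀ i q j b → i + (q + 1ℤ) * (b - i) + - + 2 * (q * j) ≡ b + q * (b - i - + 2 * j)
        lem₃ = solve-∀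
        term : ∀ e → 𝟙 (⟦ suc x ⟧ (suc (end₁ e))) * a e + 𝟙 (⟦ suc x ⟧ (suc (end₂ e))) * flow (order ↑ʳ e) false ≡ a e * incidence σ e x
        term e = trans (cong₂ (λ u w → u * a e + w) (⟦suc⟧ x (end₁ e)) (cong₂ _*_ (⟦suc⟧ x (end₂ e)) (a-false e)))
          (sign (σ e) (a e) (0≤a e) (a≤ e) (𝟙 ⌊ end₁ e ≟ x ⌋) (𝟙 ⌊ end₂ e ≟ x ⌋))
          where
          lem : ∀ a u w → u * a + w * - a ≡ a * (u - 1ℤ * w)
          lem = solve-∀
          lem′ : ∀ u w → u * 0ℤ + w * 0ℤ ≡ 0ℤ
          lem′ = solve-∀
          sign : ∀ s a → 0ℤ ≤ a → a ≤ positive-part s → ∀ u w → u * a + w * - a ≡ a * (u - sgn s * w)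
          sign Sign.+ a _ _ u w = lem a u w
          sign Sign.- a lo hi u w with ℤ.≤-antisym hi lo
          ... | refl = trans (lem′ u w) (sym (ℤ.*-zeroˡ (u - -1ℤ * w)))
        routed : ∀ j → net (end positives) (dem positives +ᵈ flow) (𝟙 ∘ ⟦ suc x ⟧) ≡ q * j →
          sum (λ e → a e * incidence σ e x) ≡ q * j - r x
        routed j eq = begin
          sum (λ e → a e * incidence σ e x)                ≡⟨ lem (sum (λ e → a e * incidence σ e x)) (r x) ⟩
          r x + sum (λ e → a e * incidence σ e x) - r x    ≡⟨ cong (_- r x) (sym split) ⟩
          net (end positives) (dem positives +ᵈ flow) (𝟙 ∘ ⟦ suc x ⟧) - r x ≡⟨ cong (_- r x) eq ⟩
          q * j - r x                                      ∎
          where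
          lem : ∀ s r → s ≡ r + s - r
          lem = solve-∀
          split : net (end positives) (dem positives +ᵈ flow) (𝟙 ∘ ⟦ suc x ⟧) ≡ r x + sum (λ e → a e * incidence σ e x)
          split = trans (net-split flow (𝟙 ∘ ⟦ suc x ⟧)) (cong₂ _+_
            (trans (sum-cong-≗ λ y → cong (λ z → 𝟙 (⟦ suc x ⟧ (suc y)) * z) (trans (cong (λ z → r y + z) (cancel y)) (ℤ.+-identityʳ (r y)))) (sum-select r x))
            (sum-cong-≗ term))
            where
            cancel : ∀ y → flow (y ↑ˡ size) true + flow (y ↑ˡ size) false ≡ 0ℤ
            cancel y = trans (cong (λ z → flow (y ↑ˡ size) true + z) (anti (y ↑ˡ size))) (ℤ.+-inverseʳ (flow (y ↑ˡ size) true))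

    realizable : ¬ ¬ Realizable q σ β
    realizable ¬real = solve positives zero positives-valid (¬real ∘ realized)

-- The first argument takes the place of function extensionality: the search meets every function
-- only up to pointwise equality.
any-sign? : ∀ {m} {P : (Fin m → Sign) → Set} → (∀ {f g} → (∀ i → f i ≡ g i) → P f → P g) →
  (∀ f → Dec (P f)) → Dec (∃[ f ] P f)
any-sign? {zero} resp P? with P? (λ ())
... | yes p = yes ((λ ()) , p)
... | no ¬p = no λ (f , p) → ¬p (resp (λ ()) p)
any-sign? {suc m} {P} resp P? = decide (tail? Sign.+) (tail? Sign.-)
  where
  _▹_ : Sign → (Fin m → Sign) → Fin (suc m) → Sign
  (s ▹ f) zero    = s
  (s ▹ f) (suc i) = f i
  tail? : ∀ s → Dec (∃[ f ] P (s ▹ f))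
  tail? s = any-sign? (λ eq → resp λ { zero → refl ; (suc i) → eq i }) (λ f → P? (s ▹ f))
  decide : Dec (∃[ f ] P (Sign.+ ▹ f)) → Dec (∃[ f ] P (Sign.- ▹ f)) → Dec (∃[ f ] P f)
  decide (yes (f , p)) _ = yes (_ , p)
  decide _ (yes (f , p)) = yes (_ , p)
  decide (no ¬p) (no ¬p′) = no λ (f , p) → absurd f (f zero) refl p
    where
    absurd : ∀ f s → f zero ≡ s → ¬ P f
    absurd f Sign.+ eq p = ¬p (f ∘ suc , resp (λ { zero → eq ; (suc i) → refl }) p)
    absurd f Sign.- eq p = ¬p′ (f ∘ suc , resp (λ { zero → eq ; (suc i) → refl }) p)

module _ (G : Graph) where
  open Graph G
  open Excess G

  realizable? : ∀ q σ β → Dec (Realizable q σ β)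
  realizable? q σ β = any-sign?
    (λ eq met x → case met x of λ (j , eq′) → j , trans (sum-cong-≗ λ e → cong (λ s → sgn s * incidence σ e x) (sym (eq e))) eq′)
    (λ μ → all? λ x → map′
      (λ (Signed.divides j eq) → j , trans (lem (excess σ μ x) (β x)) (trans (cong (λ r → β x + r) eq) (cong (λ r → β x + r) (ℤ.*-comm j q))))
      (λ (j , eq) → Signed.divides j (trans (cong (_- β x) eq) (lem′ (β x) q j)))
      (q Signed.∣? (excess σ μ x - β x)))
    where
    lem : ∀ a b → a ≡ b + (a - b)
    lem = solve-∀
    lem′ : ∀ b q j → b + q * j - b ≡ j * q
    lem′ = solve-∀

  -- Switching `A` after `vs` is again a list of switchings, so by minimality the resulting change
  -- in the number of negative edges is not negative.
  minimal-cut : ∀ σ vs → (∀ ws → negativeEdges (foldl switch σ vs) ℕ.≤ negativeEdges (foldl switch σ ws)) →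
    ∀ A → 0ℤ ≤ sum (λ e → crossing G A e * sgn (foldl switch σ vs e))
  minimal-cut σ vs minimal A = case negatives-switched G (foldl switch σ vs) A of λ (ws , eq) →
    by-gap (gap (subst₂ _≤_ (negatives (foldl switch σ vs))
        (trans (cong (+_ ∘ negativeEdges) (foldl-++ switch σ vs ws)) (trans (negatives (foldl switch (foldl switch σ vs) ws)) eq))
        (+≤+ (minimal (vs List.++ ws)))))
      (lem (sum (λ e → negative (foldl switch σ vs e))) _)
    where
    lem : ∀ a b → a + b - a ≡ b - 0ℤ
    lem = solve-∀

  -- Twice the number of positive crossing edges is C + T, hence at least 6p - 1; being even, it is
  -- at least 6p.
  positive-cut : ∀ (σ : Signature) A l p → + 6 * p ≤ 1ℤ + l → l ≤ sum (crossing G A) → 0ℤ ≤ sum (λ e → crossing G A e * sgn (σ e)) →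
    + 3 * p ≤ sum (λ e → crossing G A e * positive-part (σ e))
  positive-cut σ A l p 6p≤ l≤ 0≤ = case + 3 * p ℤ.≤? P of λ
    { (yes h) → h
    ; (no ¬h) → ⊥-elim (absurd-gap
        (gap (≰⇒1+≤ ¬h) ⊕ gap (≰⇒1+≤ ¬h) ⊕ gap 6p≤ ⊕ gap l≤ ⊕ 0≤ ⊕ gap (ℤ.≤-reflexive double) ⊕ +≤+ {n = 0} z≤n)
        (lem p l P C T)) }
    where
    P C T : ℤ
    P = sum (λ e → crossing G A e * positive-part (σ e))
    C = sum (crossing G A)
    T = sum (λ e → crossing G A e * sgn (σ e))
    double : C + 1ℤ * T ≡ + 2 * P
    double = trans (sym (sum-linear (crossing G A) (λ e → crossing G A e * sgn (σ e)) 1ℤ)) (trans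
      (sum-cong-≗ λ e → sign (crossing G A e) (σ e)) (sym (*-distribˡ-sum (+ 2) (λ e → crossing G A e * positive-part (σ e)))))
      where
      sign : ∀ c s → c + 1ℤ * (c * sgn s) ≡ + 2 * (c * positive-part s)
      sign c Sign.+ = lem′ c
        where
        lem′ : ∀ c → c + 1ℤ * (c * 1ℤ) ≡ + 2 * (c * 1ℤ)
        lem′ = solve-∀
      sign c Sign.- = lem′ c
        where
        lem′ : ∀ c → c + 1ℤ * (c * -1ℤ) ≡ + 2 * (c * 0ℤ)
        lem′ = solve-∀
    lem : ∀ p l P C T → + 3 * p - (1ℤ + P) + (+ 3 * p - (1ℤ + P)) + (1ℤ + l - + 6 * p) + (C - l) + T + (+ 2 * P - (C + 1ℤ * T)) + 0ℤ ≡ -1ℤ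
    lem = solve-∀

-- From marks back to orientations

open SignedGraph

module _ (G : SignedGraph) where
  open Excess (graph G)

  degree-difference : ∀ μ x → let τ = λ e → orientation (σ G e) (μ e) in
    + d⁺ G τ x - + d⁻ G τ x ≡ excess (σ G) μ x
  degree-difference μ x = begin
    + (m₁ Sign.+ ℕ.+ m₂ Sign.+) - + (m₁ Sign.- ℕ.+ m₂ Sign.-)
      ≡⟨ cong₂ _-_ (ℤ.pos-+ (m₁ Sign.+) _) (ℤ.pos-+ (m₁ Sign.-) _) ⟩
    (+ m₁ Sign.+ + + m₂ Sign.+) - (+ m₁ Sign.- + + m₂ Sign.-)
      ≡⟨ cong₂ (λ a b → a + b - (+ m₁ Sign.- + + m₂ Sign.-)) (difference (λ e → end₁ G e ≟ x) (λ e → mark₁ (τ e))) (difference (λ e → end₂ G e ≟ x) (λ e → mark₂ (τ e))) ⟩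
    (+ m₁ Sign.- + sum s₁) + (+ m₂ Sign.- + sum s₂) - (+ m₁ Sign.- + + m₂ Sign.-)
      ≡⟨ lem (+ m₁ Sign.-) (sum s₁) (+ m₂ Sign.-) (sum s₂) ⟩
    sum s₁ + sum s₂
      ≡⟨ sym (∑-distrib-+ s₁ s₂) ⟩
    sum (λ e → s₁ e + s₂ e)
      ≡⟨ sum-cong-≗ (λ e → trans
           (cong₂ (λ a b → 𝟙 ⌊ end₁ G e ≟ x ⌋ * a + 𝟙 ⌊ end₂ G e ≟ x ⌋ * b) (sgn-mark₁ (σ G e) (μ e)) (sgn-mark₂ (σ G e) (μ e)))
           (lem′ (𝟙 ⌊ end₁ G e ≟ x ⌋) (𝟙 ⌊ end₂ G e ≟ x ⌋) (sgn (μ e)) (sgn (σ G e)))) ⟩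
    excess (σ G) μ x ∎
    where
    open ≡-Reasoning
    τ : Orientation G
    τ e = orientation (σ G e) (μ e)
    marked : {P : Edge G → Set} → Decidable P → (Edge G → Sign) → Sign → ℕ
    marked P? m s = count (λ e → P? e ×-dec (m e Sign.≟ s)) (allFin (size G))
    m₁ m₂ : Sign → ℕ
    m₁ = marked (λ e → end₁ G e ≟ x) λ e → mark₁ (τ e)
    m₂ = marked (λ e → end₂ G e ≟ x) λ e → mark₂ (τ e)
    s₁ s₂ : Edge G → ℤ
    s₁ e = 𝟙 ⌊ end₁ G e ≟ x ⌋ * sgn (mark₁ (τ e))
    s₂ e = 𝟙 ⌊ end₂ G e ≟ x ⌋ * sgn (mark₂ (τ e))
    difference : {P : Edge G → Set} (P? : Decidable P) (m : Edge G → Sign) →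
      + marked P? m Sign.+ ≡ + marked P? m Sign.- + sum (λ e → 𝟙 ⌊ P? e ⌋ * sgn (m e))
    difference P? m = trans (count-tabulate (λ e → P? e ×-dec (m e Sign.≟ Sign.+)) id) (trans
      (sum-cong-≗ λ e → bit (P? e) (m e))
      (trans (∑-distrib-+ (λ e → 𝟙 (does (P? e ×-dec (m e Sign.≟ Sign.-)))) (λ e → 𝟙 ⌊ P? e ⌋ * sgn (m e)))
        (cong (_+ sum (λ e → 𝟙 ⌊ P? e ⌋ * sgn (m e))) (sym (count-tabulate (λ e → P? e ×-dec (m e Sign.≟ Sign.-)) id)))))
      where
      bit : {A : Set} (d : Dec A) (s : Sign) →
        𝟙 (does (d ×-dec (s Sign.≟ Sign.+))) ≡ 𝟙 (does (d ×-dec (s Sign.≟ Sign.-))) + 𝟙 ⌊ d ⌋ * sgn s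
      bit (yes _) Sign.+ = refl
      bit (yes _) Sign.- = refl
      bit (no _)  Sign.+ = refl
      bit (no _)  Sign.- = refl
    lem : ∀ a b c d → (a + b) + (c + d) - (a + c) ≡ b + d
    lem = solve-∀
    lem′ : ∀ u w m s → u * m + w * - (s * m) ≡ m * (u - s * w)
    lem′ = solve-∀

theorem3 : (k : ℕ) .{{_ : NonZero k}} (G : SignedGraph) →
    Unbalanced G (2 ℕ.* k ℕ.+ 1) (σ G) →
    EdgeConnected G (12 ℕ.* k ℕ.∸ 1) →
    (β : Vertex G → Fin (2 ℕ.* k ℕ.+ 1)) →
    ∃[ τ ] IsβOrientation G β τ
theorem3 k G unbalanced connected β = case realize (λ x → + toℕ (β x)) of λ (μ , met) →
  (λ e → orientation (σ G e) (μ e)) , λ x → case met x of λ (j , eq) → Signed.∣⇒∣ᵤ (Signed.divides j (begin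
    + d⁺ G (λ e → orientation (σ G e) (μ e)) x - + d⁻ G (λ e → orientation (σ G e) (μ e)) x - + toℕ (β x)
      ≡⟨ cong (_- + toℕ (β x)) (trans (degree-difference G μ x) eq) ⟩
    + toℕ (β x) + q * j - + toℕ (β x)
      ≡⟨ lem (+ toℕ (β x)) q j ⟩
    j * q ∎))
  where
  open ≡-Reasoning
  open Excess (graph G)
  p q K : ℤ
  p = + (2 ℕ.* k)
  q = + (2 ℕ.* k ℕ.+ 1)
  -- 2 (k + 1) = q + 1, so k + 1 is the inverse of 2 modulo q.
  K = + suc k
  lem : ∀ b q j → b + q * j - b ≡ j * q
  lem = solve-∀
  1≤k : 1 ℕ.≤ k
  1≤k = ℕ.>-nonZero⁻¹ k
  1≤p : 1ℤ ≤ p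
  1≤p = +≤+ (ℕ.≤-trans 1≤k (ℕ.m≤n*m k 2))
  q≡1+p : q ≡ 1ℤ + p
  q≡1+p = cong +_ (ℕ.+-comm (2 ℕ.* k) 1)
  2K≡q+1 : + 2 * K ≡ q + 1ℤ
  2K≡q+1 = trans (sym (ℤ.pos-* 2 (suc k))) (cong +_ (trans (ℕ.*-suc 2 k) (trans (ℕ.+-comm 2 (2 ℕ.* k)) (sym (ℕ.+-assoc (2 ℕ.* k) 1 1)))))
  6p≤ : + 6 * p ≤ 1ℤ + + (12 ℕ.* k ℕ.∸ 1)
  6p≤ = ℤ.≤-reflexive (trans (sym (ℤ.pos-* 6 (2 ℕ.* k))) (cong +_ (trans (sym (ℕ.*-assoc 6 2 k))
    (sym (ℕ.m+[n∸m]≡n (ℕ.≤-trans 1≤k (ℕ.m≤n*m k 12)))))))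
  instance
    q≢0 : NonZero (2 ℕ.* k ℕ.+ 1)
    q≢0 = ℕ.>-nonZero (ℕ.m≤n+m 1 (2 ℕ.* k))
  realizable : ∀ β → ¬ ¬ Realizable q (σ G) β
  -- `switches-realizable` needs every demand of the switched graph, since switching changes
  -- demands; so the double negation is removed for each β′ separately, inside the outer one.
  realizable β ¬real = ¬¬-minimum (λ vs → negativeEdges G (foldl (switch G) (σ G) vs)) [] λ (vs , minimal) →
    ¬real (switches-realizable {q} vs (σ G) (λ β′ → decidable-stable (realizable? (graph G) q (foldl (switch G) (σ G) vs) β′)
      (Core.realizable p q K 1≤p q≡1+p 2K≡q+1 (2 ℕ.* k ℕ.+ 1) refl (graph G) (foldl (switch G) (σ G) vs)
        (subst (q ≤_) (negatives (foldl (switch G) (σ G) vs)) (+≤+ (unbalanced _ (vs , λ _ → refl))))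
        (λ A x∈ z∉ → positive-cut (graph G) (foldl (switch G) (σ G) vs) A (+ (12 ℕ.* k ℕ.∸ 1)) p 6p≤
          (crossing-bound (graph G) connected A x∈ z∉) (minimal-cut (graph G) (σ G) vs minimal A))
        β′)) β)
  realize : ∀ β → Realizable q (σ G) β
  realize β = decidable-stable (realizable? (graph G) q (σ G) β) (realizable β)
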